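{- Let $F$ be a forest with at least one vertex. Then $F$ is a tree (i.e. connected) if and only if its chromatic symmetric function $X_F$ is irreducible in the ring $\Lambda$ of symmetric functions (over $\mathbb{C}$).
   Context: For a graph $G=(V,E)$ with $V=\{v_1,\dots,v_n\}$, a proper coloring is a map $\kappa:V\to\mathbb{N}$ with $\kappa(u)\ne\kappa(v)$ whenever $(u,v)\in E$. The chromatic symmetric function is $X_G=\sum_\kappa x_{\kappa(v_1)}\cdots x_{\kappa(v_n)}$, summed over proper colorings. $\Lambda$ is the ring of symmetric functions, which is the polynomial ring $\mathbb{C}[p_1,p_2,\dots]$ in the power sums $p_m=\sum_i x_i^m$. Irreducible means non-constant, non-unit, and not a product of two non-constant elements. -}

module Defs where

module ComplexNumbers where

  open import Algebra.Bundles using (CommutativeRing)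
  import Algebra.Consequences.Setoid as Consequences
  import Algebra.Properties.Ring as RingProperties
  import Algebra.Solver.Ring.NaturalCoefficients.Default as NaturalCoefficients
  import Relation.Binary.Reasoning.Setoid as SetoidReasoning
  open import Data.Nat as ℕ using (ℕ)
  import Data.Nat.Properties as ℕ
  open import Data.Product using (∃-syntax; _×_; _,_; proj₁; proj₂)
  open import Data.Rational as ℚ using (ℚ; 0ℚ; 1ℚ; ½; ∣_∣)
  import Data.Rational.Properties as ℚ
  open import Data.Rational.Solver using (module +-*-Solver)
  open import Level using (0ℓ)
  open import Relation.Binary using (IsEquivalence; Setoid)
  open import Relation.Binary.PropositionalEquality using (_≡_; refl; sym; trans; cong; cong₂; subst)

  -- Real numbers are Cauchy sequences of rationals; two are equal when their
  -- difference tends to 0.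
  Cauchy : (ℕ → ℚ) → Set
  Cauchy x = ∀ ε → 0ℚ ℚ.< ε →
    ∃[ N ] (∀ m n → N ℕ.≤ m → N ℕ.≤ n → ∣ x m ℚ.- x n ∣ ℚ.< ε)

  Null : (ℕ → ℚ) → Set
  Null z = ∀ ε → 0ℚ ℚ.< ε → ∃[ N ] (∀ n → N ℕ.≤ n → ∣ z n ∣ ℚ.< ε)

  record ℝ : Set where
    no-eta-equality
    constructor mkℝ
    field
      seq    : ℕ → ℚ
      cauchy : Cauchy seq

  open ℝ public

  infix 4 _≈ᴿ_
  record _≈ᴿ_ (x y : ℝ) : Set where
    no-eta-equality; pattern
    constructor mk≈
    field
      null : Null (λ n → seq x n ℚ.- seq y n)

  open _≈ᴿ_ public

  -- Cauchy and Null are one notion, for families indexed by ℕ × ℕ and by ℕ.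
  module Vanishing {I : Set} (Late : ℕ → I → Set)
    (late : ∀ {N M i} → N ℕ.≤ M → Late M i → Late N i) where

    record Small (z : I → ℚ) : Set where
      constructor mkSmall
      field
        small : ∀ ε → 0ℚ ℚ.< ε → ∃[ N ] (∀ i → Late N i → ∣ z i ∣ ℚ.< ε)

    open Small public

    record Bdd (b : I → ℚ) : Set where
      constructor mkBdd
      field
        bound   : ℚ
        bound>0 : 0ℚ ℚ.< bound
        from    : ℕ
        bdd     : ∀ i → Late from i → ∣ b i ∣ ℚ.≤ bound

    small-≡ : ∀ {w z} → (∀ i → w i ≡ z i) → Small w → Small z
    small-≡ {w} {z} eq (mkSmall s) = mkSmall λ ε ε>0 → go ε (s ε ε>0)
      where
      go : ∀ ε → ∃[ N ] (∀ i → Late N i → ∣ w i ∣ ℚ.< ε) →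
                 ∃[ N ] (∀ i → Late N i → ∣ z i ∣ ℚ.< ε)
      go ε (N , f) = N , λ i l → subst (λ q → ∣ q ∣ ℚ.< ε) (eq i) (f i l)

    small-0 : ∀ {z} → (∀ i → z i ≡ 0ℚ) → Small z
    small-0 eq = mkSmall λ ε ε>0 → 0 , λ i _ → subst (λ q → ∣ q ∣ ℚ.< ε) (sym (eq i)) ε>0

    small-+ : ∀ {w z} → Small w → Small z → Small (λ i → w i ℚ.+ z i)
    small-+ {w} {z} (mkSmall s) (mkSmall t) = mkSmall main
      where
      module _ (ε : ℚ) (ε>0 : 0ℚ ℚ.< ε) where
        h>0 : 0ℚ ℚ.< ½ ℚ.* ε
        h>0 = subst (ℚ._< ½ ℚ.* ε) (ℚ.*-zeroʳ ½) (ℚ.*-monoʳ-<-pos ½ ε>0)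
        halves : ½ ℚ.* ε ℚ.+ ½ ℚ.* ε ≡ ε
        halves = trans (sym (ℚ.*-distribʳ-+ ε ½ ½)) (ℚ.*-identityˡ ε)
        go : ∃[ N ] (∀ i → Late N i → ∣ w i ∣ ℚ.< ½ ℚ.* ε) →
             ∃[ N ] (∀ i → Late N i → ∣ z i ∣ ℚ.< ½ ℚ.* ε) →
             ∃[ N ] (∀ i → Late N i → ∣ w i ℚ.+ z i ∣ ℚ.< ε)
        go (N , f) (M , g) = N ℕ.⊔ M , λ i l → ℚ.≤-<-trans
          (ℚ.∣p+q∣≤∣p∣+∣q∣ (w i) (z i))
          (subst (_ ℚ.<_) halves
            (ℚ.+-mono-< (f i (late (ℕ.m≤m⊔n N M) l)) (g i (late (ℕ.m≤n⊔m N M) l))))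
        main : ∃[ K ] (∀ i → Late K i → ∣ w i ℚ.+ z i ∣ ℚ.< ε)
        main = go (s (½ ℚ.* ε) h>0) (t (½ ℚ.* ε) h>0)

    small-neg : ∀ {z} → Small z → Small (λ i → ℚ.- z i)
    small-neg {z} (mkSmall s) = mkSmall λ ε ε>0 → go ε (s ε ε>0)
      where
      go : ∀ ε → ∃[ N ] (∀ i → Late N i → ∣ z i ∣ ℚ.< ε) →
                 ∃[ N ] (∀ i → Late N i → ∣ ℚ.- z i ∣ ℚ.< ε)
      go ε (N , f) = N , λ i l → subst (ℚ._< ε) (sym (ℚ.∣-p∣≡∣p∣ (z i))) (f i l)

    small-* : ∀ {b z} → Bdd b → Small z → Small (λ i → b i ℚ.* z i)
    small-* {b} {z} (mkBdd B B>0 M bdd) (mkSmall s) = mkSmall λ ε ε>0 →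
      go ε (s (δ ε) (δ>0 ε ε>0))
      where
      instance
        B-pos = ℚ.positive B>0
        B-nn  = ℚ.pos⇒nonNeg B
        B-nz  = ℚ.pos⇒nonZero B
        1/B-pos = ℚ.1/pos⇒pos B
      δ : ℚ → ℚ
      δ ε = (ℚ.1/ B) ℚ.* ε
      δ>0 : ∀ ε → 0ℚ ℚ.< ε → 0ℚ ℚ.< δ ε
      δ>0 ε ε>0 = subst (ℚ._< δ ε) (ℚ.*-zeroʳ (ℚ.1/ B)) (ℚ.*-monoʳ-<-pos (ℚ.1/ B) ε>0)
      Bδ : ∀ ε → B ℚ.* δ ε ≡ ε
      Bδ ε = trans (sym (ℚ.*-assoc B (ℚ.1/ B) ε))
             (trans (cong (ℚ._* ε) (ℚ.*-inverseʳ B)) (ℚ.*-identityˡ ε))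
      go : ∀ ε → ∃[ N ] (∀ i → Late N i → ∣ z i ∣ ℚ.< δ ε) →
                 ∃[ N ] (∀ i → Late N i → ∣ b i ℚ.* z i ∣ ℚ.< ε)
      go ε (N , f) = N ℕ.⊔ M , λ i l → begin-strict
        ∣ b i ℚ.* z i ∣     ≡⟨ ℚ.∣p*q∣≡∣p∣*∣q∣ (b i) (z i) ⟩
        ∣ b i ∣ ℚ.* ∣ z i ∣ ≤⟨ ℚ.*-monoʳ-≤-nonNeg ∣ z i ∣ {{ℚ.∣-∣-nonNeg (z i)}}
                                 (bdd i (late (ℕ.m≤n⊔m N M) l)) ⟩
        B ℚ.* ∣ z i ∣       <⟨ ℚ.*-monoʳ-<-pos B (f i (late (ℕ.m≤m⊔n N M) l)) ⟩
        B ℚ.* δ ε           ≡⟨ Bδ ε ⟩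
        ε                   ∎
        where open ℚ.≤-Reasoning

  module V₁ = Vanishing {ℕ} ℕ._≤_ ℕ.≤-trans
  module V₂ = Vanishing {ℕ × ℕ} (λ N (m , n) → N ℕ.≤ m × N ℕ.≤ n)
                (λ le (p , q) → ℕ.≤-trans le p , ℕ.≤-trans le q)

  toCauchy : ∀ x → V₂.Small (λ (m , n) → x m ℚ.- x n) → Cauchy x
  toCauchy x (V₂.mkSmall s) ε ε>0 = go (s ε ε>0)
    where
    go : ∃[ N ] (∀ i → N ℕ.≤ proj₁ i × N ℕ.≤ proj₂ i →
                 ∣ x (proj₁ i) ℚ.- x (proj₂ i) ∣ ℚ.< ε) →
         ∃[ N ] (∀ m n → N ℕ.≤ m → N ℕ.≤ n → ∣ x m ℚ.- x n ∣ ℚ.< ε)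
    go (N , f) = N , λ m n p q → f (m , n) (p , q)

  fromCauchy : ∀ x → V₂.Small (λ (m , n) → seq x m ℚ.- seq x n)
  fromCauchy x = V₂.mkSmall λ ε ε>0 → go ε (cauchy x ε ε>0)
    where
    go : ∀ ε → ∃[ N ] (∀ m n → N ℕ.≤ m → N ℕ.≤ n → ∣ seq x m ℚ.- seq x n ∣ ℚ.< ε) →
         ∃[ N ] (∀ i → N ℕ.≤ proj₁ i × N ℕ.≤ proj₂ i →
                 ∣ seq x (proj₁ i) ℚ.- seq x (proj₂ i) ∣ ℚ.< ε)
    go ε (N , f) = N , λ (m , n) (p , q) → f m n p q

  fromSmall : ∀ x → V₂.Small (λ (m , n) → x m ℚ.- x n) → ℝ
  fromSmall x s = mkℝ x (toCauchy x s)

  toNull : ∀ {x y} → V₁.Small (λ n → seq x n ℚ.- seq y n) → x ≈ᴿ y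
  toNull (V₁.mkSmall s) = mk≈ s

  fromNull : ∀ {x y} → x ≈ᴿ y → V₁.Small (λ n → seq x n ℚ.- seq y n)
  fromNull (mk≈ s) = V₁.mkSmall s

  bound>0 : ∀ c q → 0ℚ ℚ.< c → 0ℚ ℚ.< c ℚ.+ ∣ q ∣
  bound>0 c q c>0 = ℚ.positive⁻¹ (c ℚ.+ ∣ q ∣)
    {{ℚ.pos+nonNeg⇒pos c {{ℚ.positive c>0}} ∣ q ∣ {{ℚ.∣-∣-nonNeg q}}}}

  close⇒bounded : ∀ p q c → ∣ p ℚ.- q ∣ ℚ.< c → ∣ p ∣ ℚ.≤ c ℚ.+ ∣ q ∣
  close⇒bounded p q c lt = begin
    ∣ p ∣               ≡⟨ cong ∣_∣ (split p q) ⟨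
    ∣ (p ℚ.- q) ℚ.+ q ∣ ≤⟨ ℚ.∣p+q∣≤∣p∣+∣q∣ (p ℚ.- q) q ⟩
    ∣ p ℚ.- q ∣ ℚ.+ ∣ q ∣ ≤⟨ ℚ.+-monoˡ-≤ ∣ q ∣ {∣ p ℚ.- q ∣} {c} (ℚ.<⇒≤ lt) ⟩
    c ℚ.+ ∣ q ∣         ∎
    where
    open ℚ.≤-Reasoning
    split : ∀ p q → (p ℚ.- q) ℚ.+ q ≡ p
    split = solve 2 (λ p q → (p :- q) :+ q := p) refl
      where open +-*-Solver

  bounded : ∀ x → V₁.Bdd (seq x)
  bounded x = go 1ℚ (ℚ.positive⁻¹ 1ℚ)
    where
    go : ∀ c → 0ℚ ℚ.< c → V₁.Bdd (seq x)
    go c c>0 = fin (cauchy x c c>0)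
      where
      fin : ∃[ N ] (∀ m n → N ℕ.≤ m → N ℕ.≤ n → ∣ seq x m ℚ.- seq x n ∣ ℚ.< c) →
            V₁.Bdd (seq x)
      fin (N , f) = V₁.mkBdd (c ℚ.+ ∣ seq x N ∣) (bound>0 c (seq x N) c>0) N
        λ n l → close⇒bounded (seq x n) (seq x N) c (f n N l ℕ.≤-refl)

  on₁ : ∀ {b} → V₁.Bdd b → V₂.Bdd (λ (m , _) → b m)
  on₁ (V₁.mkBdd B B>0 N f) = V₂.mkBdd B B>0 N λ (m , _) (p , _) → f m p

  on₂ : ∀ {b} → V₁.Bdd b → V₂.Bdd (λ (_ , n) → b n)
  on₂ (V₁.mkBdd B B>0 N f) = V₂.mkBdd B B>0 N λ (_ , n) (_ , q) → f n q

  +-diff : ∀ a b c d → (a ℚ.- c) ℚ.+ (b ℚ.- d) ≡ (a ℚ.+ b) ℚ.- (c ℚ.+ d)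
  +-diff = solve 4 (λ a b c d → (a :- c) :+ (b :- d) := (a :+ b) :- (c :+ d)) refl
    where open +-*-Solver

  *-diff : ∀ a b c d → a ℚ.* (b ℚ.- d) ℚ.+ d ℚ.* (a ℚ.- c) ≡ a ℚ.* b ℚ.- c ℚ.* d
  *-diff = solve 4 (λ a b c d → a :* (b :- d) :+ d :* (a :- c) := a :* b :- c :* d) refl
    where open +-*-Solver

  neg-diff : ∀ a c → ℚ.- (a ℚ.- c) ≡ (ℚ.- a) ℚ.- (ℚ.- c)
  neg-diff = solve 2 (λ a c → :- (a :- c) := (:- a) :- (:- c)) refl
    where open +-*-Solver

  pointwise : ∀ x y → (∀ n → seq x n ≡ seq y n) → x ≈ᴿ y
  pointwise x y eq = toNull (V₁.small-0 λ n →
    trans (cong (ℚ._- seq y n) (eq n)) (ℚ.+-inverseʳ (seq y n)))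

  ≈ᴿ-isEquivalence : IsEquivalence _≈ᴿ_
  ≈ᴿ-isEquivalence = record
    { refl  = pointwise _ _ (λ _ → refl)
    ; sym   = λ {x} {y} e → toNull (V₁.small-≡ (λ n → flip (seq x n) (seq y n)) (V₁.small-neg (fromNull e)))
    ; trans = λ {x} {y} {z} e f → toNull (V₁.small-≡
        (λ n → glue (seq x n) (seq y n) (seq z n)) (V₁.small-+ (fromNull e) (fromNull f)))
    }
    where
    open +-*-Solver
    flip : ∀ a b → ℚ.- (a ℚ.- b) ≡ b ℚ.- a
    flip = solve 2 (λ a b → :- (a :- b) := b :- a) refl
    glue : ∀ a b c → (a ℚ.- b) ℚ.+ (b ℚ.- c) ≡ a ℚ.- c
    glue = solve 3 (λ a b c → (a :- b) :+ (b :- c) := a :- c) refl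

  infixl 6 _+ᴿ_
  infixl 7 _*ᴿ_
  infix  8 -ᴿ_

  -- Opaque because the type checker otherwise unfolds rational arithmetic.
  opaque
    _+ᴿ_ _*ᴿ_ : ℝ → ℝ → ℝ
    x +ᴿ y = fromSmall (λ n → seq x n ℚ.+ seq y n) (V₂.small-≡
      (λ (m , n) → +-diff (seq x m) (seq y m) (seq x n) (seq y n))
      (V₂.small-+ (fromCauchy x) (fromCauchy y)))
    x *ᴿ y = fromSmall (λ n → seq x n ℚ.* seq y n) (V₂.small-≡
      (λ (m , n) → *-diff (seq x m) (seq y m) (seq x n) (seq y n))
      (V₂.small-+ (V₂.small-* (on₁ (bounded x)) (fromCauchy y))
                  (V₂.small-* (on₂ (bounded y)) (fromCauchy x))))

    -ᴿ_ : ℝ → ℝ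
    -ᴿ x = fromSmall (λ n → ℚ.- seq x n) (V₂.small-≡
      (λ (m , n) → neg-diff (seq x m) (seq x n)) (V₂.small-neg (fromCauchy x)))

    fromℚ : ℚ → ℝ
    fromℚ q = fromSmall (λ _ → q) (V₂.small-0 (λ _ → ℚ.+-inverseʳ q))

    0ᴿ 1ᴿ : ℝ
    0ᴿ = fromℚ 0ℚ
    1ᴿ = fromℚ 1ℚ

    +ᴿ-cong : ∀ {x x′ y y′} → x ≈ᴿ x′ → y ≈ᴿ y′ → x +ᴿ y ≈ᴿ x′ +ᴿ y′
    +ᴿ-cong {x} {x′} {y} {y′} e f = toNull (V₁.small-≡
      (λ n → +-diff (seq x n) (seq y n) (seq x′ n) (seq y′ n)) (V₁.small-+ (fromNull e) (fromNull f)))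

    *ᴿ-cong : ∀ {x x′ y y′} → x ≈ᴿ x′ → y ≈ᴿ y′ → x *ᴿ y ≈ᴿ x′ *ᴿ y′
    *ᴿ-cong {x} {x′} {y} {y′} e f = toNull (V₁.small-≡
      (λ n → *-diff (seq x n) (seq y n) (seq x′ n) (seq y′ n))
      (V₁.small-+ (V₁.small-* (bounded x) (fromNull f)) (V₁.small-* (bounded y′) (fromNull e))))

    -ᴿ-cong : ∀ {x x′} → x ≈ᴿ x′ → -ᴿ x ≈ᴿ -ᴿ x′
    -ᴿ-cong {x} {x′} e = toNull (V₁.small-≡
      (λ n → neg-diff (seq x n) (seq x′ n)) (V₁.small-neg (fromNull e)))

    +ᴿ-assoc : ∀ x y z → (x +ᴿ y) +ᴿ z ≈ᴿ x +ᴿ (y +ᴿ z)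
    +ᴿ-assoc x y z = pointwise ((x +ᴿ y) +ᴿ z) (x +ᴿ (y +ᴿ z))
      λ n → ℚ.+-assoc (seq x n) (seq y n) (seq z n)

    +ᴿ-comm : ∀ x y → x +ᴿ y ≈ᴿ y +ᴿ x
    +ᴿ-comm x y = pointwise (x +ᴿ y) (y +ᴿ x) λ n → ℚ.+-comm (seq x n) (seq y n)

    +ᴿ-identityˡ : ∀ x → 0ᴿ +ᴿ x ≈ᴿ x
    +ᴿ-identityˡ x = pointwise (0ᴿ +ᴿ x) x λ n → ℚ.+-identityˡ (seq x n)

    -ᴿ-inverseˡ : ∀ x → (-ᴿ x) +ᴿ x ≈ᴿ 0ᴿ
    -ᴿ-inverseˡ x = pointwise ((-ᴿ x) +ᴿ x) 0ᴿ λ n → ℚ.+-inverseˡ (seq x n)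

    *ᴿ-assoc : ∀ x y z → (x *ᴿ y) *ᴿ z ≈ᴿ x *ᴿ (y *ᴿ z)
    *ᴿ-assoc x y z = pointwise ((x *ᴿ y) *ᴿ z) (x *ᴿ (y *ᴿ z))
      λ n → ℚ.*-assoc (seq x n) (seq y n) (seq z n)

    *ᴿ-comm : ∀ x y → x *ᴿ y ≈ᴿ y *ᴿ x
    *ᴿ-comm x y = pointwise (x *ᴿ y) (y *ᴿ x) λ n → ℚ.*-comm (seq x n) (seq y n)

    *ᴿ-identityˡ : ∀ x → 1ᴿ *ᴿ x ≈ᴿ x
    *ᴿ-identityˡ x = pointwise (1ᴿ *ᴿ x) x λ n → ℚ.*-identityˡ (seq x n)

    *ᴿ-distribˡ-+ᴿ : ∀ x y z → x *ᴿ (y +ᴿ z) ≈ᴿ x *ᴿ y +ᴿ x *ᴿ z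
    *ᴿ-distribˡ-+ᴿ x y z = pointwise (x *ᴿ (y +ᴿ z)) (x *ᴿ y +ᴿ x *ᴿ z)
      λ n → ℚ.*-distribˡ-+ (seq x n) (seq y n) (seq z n)

  ℝ-commutativeRing : CommutativeRing 0ℓ 0ℓ
  ℝ-commutativeRing = record
    { Carrier = ℝ ; _≈_ = _≈ᴿ_ ; _+_ = _+ᴿ_ ; _*_ = _*ᴿ_ ; -_ = -ᴿ_ ; 0# = 0ᴿ ; 1# = 1ᴿ
    ; isCommutativeRing = record
      { isRing = record
        { +-isAbelianGroup = record
          { isGroup = record
            { isMonoid = record
              { isSemigroup = record
                { isMagma = record { isEquivalence = ≈ᴿ-isEquivalence ; ∙-cong = +ᴿ-cong }
                ; assoc = +ᴿ-assoc
                }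
              ; identity = comm∧idˡ⇒id +ᴿ-comm +ᴿ-identityˡ
              }
            ; inverse = comm∧invˡ⇒inv +ᴿ-comm -ᴿ-inverseˡ
            ; ⁻¹-cong = -ᴿ-cong
            }
          ; comm = +ᴿ-comm
          }
        ; *-cong = *ᴿ-cong
        ; *-assoc = *ᴿ-assoc
        ; *-identity = comm∧idˡ⇒id *ᴿ-comm *ᴿ-identityˡ
        ; distrib = comm∧distrˡ⇒distr +ᴿ-cong *ᴿ-comm *ᴿ-distribˡ-+ᴿ
        }
      ; *-comm = *ᴿ-comm
      }
    }
    where
    ℝ-setoid : Setoid 0ℓ 0ℓ
    ℝ-setoid = record { isEquivalence = ≈ᴿ-isEquivalence }
    open Consequences ℝ-setoid

  record ℂ : Set where
    constructor _+i_
    field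
      re im : ℝ

  open ℂ public

  infix 4 _≈ᶜ_
  record _≈ᶜ_ (z w : ℂ) : Set where
    constructor _,_
    field
      re≈ : re z ≈ᴿ re w
      im≈ : im z ≈ᴿ im w

  open _≈ᶜ_ public

  infixl 6 _+ᶜ_
  infixl 7 _*ᶜ_
  infix  8 -ᶜ_

  _+ᶜ_ _*ᶜ_ : ℂ → ℂ → ℂ
  (a +i b) +ᶜ (c +i d) = (a +ᴿ c) +i (b +ᴿ d)
  (a +i b) *ᶜ (c +i d) = (a *ᴿ c +ᴿ -ᴿ (b *ᴿ d)) +i (a *ᴿ d +ᴿ b *ᴿ c)

  -ᶜ_ : ℂ → ℂ
  -ᶜ (a +i b) = (-ᴿ a) +i (-ᴿ b)

  0ᶜ 1ᶜ : ℂ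
  0ᶜ = 0ᴿ +i 0ᴿ
  1ᶜ = 1ᴿ +i 0ᴿ

  private
    module ComplexLaws {c ℓ} (R : CommutativeRing c ℓ) where
      open CommutativeRing R renaming (refl to ≈-refl; sym to ≈-sym; trans to ≈-trans)
      open RingProperties ring using (-1*x≈-x)
      open NaturalCoefficients commutativeSemiring using (solve; _:=_; _:+_; _:*_)
      open SetoidReasoning setoid

      -- The solver knows no negation: treat - 1# as a variable m.
      private
        m : Carrier
        m = - 1#

        sub : ∀ {x y z} → y ≈ z → x + - y ≈ x + m * z
        sub {x} {y} {z} e = +-congˡ (≈-trans (≈-sym (-1*x≈-x y)) (*-congˡ e))

        subst-sub : ∀ {x x′ y y′} → x ≈ x′ → y ≈ y′ → x + - y ≈ x′ + m * y′
        subst-sub p q = ≈-trans (sub q) (+-congʳ p)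

      assoc-re : ∀ a b c d e f →
        (a * c + - (b * d)) * e + - ((a * d + b * c) * f)
          ≈ a * (c * e + - (d * f)) + - (b * (c * f + d * e))
      assoc-re a b c d e f = begin
        (a * c + - (b * d)) * e + - ((a * d + b * c) * f)
          ≈⟨ subst-sub (*-congʳ (sub ≈-refl)) ≈-refl ⟩
        (a * c + m * (b * d)) * e + m * ((a * d + b * c) * f)
          ≈⟨ solve 7 (λ a b c d e f m →
               (a :* c :+ m :* (b :* d)) :* e :+ m :* ((a :* d :+ b :* c) :* f)
            := a :* (c :* e :+ m :* (d :* f)) :+ m :* (b :* (c :* f :+ d :* e)))
               ≈-refl a b c d e f m ⟩
        a * (c * e + m * (d * f)) + m * (b * (c * f + d * e))
          ≈⟨ subst-sub (*-congˡ (sub ≈-refl)) ≈-refl ⟨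
        a * (c * e + - (d * f)) + - (b * (c * f + d * e)) ∎

      assoc-im : ∀ a b c d e f →
        (a * c + - (b * d)) * f + (a * d + b * c) * e
          ≈ a * (c * f + d * e) + b * (c * e + - (d * f))
      assoc-im a b c d e f = begin
        (a * c + - (b * d)) * f + (a * d + b * c) * e
          ≈⟨ +-congʳ (*-congʳ (sub ≈-refl)) ⟩
        (a * c + m * (b * d)) * f + (a * d + b * c) * e
          ≈⟨ solve 7 (λ a b c d e f m →
               (a :* c :+ m :* (b :* d)) :* f :+ (a :* d :+ b :* c) :* e
            := a :* (c :* f :+ d :* e) :+ b :* (c :* e :+ m :* (d :* f)))
               ≈-refl a b c d e f m ⟩
        a * (c * f + d * e) + b * (c * e + m * (d * f))
          ≈⟨ +-congˡ (*-congˡ (sub ≈-refl)) ⟨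
        a * (c * f + d * e) + b * (c * e + - (d * f)) ∎

      distrib-re : ∀ a b c d e f →
        a * (c + e) + - (b * (d + f)) ≈ (a * c + - (b * d)) + (a * e + - (b * f))
      distrib-re a b c d e f = begin
        a * (c + e) + - (b * (d + f))
          ≈⟨ sub ≈-refl ⟩
        a * (c + e) + m * (b * (d + f))
          ≈⟨ solve 7 (λ a b c d e f m →
               a :* (c :+ e) :+ m :* (b :* (d :+ f))
            := (a :* c :+ m :* (b :* d)) :+ (a :* e :+ m :* (b :* f)))
               ≈-refl a b c d e f m ⟩
        (a * c + m * (b * d)) + (a * e + m * (b * f))
          ≈⟨ +-cong (sub ≈-refl) (sub ≈-refl) ⟨
        (a * c + - (b * d)) + (a * e + - (b * f)) ∎

      distrib-im : ∀ a b c d e f →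
        a * (d + f) + b * (c + e) ≈ (a * d + b * c) + (a * f + b * e)
      distrib-im = solve 6 (λ a b c d e f →
        a :* (d :+ f) :+ b :* (c :+ e) := (a :* d :+ b :* c) :+ (a :* f :+ b :* e)) ≈-refl

  ℂ-commutativeRing : CommutativeRing 0ℓ 0ℓ
  ℂ-commutativeRing = record
    { Carrier = ℂ ; _≈_ = _≈ᶜ_ ; _+_ = _+ᶜ_ ; _*_ = _*ᶜ_ ; -_ = -ᶜ_ ; 0# = 0ᶜ ; 1# = 1ᶜ
    ; isCommutativeRing = record
      { isRing = record
        { +-isAbelianGroup = record
          { isGroup = record
            { isMonoid = record
              { isSemigroup = record
                { isMagma = record
                  { isEquivalence = record
                    { refl  = R.refl , R.refl
                    ; sym   = λ (p , q) → R.sym p , R.sym q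
                    ; trans = λ (p , q) (r , s) → R.trans p r , R.trans q s
                    }
                  ; ∙-cong = λ (p , q) (r , s) → R.+-cong p r , R.+-cong q s
                  }
                ; assoc = λ _ _ _ → R.+-assoc _ _ _ , R.+-assoc _ _ _
                }
              ; identity = (λ _ → R.+-identityˡ _ , R.+-identityˡ _)
                         , (λ _ → R.+-identityʳ _ , R.+-identityʳ _)
              }
            ; inverse = (λ _ → R.-‿inverseˡ _ , R.-‿inverseˡ _)
                      , (λ _ → R.-‿inverseʳ _ , R.-‿inverseʳ _)
            ; ⁻¹-cong = λ (p , q) → R.-‿cong p , R.-‿cong q
            }
          ; comm = λ _ _ → R.+-comm _ _ , R.+-comm _ _
          }
        ; *-cong = λ (p , q) (r , s) →
              R.+-cong (R.*-cong p r) (R.-‿cong (R.*-cong q s))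
            , R.+-cong (R.*-cong p s) (R.*-cong q r)
        ; *-assoc = *-assoc
        ; *-identity = *-identityˡ , λ z → ≈-trans (*-comm z 1ᶜ) (*-identityˡ z)
        ; distrib = *-distribˡ , λ z x y → ≈-trans (*-comm (x +ᶜ y) z)
            (≈-trans (*-distribˡ z x y) (+-cong (*-comm z x) (*-comm z y)))
        }
      ; *-comm = *-comm
      }
    }
    where
    module R = CommutativeRing ℝ-commutativeRing
    open RingProperties R.ring using (-0#≈0#)
    open ComplexLaws ℝ-commutativeRing

    ≈-trans : ∀ {x y z} → x ≈ᶜ y → y ≈ᶜ z → x ≈ᶜ z
    ≈-trans (p , q) (r , s) = R.trans p r , R.trans q s

    +-cong : ∀ {x x′ y y′} → x ≈ᶜ x′ → y ≈ᶜ y′ → x +ᶜ y ≈ᶜ x′ +ᶜ y′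
    +-cong (p , q) (r , s) = R.+-cong p r , R.+-cong q s

    *-comm : ∀ z w → z *ᶜ w ≈ᶜ w *ᶜ z
    *-comm (a +i b) (c +i d) =
        R.+-cong (R.*-comm a c) (R.-‿cong (R.*-comm b d))
      , R.trans (R.+-comm _ _) (R.+-cong (R.*-comm b c) (R.*-comm a d))

    *-identityˡ : ∀ z → 1ᶜ *ᶜ z ≈ᶜ z
    *-identityˡ (a +i b) =
        R.trans (R.+-cong (R.*-identityˡ a) (R.trans (R.-‿cong (R.zeroˡ b)) -0#≈0#)) (R.+-identityʳ a)
      , R.trans (R.+-cong (R.*-identityˡ b) (R.zeroˡ a)) (R.+-identityʳ b)

    *-assoc : ∀ x y z → (x *ᶜ y) *ᶜ z ≈ᶜ x *ᶜ (y *ᶜ z)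
    *-assoc (a +i b) (c +i d) (e +i f) = assoc-re a b c d e f , assoc-im a b c d e f

    *-distribˡ : ∀ x y z → x *ᶜ (y +ᶜ z) ≈ᶜ x *ᶜ y +ᶜ x *ᶜ z
    *-distribˡ (a +i b) (c +i d) (e +i f) = distrib-re a b c d e f , distrib-im a b c d e f

open ComplexNumbers public using (ℂ-commutativeRing)

open import Algebra.Bundles using (CommutativeRing)
import Algebra.Properties.CommutativeMonoid.Sum as Sum
open import Algebra.Properties.CommutativeSemigroup using (interchange)
import Algebra.Properties.Semiring.Mult as Mult
open import Data.Bool using (if_then_else_; true; false)
open import Data.Empty using (⊥; ⊥-elim)
open import Data.Fin as Fin using (Fin; zero; suc; toℕ; inject₁; fromℕ; finToFun; funToFin)
import Data.Fin.Permutation as Perm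
import Data.Fin.Properties as Fin
open import Data.List using (List; []; _∷_; [_]; _++_; length; lookup; filter; allFin)
open import Data.List.Membership.Propositional using (_∈_)
open import Data.List.Membership.Propositional.Properties
  using (∈-filter⁺; ∈-filter⁻; ∈-allFin; ∈-lookup)
open import Data.List.Membership.Setoid.Properties using (index-injective)
open import Data.List.Properties using (filter-none; filter-≐; length-tabulate)
open import Data.List.Relation.Binary.Permutation.Propositional as ↭
  using (_↭_; ↭-sym; ↭⇒↭ₛ; refl; prep; swap; trans)
open import Data.List.Relation.Binary.Permutation.Propositional.Properties using (∷↭∷ʳ)
import Data.List.Relation.Binary.Permutation.Homogeneous as ↭ₕ
import Data.List.Relation.Binary.Permutation.Setoid.Properties as ↭ₛ
import Data.List.Relation.Unary.All as All
open import Data.List.Relation.Unary.AllPairs using ([]; _∷_)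
open import Data.List.Relation.Unary.Any using (index)
open import Data.List.Relation.Unary.Unique.Propositional using (Unique)
import Data.List.Relation.Unary.Unique.Propositional.Properties as Unique
open import Data.Nat as ℕ using (ℕ; zero; suc)
open import Data.Nat.ListAction using (sum)
open import Data.Nat.ListAction.Properties using (sum-++; sum-↭)
import Data.Nat.Properties as ℕ
open import Data.Product using (Σ-syntax; ∃; ∃-syntax; _×_; _,_; proj₁; proj₂)
open import Data.Sum using (_⊎_; inj₁; inj₂; [_,_]′)
open import Function using (_∘_; Injective)
open import Function.Bundles using (Inverse)
open import Level using (Level; _⊔_)
open import Relation.Binary using (Decidable; Symmetric; Irreflexive)
open import Relation.Binary.Construct.Closure.ReflexiveTransitive using (Star)
open import Relation.Binary.PropositionalEquality as ≡ using (_≡_; _≢_; _≗_; cong; cong₂; subst)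
import Relation.Binary.Reasoning.Setoid as SetoidReasoning
open import Relation.Nullary using (¬_; Dec; yes; no; contradiction; does)
open import Relation.Nullary.Decidable using (_×-dec_; _→-dec_; ¬?)
import Relation.Unary as U

-- Finite simple graphs with vertex set Fin n.

record Graph (n : ℕ) : Set₁ where
  field
    Adj        : Fin n → Fin n → Set
    adj?       : Decidable Adj
    adj-sym    : Symmetric Adj
    adj-irrefl : Irreflexive _≡_ Adj

open Graph public

Connected : ∀ {n} → Graph n → Set
Connected G = ∀ u v → Star (Adj G) u v

-- A cycle of length 3 + k.
record Cycle {n} (G : Graph n) : Set where
  field
    k        : ℕ
    vertex   : Fin (3 ℕ.+ k) → Fin n
    distinct : Injective _≡_ _≡_ vertex
    step     : ∀ i → Adj G (vertex (inject₁ i)) (vertex (suc i))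
    close    : Adj G (vertex (fromℕ (2 ℕ.+ k))) (vertex zero)

IsForest : ∀ {n} → Graph n → Set
IsForest G = ¬ Cycle G

IsTree : ∀ {n} → Graph n → Set
IsTree G = IsForest G × Connected G

Proper : ∀ {n N} → Graph n → (Fin n → Fin N) → Set
Proper G κ = ∀ u v → Adj G u v → κ u ≢ κ v

proper? : ∀ {n N} (G : Graph n) (κ : Fin n → Fin N) → Dec (Proper G κ)
proper? G κ = Fin.all? λ u → Fin.all? λ v → adj? G u v →-dec ¬? (κ u Fin.≟ κ v)

count : ∀ {n p} {P : U.Pred (Fin n) p} → U.Decidable P → ℕ
count {n} P? = length (filter P? (allFin n))

-- The list α = [ a₀ , … , aₖ ] stands for the monomial x₀^a₀ ⋯ xₖ^aₖ.  A colouring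
-- whose monomial x_κ(v₁) ⋯ x_κ(vₙ) is this one only uses the colours 0, …, k.
HasContent : ∀ {n} (α : List ℕ) → (Fin n → Fin (length α)) → Set
HasContent α κ = ∀ i → count (λ v → κ v Fin.≟ i) ≡ lookup α i

hasContent? : ∀ {n} (α : List ℕ) (κ : Fin n → Fin (length α)) → Dec (HasContent α κ)
hasContent? α κ = Fin.all? λ i → count (λ v → κ v Fin.≟ i) ℕ.≟ lookup α i

ProperWithContent : ∀ {n} → Graph n → (α : List ℕ) → (Fin n → Fin (length α)) → Set
ProperWithContent G α κ = Proper G κ × HasContent α κ

properWithContent? : ∀ {n} (G : Graph n) α κ → Dec (ProperWithContent G α κ)
properWithContent? G α κ = proper? G κ ×-dec hasContent? α κ

-- finToFun : Fin (N ^ n) → (Fin n → Fin N) enumerates all maps.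
#colorings : ∀ {n} → Graph n → List ℕ → ℕ
#colorings {n} G α =
  count (λ (c : Fin (length α ℕ.^ n)) → properWithContent? G α (finToFun c))

lookup-injective : ∀ {a} {A : Set a} {xs : List A} → Unique xs →
                   ∀ i j → lookup xs i ≡ lookup xs j → i ≡ j
lookup-injective (_ ∷ _) zero zero _ = ≡.refl
lookup-injective (x∉ ∷ _) zero (suc j) eq = contradiction eq (All.lookup x∉ (∈-lookup j))
lookup-injective (x∉ ∷ _) (suc i) zero eq = contradiction (≡.sym eq) (All.lookup x∉ (∈-lookup i))
lookup-injective (_ ∷ u) (suc i) (suc j) eq = cong suc (lookup-injective u i j eq)

count-mono : ∀ {a b p q} {P : U.Pred (Fin a) p} {Q : U.Pred (Fin b) q}
  (P? : U.Decidable P) (Q? : U.Decidable Q) (f : ∀ i → P i → Fin b) →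
  (∀ i p → Q (f i p)) → (∀ i j p q → f i p ≡ f j q → i ≡ j) →
  count P? ℕ.≤ count Q?
count-mono {a} {b} {P = P} {Q} P? Q? f f∈ f-inj = Fin.injective⇒≤ g-inj
  where
  xs = filter P? (allFin a)
  ys = filter Q? (allFin b)
  P∈ : ∀ i → P (lookup xs i)
  P∈ i = proj₂ (∈-filter⁻ P? {xs = allFin a} (∈-lookup {xs = xs} i))
  mem : ∀ i → f (lookup xs i) (P∈ i) ∈ ys
  mem i = ∈-filter⁺ Q? (∈-allFin _) (f∈ _ (P∈ i))
  g : Fin (length xs) → Fin (length ys)
  g i = index (mem i)
  g-inj : Injective _≡_ _≡_ g
  g-inj {i} {j} eq = lookup-injective (Unique.filter⁺ P? (Unique.allFin⁺ a)) i j
    (f-inj _ _ (P∈ i) (P∈ j) (index-injective (≡.setoid _) (mem i) (mem j) eq))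

count-cong : ∀ {n p q} {P : U.Pred (Fin n) p} {Q : U.Pred (Fin n) q}
  (P? : U.Decidable P) (Q? : U.Decidable Q) →
  (∀ {i} → P i → Q i) → (∀ {i} → Q i → P i) → count P? ≡ count Q?
count-cong {n} P? Q? to from = cong length (filter-≐ P? Q? (to , from) (allFin n))

count-none : ∀ {n p} {P : U.Pred (Fin n) p} (P? : U.Decidable P) →
  (∀ i → ¬ P i) → count P? ≡ 0
count-none {n} P? none = cong length (filter-none P? {allFin n} (All.universal none (allFin n)))

proper-≗ : ∀ {n N} (G : Graph n) {κ κ′ : Fin n → Fin N} → κ ≗ κ′ → Proper G κ → Proper G κ′
proper-≗ G eq p u v a e = p u v a (≡.trans (eq u) (≡.trans e (≡.sym (eq v))))

content-≗ : ∀ {n} α {κ κ′ : Fin n → Fin (length α)} → κ ≗ κ′ → HasContent α κ → HasContent α κ′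
content-≗ α {κ} {κ′} eq h i = ≡.trans
  (count-cong (λ v → κ′ v Fin.≟ i) (λ v → κ v Fin.≟ i)
    (λ {v} e → ≡.trans (eq v) e) (λ {v} e → ≡.trans (≡.sym (eq v)) e))
  (h i)

funToFin-injective : ∀ {n N} (κ κ′ : Fin n → Fin N) → funToFin κ ≡ funToFin κ′ → κ ≗ κ′
funToFin-injective κ κ′ eq v = ≡.trans (≡.sym (Fin.finToFun-funToFin κ v))
  (≡.trans (cong (λ c → finToFun c v) eq) (Fin.finToFun-funToFin κ′ v))

finToFun-injective : ∀ {n N} (c d : Fin (N ℕ.^ n)) →
  finToFun {N} {n} c ≗ finToFun d → c ≡ d
finToFun-injective {n} {N} c d eq = ≡.trans (≡.sym (Fin.funToFin-finToFin {n} {N} c))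
  (≡.trans (funToFin-cong eq) (Fin.funToFin-finToFin {n} {N} d))
  where
  funToFin-cong : ∀ {n N} {κ κ′ : Fin n → Fin N} → κ ≗ κ′ → funToFin κ ≡ funToFin κ′
  funToFin-cong {zero}  eq = ≡.refl
  funToFin-cong {suc n} eq = cong₂ Fin.combine (eq zero) (funToFin-cong (eq ∘ suc))

#colorings-mono : ∀ {n} (G : Graph n) α β
  (f : ∀ κ → ProperWithContent G α κ → Fin n → Fin (length β)) →
  (∀ κ p → ProperWithContent G β (f κ p)) →
  (∀ κ κ′ p q → f κ p ≗ f κ′ q → κ ≗ κ′) →
  #colorings G α ℕ.≤ #colorings G β
#colorings-mono {n} G α β f f∈ f-inj = count-mono
  (λ (c : Fin (length α ℕ.^ n)) → properWithContent? G α (finToFun c))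
  (λ (c : Fin (length β ℕ.^ n)) → properWithContent? G β (finToFun c))
  (λ c p → funToFin (f (finToFun c) p))
  (λ c p → let φ = f (finToFun {length α} {n} c) p ; eq = λ v → ≡.sym (Fin.finToFun-funToFin φ v)
           in proper-≗ G eq (proj₁ (f∈ _ p)) , content-≗ β eq (proj₂ (f∈ _ p)))
  (λ c d p q e → finToFun-injective {n} c d
    (f-inj _ _ p q (funToFin-injective (f (finToFun {length α} {n} c) p) (f (finToFun {length α} {n} d) q) e)))

recolor-mono : ∀ {n} (G : Graph n) α β (σ : Fin (length α) → Fin (length β)) →
  Injective _≡_ _≡_ σ → (∀ i → lookup α i ≡ lookup β (σ i)) →
  (∀ j → (∃[ i ] σ i ≡ j) ⊎ ((∀ i → σ i ≢ j) × lookup β j ≡ 0)) →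
  #colorings G α ℕ.≤ #colorings G β
recolor-mono G α β σ σ-inj σ-lookup image = #colorings-mono G α β
  (λ κ _ → σ ∘ κ)
  (λ κ (p , h) → (λ u v a e → p u v a (σ-inj e)) , λ j → content κ h j (image j))
  (λ κ κ′ _ _ e v → σ-inj (e v))
  where
  content : ∀ κ → HasContent α κ → ∀ j → (∃[ i ] σ i ≡ j) ⊎ ((∀ i → σ i ≢ j) × lookup β j ≡ 0) →
    count (λ v → σ (κ v) Fin.≟ j) ≡ lookup β j
  content κ h _ (inj₁ (i , ≡.refl)) = ≡.trans
    (count-cong (λ v → σ (κ v) Fin.≟ σ i) (λ v → κ v Fin.≟ i) σ-inj (cong σ))
    (≡.trans (h i) (σ-lookup i))
  content κ h j (inj₂ (∉ , z)) = ≡.trans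
    (count-none (λ v → σ (κ v) Fin.≟ j) (λ v → ∉ (κ v))) (≡.sym z)

#colorings-↭-≤ : ∀ {n} (G : Graph n) {α β} → α ↭ β → #colorings G α ℕ.≤ #colorings G β
#colorings-↭-≤ G {α} {β} α↭β = recolor-mono G α β (Inverse.to π)
  (λ {i} {j} e → ≡.trans (≡.sym (Perm.inverseˡ π)) (≡.trans (cong (Inverse.from π) e) (Perm.inverseˡ π)))
  (↭ₛ.onIndices-lookup (≡.setoid ℕ) p)
  (λ j → inj₁ (Inverse.from π j , Perm.inverseʳ π))
  where
  p = ↭⇒↭ₛ α↭β
  π = ↭ₕ.onIndices p

#colorings-↭ : ∀ {n} (G : Graph n) {α β} → α ↭ β → #colorings G α ≡ #colorings G β
#colorings-↭ G p = ℕ.≤-antisym (#colorings-↭-≤ G p) (#colorings-↭-≤ G (↭-sym p))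

#colorings-0∷ : ∀ {n} (G : Graph n) α → #colorings G (0 ∷ α) ≡ #colorings G α
#colorings-0∷ {n} G α = ℕ.≤-antisym
  (#colorings-mono G (0 ∷ α) α
    (λ κ p v → lower (κ v) (unused κ p v))
    (λ κ p → (λ u v a e → proj₁ p u v a (lower-inj _ _ _ _ e))
           , λ i → ≡.trans (count-cong (λ v → lower (κ v) (unused κ p v) Fin.≟ i)
                       (λ v → κ v Fin.≟ suc i) (lower⇒ _ _) (⇒lower _ _))
                     (proj₂ p (suc i)))
    (λ κ κ′ p q e v → lower-inj _ _ _ _ (e v)))
  (recolor-mono G α (0 ∷ α) suc Fin.suc-injective (λ _ → ≡.refl)
    λ { zero → inj₂ ((λ _ ()) , ≡.refl) ; (suc j) → inj₁ (j , ≡.refl) })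
  where
  lower : ∀ {N} (i : Fin (suc N)) → i ≢ zero → Fin N
  lower zero    nz = ⊥-elim (nz ≡.refl)
  lower (suc i) _  = i
  lower-inj : ∀ {N} (i j : Fin (suc N)) p q → lower i p ≡ lower j q → i ≡ j
  lower-inj zero    _       p _ _ = ⊥-elim (p ≡.refl)
  lower-inj (suc _) zero    _ q _ = ⊥-elim (q ≡.refl)
  lower-inj (suc _) (suc _) _ _ e = cong suc e
  lower⇒ : ∀ {N} (i : Fin (suc N)) p {j} → lower i p ≡ j → i ≡ suc j
  lower⇒ zero    p _ = ⊥-elim (p ≡.refl)
  lower⇒ (suc _) _ e = cong suc e
  ⇒lower : ∀ {N} (i : Fin (suc N)) p {j} → i ≡ suc j → lower i p ≡ j
  ⇒lower (suc _) _ e = Fin.suc-injective e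
  unused : ∀ κ → ProperWithContent G (0 ∷ α) κ → ∀ v → κ v ≢ zero
  unused κ (_ , h) v e = empty (h zero) (∈-filter⁺ (λ v → κ v Fin.≟ zero) (∈-allFin v) e)
    where
    empty : ∀ {xs : List (Fin n)} → length xs ≡ 0 → v ∈ xs → ⊥
    empty {[]} _ ()

#colorings-pad : ∀ {n} (G : Graph n) α → #colorings G (α ++ [ 0 ]) ≡ #colorings G α
#colorings-pad G α = ≡.trans (#colorings-↭ G (↭-sym (∷↭∷ʳ 0 α))) (#colorings-0∷ G α)

content⇒degree : ∀ {n} α (κ : Fin n → Fin (length α)) → HasContent α κ → sum α ≡ n
content⇒degree {n} α κ h = begin
  sum α                                                       ≡⟨ sum-lookup α ⟨
  ∑[ i < length α ] lookup α i                                ≡⟨ S.sum-cong-≗ h ⟨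
  ∑[ i < length α ] length (filter (λ v → κ v Fin.≟ i) (allFin n)) ≡⟨ fibres (allFin n) ⟩
  length (allFin n)                                           ≡⟨ length-tabulate _ ⟩
  n                                                           ∎
  where
  open ≡.≡-Reasoning
  module S = Sum ℕ.+-0-commutativeMonoid
  open S using (sum-syntax)
  sum-lookup : ∀ α → ∑[ i < length α ] lookup α i ≡ sum α
  sum-lookup []      = ≡.refl
  sum-lookup (a ∷ α) = cong (a ℕ.+_) (sum-lookup α)
  ind : ∀ {N} → Fin N → Fin N → ℕ
  ind c i = if does (c Fin.≟ i) then 1 else 0
  sum-ind : ∀ {N} (c : Fin N) → ∑[ i < N ] ind c i ≡ 1
  sum-ind {suc N} zero = cong suc (S.sum-replicate-zero N)
  sum-ind {suc N} (suc c) = ≡.trans (S.sum-cong-≗ {N} shift) (sum-ind c)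
    where
    shift : ∀ i → ind (suc c) (suc i) ≡ ind c i
    shift i with c Fin.≟ i
    ... | yes _ = ≡.refl
    ... | no  _ = ≡.refl
  step : ∀ v vs i → length (filter (λ v → κ v Fin.≟ i) (v ∷ vs))
                  ≡ ind (κ v) i ℕ.+ length (filter (λ v → κ v Fin.≟ i) vs)
  step v vs i with does (κ v Fin.≟ i)
  ... | true  = ≡.refl
  ... | false = ≡.refl
  fibres : ∀ vs → ∑[ i < length α ] length (filter (λ v → κ v Fin.≟ i) vs) ≡ length vs
  fibres []       = S.sum-replicate-zero (length α)
  fibres (v ∷ vs) = ≡.trans (S.sum-cong-≗ (step v vs))
    (≡.trans (S.∑-distrib-+ (ind (κ v)) _) (cong₂ ℕ._+_ (sum-ind (κ v)) (fibres vs)))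

#colorings-bounded : ∀ {n} (G : Graph n) α → n ℕ.< sum α → #colorings G α ≡ 0
#colorings-bounded {n} G α lt = count-none
  (λ (c : Fin (length α ℕ.^ n)) → properWithContent? G α (finToFun c))
  λ c (_ , h) → ℕ.<-irrefl (≡.sym (content⇒degree α (finToFun {length α} {n} c) h)) lt

module SymmetricFunctions {c ℓ} (R : CommutativeRing c ℓ) where
  open CommutativeRing R renaming (refl to ≈-refl; sym to ≈-sym; trans to ≈-trans)
  open Sum +-commutativeMonoid using (sum-syntax; sum⁺-syntax; ∑-comm; sum-cong-≋; sum-replicate-zero)
  open Mult semiring using () renaming (_×_ to _·_)

  -- Formal power series in x₀, x₁, … of bounded degree, invariant under permuting
  -- the variables.  coeff f α is the coefficient at the monomial with exponent
  -- list α; padding holds since trailing zeros do not change the monomial.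
  record Λ : Set (c ⊔ ℓ) where
    field
      coeff     : List ℕ → Carrier
      padding   : ∀ α → coeff (α ++ [ 0 ]) ≈ coeff α
      symmetric : ∀ {α β} → α ↭ β → coeff α ≈ coeff β
      bounded   : ∃[ d ] (∀ α → d ℕ.< sum α → coeff α ≈ 0#)

  open Λ public

  infix 4 _≈Λ_
  _≈Λ_ : Λ → Λ → Set ℓ
  f ≈Λ g = ∀ α → coeff f α ≈ coeff g α

  -- The sum of F β γ over all pairs of exponent lists with β + γ = α.
  ∑-split : (List ℕ → List ℕ → Carrier) → List ℕ → Carrier
  ∑-split F []      = F [] []
  ∑-split F (a ∷ α) = ∑[ i ≤ a ] ∑-split (λ β γ → F (toℕ i ∷ β) (a ℕ.∸ toℕ i ∷ γ)) α

  ∑-split-cong : ∀ {F G} → (∀ β γ → F β γ ≈ G β γ) → ∀ α → ∑-split F α ≈ ∑-split G α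
  ∑-split-cong eq []      = eq [] []
  ∑-split-cong eq (a ∷ α) = sum-cong-≋ {suc a} λ i →
    ∑-split-cong (λ β γ → eq (toℕ i ∷ β) (a ℕ.∸ toℕ i ∷ γ)) α

  Resp↭ : (List ℕ → List ℕ → Carrier) → Set ℓ
  Resp↭ F = ∀ {β β′ γ γ′} → β ↭ β′ → γ ↭ γ′ → F β γ ≈ F β′ γ′

  ∑-split-↭ : ∀ F → Resp↭ F → ∀ {α α′} → α ↭ α′ → ∑-split F α ≈ ∑-split F α′
  ∑-split-↭ F r refl = ≈-refl
  ∑-split-↭ F r (prep a p) = sum-cong-≋ {suc a} λ i →
    ∑-split-↭ (λ β γ → F (toℕ i ∷ β) (a ℕ.∸ toℕ i ∷ γ)) (λ q s → r (prep _ q) (prep _ s)) p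
  ∑-split-↭ F r (swap {xs = α} {ys = α′} a b p) = ≈-trans
    (sum-cong-≋ {suc a} λ i → sum-cong-≋ {suc b} λ j → ≈-trans
      (∑-split-↭ (λ β γ → F (toℕ i ∷ toℕ j ∷ β) (a ℕ.∸ toℕ i ∷ b ℕ.∸ toℕ j ∷ γ))
        (λ q s → r (prep _ (prep _ q)) (prep _ (prep _ s))) p)
      (∑-split-cong (λ β γ → r (swap _ _ refl) (swap _ _ refl)) α′))
    (∑-comm {suc a} {suc b} λ i j → ∑-split
      (λ β γ → F (toℕ j ∷ toℕ i ∷ β) (b ℕ.∸ toℕ j ∷ a ℕ.∸ toℕ i ∷ γ)) α′)
  ∑-split-↭ F r (trans p q) = ≈-trans (∑-split-↭ F r p) (∑-split-↭ F r q)

  ∑-split-pad : ∀ F → (∀ β γ → F (β ++ [ 0 ]) (γ ++ [ 0 ]) ≈ F β γ) →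
    ∀ α → ∑-split F (α ++ [ 0 ]) ≈ ∑-split F α
  ∑-split-pad F r []      = ≈-trans (+-identityʳ _) (r [] [])
  ∑-split-pad F r (a ∷ α) = sum-cong-≋ {suc a} λ i →
    ∑-split-pad (λ β γ → F (toℕ i ∷ β) (a ℕ.∸ toℕ i ∷ γ)) (λ β γ → r _ _) α

  ∑-split-0 : ∀ F α → (∀ β γ → sum β ℕ.+ sum γ ≡ sum α → F β γ ≈ 0#) → ∑-split F α ≈ 0#
  ∑-split-0 F []      z = z [] [] ≡.refl
  ∑-split-0 F (a ∷ α) z = ≈-trans
    (sum-cong-≋ {suc a} λ i → ∑-split-0
      (λ β γ → F (toℕ i ∷ β) (a ℕ.∸ toℕ i ∷ γ)) α λ β γ e →
      z (toℕ i ∷ β) (a ℕ.∸ toℕ i ∷ γ) (add (toℕ i) (sum β) (sum γ)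
      (ℕ.m+[n∸m]≡n (Fin.toℕ≤pred[n] i)) e))
    (sum-replicate-zero (suc a))
    where
    add : ∀ i b g {k} → i ℕ.+ k ≡ a → b ℕ.+ g ≡ sum α →
      (i ℕ.+ b) ℕ.+ (k ℕ.+ g) ≡ a ℕ.+ sum α
    add i b g {k} p q = ≡.trans (interchange ℕ.+-commutativeSemigroup i b k g) (cong₂ ℕ._+_ p q)

  infixl 7 _*Λ_
  _*Λ_ : Λ → Λ → Λ
  f *Λ g = record
    { coeff     = ∑-split (λ β γ → coeff f β * coeff g γ)
    ; padding   = ∑-split-pad (λ β γ → coeff f β * coeff g γ) λ β γ → *-cong (padding f β) (padding g γ)
    ; symmetric = ∑-split-↭ (λ β γ → coeff f β * coeff g γ) λ p q → *-cong (symmetric f p) (symmetric g q)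
    ; bounded   = d ℕ.+ e , λ α lt → ∑-split-0 (λ β γ → coeff f β * coeff g γ) α λ β γ eq →
        [ (λ l → ≈-trans (*-congʳ (proj₂ (bounded f) β l)) (zeroˡ _))
        , (λ l → ≈-trans (*-congˡ (proj₂ (bounded g) γ l)) (zeroʳ _))
        ]′ (exceeds (sum β) (sum γ) (subst (d ℕ.+ e ℕ.<_) (≡.sym eq) lt))
    }
    where
    d = proj₁ (bounded f)
    e = proj₁ (bounded g)
    exceeds : ∀ b g → d ℕ.+ e ℕ.< b ℕ.+ g → d ℕ.< b ⊎ e ℕ.< g
    exceeds b g lt with d ℕ.<? b | e ℕ.<? g
    ... | yes p | _     = inj₁ p
    ... | no _  | yes q = inj₂ q
    ... | no p  | no q  =
      contradiction lt (ℕ.≤⇒≯ (ℕ.+-mono-≤ (ℕ.≮⇒≥ p) (ℕ.≮⇒≥ q)))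

  1Λ : Λ
  1Λ = record
    { coeff     = λ α → δ (sum α)
    ; padding   = λ α → reflexive (cong δ (≡.trans (sum-++ α [ 0 ]) (ℕ.+-identityʳ (sum α))))
    ; symmetric = λ p → reflexive (cong δ (sum-↭ p))
    ; bounded   = 0 , λ α → δ-pos (sum α)
    }
    where
    δ : ℕ → Carrier
    δ zero    = 1#
    δ (suc _) = 0#
    δ-pos : ∀ s → 0 ℕ.< s → δ s ≈ 0#
    δ-pos (suc _) _ = ≈-refl

  IsConstant : Λ → Set ℓ
  IsConstant f = ∀ α → 0 ℕ.< sum α → coeff f α ≈ 0#

  IsUnit : Λ → Set (c ⊔ ℓ)
  IsUnit f = ∃[ g ] f *Λ g ≈Λ 1Λ

  Irreducible : Λ → Set (c ⊔ ℓ)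
  Irreducible f = ¬ IsConstant f × ¬ IsUnit f
    × ¬ (∃[ g ] ∃[ h ] ¬ IsConstant g × ¬ IsConstant h × f ≈Λ g *Λ h)

  -- The chromatic symmetric function.
  X : ∀ {n} → Graph n → Λ
  X {n} G = record
    { coeff     = λ α → #colorings G α · 1#
    ; padding   = λ α → reflexive (cong (_· 1#) (#colorings-pad G α))
    ; symmetric = λ p → reflexive (cong (_· 1#) (#colorings-↭ G p))
    ; bounded   = n , λ α lt → reflexive (cong (_· 1#) (#colorings-bounded G α lt))
    }

{-# OPTIONS --safe #-}

-- For connected F the coefficient of p_n in X_F is nonzero: it is the value at the vertex set
-- of the logarithmic derivative of the set power series θ of stable sets, and up to sign
-- counts the acyclic orientations with a unique, marked sink.  Pairing with p_n is a
-- derivation at the constant terms, so if X_F = g h then g, say, has a nonzero constant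
-- term; since X_F is homogeneous, h has no terms of degree less than n, and then the top
-- components of g and h can only have a product of degree n if g is constant.
-- Conversely, if the component P of a vertex is not everything, X_F is the product of the
-- chromatic symmetric functions of P and of its complement.

module Submission where

open import Defs
open import Data.Nat using (ℕ; _≤_)
open import Function.Bundles using (_⇔_)

open import Algebra.Bundles using (CommutativeRing)
import Algebra.Properties.CommutativeMonoid.Mult as MonoidMult
import Algebra.Properties.CommutativeMonoid.Sum as Sum
open import Algebra.Properties.CommutativeSemigroup using (interchange)
import Algebra.Properties.Ring as RingProperties
import Algebra.Properties.Semiring.Mult as SemiringMult
import Algebra.Solver.Ring.NaturalCoefficients.Default as NaturalCoefficients
open import Data.Bool as Bool using (Bool; true; false; _∨_; if_then_else_)
open import Data.Bool.Properties using (¬-not; ∨-zeroʳ; ∨-comm; ∨-assoc)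
open import Data.Empty using (⊥)
open import Data.Fin as Fin using (Fin; zero; suc; toℕ; _↑ˡ_; _↑ʳ_; combine; finToFun)
import Data.Fin.Properties as Fin
import Data.Integer as ℤ
open import Data.List using (List; []; _∷_; [_]; _++_; length; lookup; filter; replicate; tabulate; allFin)
open import Data.List.Membership.Propositional using (_∈_; lose; find)
open import Data.List.Membership.Propositional.Properties
  using (∈-filter⁺; ∈-filter⁻; ∈-allFin; ∈-∃++; ∈-++⁻)
open import Data.List.Properties
  using (length-++; length-replicate; length-tabulate; ++-assoc; ++-identityʳ)
open import Data.List.Relation.Binary.Permutation.Propositional as ↭
  using (_↭_; prep; swap; ↭-sym; ↭-trans)
open import Data.List.Relation.Binary.Permutation.Propositional.Properties
  using (↭-length; shift; ∷↭∷ʳ; ++⁺ˡ; All-resp-↭; ∈-resp-↭)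
open import Data.List.Relation.Ternary.Interleaving.Propositional using (Interleaving; []; consˡ; consʳ)
open import Data.List.Relation.Ternary.Interleaving.Properties using (interleave-length)
open import Data.List.Relation.Unary.All as All using (All; []; _∷_)
import Data.List.Relation.Unary.All.Properties as All
open import Data.List.Relation.Unary.Any as Any using (Any; here; there)
open import Data.Maybe as Maybe using (Maybe; just; nothing)
open import Data.Nat as ℕ using (zero; suc)
open import Data.Nat.Induction using (<-rec)
open import Data.Nat.ListAction using (sum)
open import Data.Nat.ListAction.Properties using (sum-++)
import Data.Nat.Properties as ℕ
open import Data.Product using (_×_; _,_; proj₁; proj₂; ∃-syntax; map₂)
open import Data.Rational as ℚ using (ℚ; 0ℚ; 1ℚ; ∣_∣)
import Data.Rational.Properties as ℚ
open import Data.Sum using (_⊎_; inj₁; inj₂; [_,_]′)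
import Data.Vec.Functional as Vector
open import Function using (_∘_; id)
open import Function.Bundles using (mk⇔)
open import Level using (_⊔_)
open import Relation.Binary using (tri<; tri≈; tri>)
open import Relation.Binary.Construct.Closure.ReflexiveTransitive
  using (Star; _◅_; _◅◅_; reverse) renaming (ε to ∎ˢ)
open import Relation.Binary.PropositionalEquality as ≡ using (_≡_; _≢_; _≗_; subst)
import Relation.Binary.Reasoning.Setoid as SetoidReasoning
open import Relation.Nullary using (¬_; Dec; yes; no; does; contradiction)
open import Relation.Nullary.Decidable using (_×-dec_; ¬?; dec-true; dec-false)
open import Relation.Unary as U using (Pred)

-- No power sum basis is constructed: `χ` reads the coefficient of p_n off the monomial
-- coefficients, and both its behaviour on products and its link to stable sets follow from Newton's
-- identity. Since θ has value 1 at the empty set it can be cancelled, so identities are found by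
-- differentiating at a vertex and cancelling θ; the recursion of `C` arises this way. That the
-- coefficient is nonzero is a matter of signs: all terms of the recursion have the same sign, so
-- one nonzero term suffices, and an enumeration in which every vertex touches an earlier one
-- provides it. The obstacle in the factorization argument is that vanishing of a complex number is
-- undecidable, so neither a leading term nor the degree of a series can be chosen. Irreducibility
-- consists of negations, hence it is enough that vanishing is stable under double negation. Every
-- choice of a least or largest nonzero term becomes an induction that proves vanishing.

-- Sums over i + j = n, products of power series, and the pairing with p_n.

module DiagonalSums {c ℓ} (R : CommutativeRing c ℓ) where
  open CommutativeRing R hiding (zero)
  open RingProperties ring public using (-‿distribˡ-*; -‿distribʳ-*; -‿+-comm; -0#≈0#; +-cancelˡ; +-cancelʳ)
  open SemiringMult semiring public renaming (_×_ to _·_)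
  open MonoidMult +-commutativeMonoid using (×-distrib-+)
  open SetoidReasoning setoid

  +-interchange : ∀ a b c d → (a + b) + (c + d) ≈ (a + c) + (b + d)
  +-interchange = interchange +-commutativeSemigroup

  -- Covers `χ`, `shuf` and `⋆` in either argument, so that `diag-homo` and `shuf-homo` exchange any
  -- of them with finite sums.
  record Linear {x} {X : Set x} (L : (X → Carrier) → Carrier) : Set (x ⊔ c ⊔ ℓ) where
    field
      cong′ : ∀ {f g} → (∀ x → f x ≈ g x) → L f ≈ L g
      +-homo : ∀ f g → L (λ x → f x + g x) ≈ L f + L g
      *-homo : ∀ k f → L (λ x → k * f x) ≈ k * L f

  open Linear public

  0-homo : ∀ {x} {X : Set x} {L : (X → Carrier) → Carrier} → Linear L → L (λ _ → 0#) ≈ 0#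
  0-homo {L = L} lin = begin
    L (λ _ → 0#)      ≈⟨ cong′ lin (λ _ → zeroˡ _) ⟨
    L (λ _ → 0# * 0#) ≈⟨ *-homo lin 0# (λ _ → 0#) ⟩
    0# * L (λ _ → 0#) ≈⟨ zeroˡ _ ⟩
    0#                ∎

  diag : ℕ → (ℕ → ℕ → Carrier) → Carrier
  diag zero    f = f 0 0
  diag (suc n) f = f 0 (suc n) + diag n (λ i → f (suc i))

  diag-cong-≡ : ∀ n {f g} → (∀ i j → i ℕ.+ j ≡ n → f i j ≈ g i j) → diag n f ≈ diag n g
  diag-cong-≡ zero    e = e 0 0 ≡.refl
  diag-cong-≡ (suc n) e = +-cong (e 0 (suc n) ≡.refl)
    (diag-cong-≡ n λ i j p → e (suc i) j (≡.cong suc p))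

  diag-cong : ∀ n {f g} → (∀ i j → f i j ≈ g i j) → diag n f ≈ diag n g
  diag-cong n e = diag-cong-≡ n λ i j _ → e i j

  diag-+ : ∀ n f g → diag n (λ i j → f i j + g i j) ≈ diag n f + diag n g
  diag-+ zero    f g = refl
  diag-+ (suc n) f g = trans (+-congˡ (diag-+ n _ _)) (+-interchange _ _ _ _)

  diag-0 : ∀ n → diag n (λ _ _ → 0#) ≈ 0#
  diag-0 zero    = refl
  diag-0 (suc n) = trans (+-identityˡ _) (diag-0 n)

  diag-*ˡ : ∀ n k f → diag n (λ i j → k * f i j) ≈ k * diag n f
  diag-*ˡ zero    k f = refl
  diag-*ˡ (suc n) k f = trans (+-congˡ (diag-*ˡ n k _)) (sym (distribˡ k _ _))

  diag-· : ∀ n k f → diag n (λ i j → k · f i j) ≈ k · diag n f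
  diag-· zero    k f = refl
  diag-· (suc n) k f = trans (+-congˡ (diag-· n k _)) (sym (×-distrib-+ _ _ k))

  diag-homo : ∀ {x} {X : Set x} {L : (X → Carrier) → Carrier} → Linear L →
    ∀ n (f : ℕ → ℕ → X → Carrier) →
    L (λ x → diag n (λ i j → f i j x)) ≈ diag n (λ i j → L (f i j))
  diag-homo lin zero    f = refl
  diag-homo lin (suc n) f =
    trans (+-homo lin _ _) (+-congˡ (diag-homo lin n (λ i → f (suc i))))

  diag-last : ∀ n f → diag (suc n) f ≈ diag n (λ i j → f i (suc j)) + f (suc n) 0
  diag-last zero    f = refl
  diag-last (suc n) f =
    trans (+-congˡ (diag-last n (λ i → f (suc i)))) (sym (+-assoc _ _ _))

  diag-flip : ∀ n f → diag n f ≈ diag n (λ i j → f j i)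
  diag-flip zero    f = refl
  diag-flip (suc n) f = begin
    f 0 (suc n) + diag n (λ i → f (suc i))       ≈⟨ +-congˡ (diag-flip n _) ⟩
    f 0 (suc n) + diag n (λ i j → f (suc j) i)   ≈⟨ +-comm _ _ ⟩
    diag n (λ i j → f (suc j) i) + f 0 (suc n)   ≈⟨ diag-last n (λ i j → f j i) ⟨
    diag (suc n) (λ i j → f j i)                 ∎

  diag-assoc : ∀ n (f : ℕ → ℕ → ℕ → Carrier) →
    diag n (λ a m → diag a (λ i j → f i j m)) ≈ diag n (λ i l → diag l (λ j m → f i j m))
  diag-assoc zero    f = refl
  diag-assoc (suc n) f = begin
    f 0 0 (suc n) + diag n (λ a m → f 0 (suc a) m + diag a (λ i j → f (suc i) j m))
      ≈⟨ +-congˡ (diag-+ n _ _) ⟩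
    f 0 0 (suc n) + (diag n (λ a m → f 0 (suc a) m) + diag n (λ a m → diag a (λ i j → f (suc i) j m)))
      ≈⟨ +-assoc _ _ _ ⟨
    diag (suc n) (f 0) + diag n (λ a m → diag a (λ i j → f (suc i) j m))
      ≈⟨ +-congˡ (diag-assoc n (λ i → f (suc i))) ⟩
    diag (suc n) (f 0) + diag n (λ i l → diag l (λ j m → f (suc i) j m)) ∎

  -- Only the term at `(0, n)` has second index `n`, so it is determined by the total and the other
  -- terms. This is the step of the triangular induction in `χ-⋆`.
  diag-head-cancel : ∀ n {f g} → (∀ i j → j ℕ.< n → f i j ≈ g i j) →
    diag n f ≈ diag n g → f 0 n ≈ g 0 n
  diag-head-cancel zero    e p = p
  diag-head-cancel (suc n) {f} {g} e p = +-cancelʳ (diag n (λ i → g (suc i))) _ _ (begin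
    f 0 (suc n) + diag n (λ i → g (suc i))
      ≈⟨ +-congˡ (diag-cong-≡ n λ i j q → e (suc i) j (ℕ.s≤s (≡.subst (j ℕ.≤_) q (ℕ.m≤n+m j i)))) ⟨
    diag (suc n) f ≈⟨ p ⟩
    diag (suc n) g ∎)

  -- The factor `n + 1` equals `i + j` in each term; the terms of weight 0 drop out, which shifts
  -- the indices.
  diag-weighted : ∀ n f → suc n · diag (suc n) f ≈
    diag n (λ i j → suc j · f i (suc j)) + diag n (λ j i → suc i · f (suc i) j)
  diag-weighted n f = begin
    suc n · diag (suc n) f                      ≈⟨ diag-· (suc n) (suc n) f ⟨
    diag (suc n) (λ i j → suc n · f i j)        ≈⟨ diag-cong-≡ (suc n) (λ i j p →
      trans (×-congˡ (≡.trans (≡.sym p) (ℕ.+-comm i j))) (×-homo-+ (f i j) j i)) ⟩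
    diag (suc n) (λ i j → j · f i j + i · f i j) ≈⟨ diag-+ (suc n) (λ i j → j · f i j) (λ i j → i · f i j) ⟩
    diag (suc n) (λ i j → j · f i j) + diag (suc n) (λ i j → i · f i j)
      ≈⟨ +-cong (trans (diag-last n λ i j → j · f i j) (+-identityʳ _))
                (trans (+-identityˡ _) (diag-flip n λ i j → suc i · f (suc i) j)) ⟩
    diag n (λ i j → suc j · f i (suc j)) + diag n (λ j i → suc i · f (suc i) j) ∎

  δ : ℕ → ℕ → Carrier
  δ zero    zero    = 1#
  δ zero    (suc _) = 0#
  δ (suc _) zero    = 0#
  δ (suc s) (suc t) = δ s t

  δ-refl : ∀ s → δ s s ≈ 1#
  δ-refl zero    = refl
  δ-refl (suc s) = δ-refl s

  δ-≢ : ∀ s t → ¬ s ≡ t → δ s t ≈ 0#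
  δ-≢ zero    zero    n = contradiction ≡.refl n
  δ-≢ zero    (suc t) n = refl
  δ-≢ (suc s) zero    n = refl
  δ-≢ (suc s) (suc t) n = δ-≢ s t (λ e → n (≡.cong suc e))

  private
    diag-0* : ∀ n (g : ℕ → ℕ → Carrier) → diag n (λ i j → 0# * g i j) ≈ 0#
    diag-0* n g = trans (diag-cong n λ _ _ → zeroˡ _) (diag-0 n)

  diag-δ : ∀ s k (g : ℕ → Carrier) → diag (s ℕ.+ k) (λ i j → δ s i * g j) ≈ g k
  diag-δ zero    zero    g = *-identityˡ _
  diag-δ zero    (suc k) g =
    trans (+-cong (*-identityˡ _) (diag-0* k λ _ j → g j)) (+-identityʳ _)
  diag-δ (suc s) k       g = trans (+-cong (zeroˡ _) (diag-δ s k g)) (+-identityˡ _)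

  diag-δ-< : ∀ n s (g : ℕ → Carrier) → n ℕ.< s → diag n (λ i j → δ s i * g j) ≈ 0#
  diag-δ-< zero    (suc s) g _         = zeroˡ _
  diag-δ-< (suc n) (suc s) g (ℕ.s≤s p) = trans (+-cong (zeroˡ _) (diag-δ-< n s g p)) (+-identityˡ _)

  diag-δ-δ : ∀ s t a → diag a (λ i j → δ s i * δ t j) ≈ δ (s ℕ.+ t) a
  diag-δ-δ zero    t zero    = *-identityˡ _
  diag-δ-δ zero    t (suc a) =
    trans (+-cong (*-identityˡ _) (diag-0* a λ _ → δ t)) (+-identityʳ _)
  diag-δ-δ (suc s) t zero    = zeroˡ _
  diag-δ-δ (suc s) t (suc a) = trans (+-cong (zeroˡ _) (diag-δ-δ s t a)) (+-identityˡ _)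

  -- A function on exponent lists stands for the power series with these coefficients.

  ZeroInvariant : (List ℕ → Carrier) → Set ℓ
  ZeroInvariant f = ∀ β γ → f (β ++ 0 ∷ γ) ≈ f (β ++ γ)

  -- Zeros are allowed at every position, not only at the end, so that the property survives fixing
  -- the first exponent in an induction.
  ∷-zeroInvariant : ∀ {f} a → ZeroInvariant f → ZeroInvariant (λ α → f (a ∷ α))
  ∷-zeroInvariant a z β γ = z (a ∷ β) γ

  split : (List ℕ → List ℕ → Carrier) → List ℕ → Carrier
  split Φ []      = Φ [] []
  split Φ (a ∷ α) = diag a λ i j → split (λ β γ → Φ (i ∷ β) (j ∷ γ)) α

  split-cong : ∀ α {Φ Ψ} → (∀ β γ → sum β ℕ.+ sum γ ≡ sum α → Φ β γ ≈ Ψ β γ) →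
    split Φ α ≈ split Ψ α
  split-cong []      e = e [] [] ≡.refl
  split-cong (a ∷ α) e = diag-cong-≡ a λ i j p → split-cong α λ β γ q →
    e (i ∷ β) (j ∷ γ) (≡.trans (ℕ-interchange i (sum β) j (sum γ)) (≡.cong₂ ℕ._+_ p q))
    where
    ℕ-interchange = interchange ℕ.+-commutativeSemigroup

  split-0 : ∀ α → split (λ _ _ → 0#) α ≈ 0#
  split-0 []      = refl
  split-0 (a ∷ α) = trans (diag-cong a λ _ _ → split-0 α) (diag-0 a)

  split-*ˡ : ∀ α k Φ → split (λ β γ → k * Φ β γ) α ≈ k * split Φ α
  split-*ˡ []      k Φ = refl
  split-*ˡ (a ∷ α) k Φ = trans (diag-cong a λ i j → split-*ˡ α k _) (diag-*ˡ a k _)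

  diag-single : ∀ a b f → (∀ i j → i ℕ.+ j ≡ a ℕ.+ b → ¬ i ≡ a → f i j ≈ 0#) →
    diag (a ℕ.+ b) f ≈ f a b
  diag-single zero    zero    f z = refl
  diag-single zero    (suc b) f z = trans (+-congˡ (trans
    (diag-cong-≡ b λ i j p → z (suc i) j (≡.cong suc p) λ ()) (diag-0 b))) (+-identityʳ _)
  diag-single (suc a) b       f z = trans (+-cong (z 0 (suc a ℕ.+ b) ≡.refl λ ())
    (diag-single a b (λ i → f (suc i)) λ i j p ne → z (suc i) j (≡.cong suc p) λ e → ne (ℕ.suc-injective e)))
    (+-identityˡ _)

  split-single : ∀ α Φ → (∀ β γ → sum β ℕ.+ sum γ ≡ sum α → ¬ sum β ≡ 0 → Φ β γ ≈ 0#) →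
    split Φ α ≈ Φ (replicate (length α) 0) α
  split-single []      Φ z = refl
  split-single (a ∷ α) Φ z = trans
    (diag-single 0 a _ λ i j p i≢0 → trans
      (split-cong α λ β γ q → z (i ∷ β) (j ∷ γ)
        (≡.trans (interchange ℕ.+-commutativeSemigroup i (sum β) j (sum γ)) (≡.cong₂ ℕ._+_ p q))
        λ e → i≢0 (ℕ.m+n≡0⇒m≡0 i e))
      (split-0 α))
    (split-single α _ λ β γ p ne → z (0 ∷ β) (a ∷ γ)
      (≡.trans (≡.sym (ℕ.+-assoc (sum β) a (sum γ))) (≡.trans (≡.cong (ℕ._+ sum γ) (ℕ.+-comm (sum β) a))
        (≡.trans (ℕ.+-assoc a (sum β) (sum γ)) (≡.cong (a ℕ.+_) p)))) ne)

  infixl 7 _⋆_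
  _⋆_ : (f g : List ℕ → Carrier) → List ℕ → Carrier
  f ⋆ g = split λ β γ → f β * g γ

  ⋆-cong : ∀ {f f′ g g′} → (∀ α → f α ≈ f′ α) → (∀ α → g α ≈ g′ α) →
    ∀ α → (f ⋆ g) α ≈ (f′ ⋆ g′) α
  ⋆-cong p q []      = *-cong (p []) (q [])
  ⋆-cong p q (a ∷ α) = diag-cong a λ i j → ⋆-cong (λ β → p (i ∷ β)) (λ γ → q (j ∷ γ)) α

  ⋆-comm : ∀ f g α → (f ⋆ g) α ≈ (g ⋆ f) α
  ⋆-comm f g []      = *-comm _ _
  ⋆-comm f g (a ∷ α) = trans (diag-flip a _) (diag-cong a λ i j → ⋆-comm _ _ α)

  ⋆-linearˡ : ∀ g α → Linear (λ f → (f ⋆ g) α)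
  ⋆-linearˡ g α = record
    { cong′  = λ e → ⋆-cong e (λ _ → refl) α
    ; +-homo = λ f f′ → +ˡ f f′ g α
    ; *-homo = λ k f → *ˡ k f g α
    }
    where
    +ˡ : ∀ f f′ g α → ((λ β → f β + f′ β) ⋆ g) α ≈ (f ⋆ g) α + (f′ ⋆ g) α
    +ˡ f f′ g []      = distribʳ _ _ _
    +ˡ f f′ g (a ∷ α) = trans (diag-cong a λ i j → +ˡ _ _ _ α) (diag-+ a _ _)
    *ˡ : ∀ k f g α → ((λ β → k * f β) ⋆ g) α ≈ k * (f ⋆ g) α
    *ˡ k f g []      = *-assoc _ _ _
    *ˡ k f g (a ∷ α) = trans (diag-cong a λ i j → *ˡ k _ _ α) (diag-*ˡ a k _)

  ⋆-linearʳ : ∀ f α → Linear (λ g → (f ⋆ g) α)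
  ⋆-linearʳ f α = record
    { cong′  = λ e → ⋆-cong (λ _ → refl) e α
    ; +-homo = λ g g′ → trans (⋆-comm f _ α) (trans (+-homo (⋆-linearˡ f α) g g′) (+-cong (⋆-comm g f α) (⋆-comm g′ f α)))
    ; *-homo = λ k g → trans (⋆-comm f _ α) (trans (*-homo (⋆-linearˡ f α) k g) (*-congˡ (⋆-comm g f α)))
    }

  -- χ 1 n is the coefficient of p_{n+1} in the power sum expansion, times n + 1:
  -- the pairing with p_{n+1} = Σ (-1)^(ℓ(α)-1) α_ℓ h_α over compositions α of n + 1.
  -- In χ a n the first part of α is required to be at least a, and a + n is the degree.
  χ : ℕ → ℕ → (List ℕ → Carrier) → Carrier
  χ a zero    F = a · F [ a ]
  χ a (suc n) F = χ (suc a) n F + - χ 1 n (λ α → F (a ∷ α))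

  χ-linear : ∀ a n → Linear (χ a n)
  χ-linear a zero = record
    { cong′  = λ e → ×-congʳ a (e [ a ])
    ; +-homo = λ f g → ×-distrib-+ _ _ a
    ; *-homo = λ k f → sym (×-comm-* a k _)
    }
  χ-linear a (suc n) = record
    { cong′  = λ e → +-cong (cong′ L e) (-‿cong (cong′ M λ α → e (a ∷ α)))
    ; +-homo = λ f g → trans
        (+-cong (+-homo L f g) (trans (-‿cong (+-homo M _ _)) (sym (-‿+-comm _ _))))
        (+-interchange _ _ _ _)
    ; *-homo = λ k f → trans
        (+-cong (*-homo L k f) (trans (-‿cong (*-homo M k _)) (-‿distribʳ-* _ _)))
        (sym (distribˡ _ _ _))
    }
    where
    L = χ-linear (suc a) n
    M = χ-linear 1 n

  private
    -- Each unfolding of `χ` subtracts the compositions whose first part is exactly `i + a`. Adding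
    -- all of them back leaves the composition with a single part.
    χ-telescope : ∀ a n F → χ a (suc n) F + diag n (λ i m → χ 1 m (λ α → F (i ℕ.+ a ∷ α)))
      ≈ (suc n ℕ.+ a) · F [ suc n ℕ.+ a ]
    χ-telescope a zero F = begin
      (χ (suc a) 0 F + - χ 1 0 (λ α → F (a ∷ α))) + χ 1 0 (λ α → F (a ∷ α)) ≈⟨ +-assoc _ _ _ ⟩
      χ (suc a) 0 F + (- χ 1 0 (λ α → F (a ∷ α)) + χ 1 0 (λ α → F (a ∷ α))) ≈⟨ +-congˡ (-‿inverseˡ _) ⟩
      χ (suc a) 0 F + 0# ≈⟨ +-identityʳ _ ⟩
      χ (suc a) 0 F      ∎
    χ-telescope a (suc n) F = begin
      (χ (suc a) (suc n) F + - y) + (y + D)  ≈⟨ +-assoc _ _ _ ⟩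
      χ (suc a) (suc n) F + (- y + (y + D))  ≈⟨ +-congˡ (+-assoc _ _ _) ⟨
      χ (suc a) (suc n) F + ((- y + y) + D)  ≈⟨ +-congˡ (trans (+-congʳ (-‿inverseˡ y)) (+-identityˡ D)) ⟩
      χ (suc a) (suc n) F + D                ≈⟨ +-congˡ (diag-cong n λ i m → cong′ (χ-linear 1 m)
        λ α → reflexive (≡.cong (λ k → F (k ∷ α)) (≡.sym (ℕ.+-suc i a)))) ⟩
      χ (suc a) (suc n) F + diag n (λ i m → χ 1 m (λ α → F (i ℕ.+ suc a ∷ α))) ≈⟨ χ-telescope (suc a) n F ⟩
      (suc n ℕ.+ suc a) · F [ suc n ℕ.+ suc a ]
        ≈⟨ reflexive (≡.cong (λ k → k · F [ k ]) (ℕ.+-suc (suc n) a)) ⟩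
      (suc (suc n) ℕ.+ a) · F [ suc (suc n) ℕ.+ a ] ∎
      where
      y = χ 1 (suc n) (λ α → F (a ∷ α))
      D = diag n (λ i m → χ 1 m (λ α → F (suc i ℕ.+ a ∷ α)))

  -- Newton's identity Σ h_a p_{m+1} = (n + 1) h_{n+1}, paired with F.
  newton : ∀ n F → (∀ α → F (0 ∷ α) ≈ F α) →
    diag n (λ a m → χ 1 m (λ α → F (a ∷ α))) ≈ suc n · F [ suc n ]
  newton n F z = begin
    diag n (λ a m → χ 1 m (λ α → F (a ∷ α)))           ≈⟨ +-identityˡ _ ⟨
    0# + diag n (λ a m → χ 1 m (λ α → F (a ∷ α)))      ≈⟨ +-cong vanish (diag-cong n λ i m →
      cong′ (χ-linear 1 m) λ α → reflexive (≡.cong (λ k → F (k ∷ α)) (≡.sym (ℕ.+-identityʳ i)))) ⟩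
    χ 0 (suc n) F + diag n (λ i m → χ 1 m (λ α → F (i ℕ.+ 0 ∷ α))) ≈⟨ χ-telescope 0 n F ⟩
    (suc n ℕ.+ 0) · F [ suc n ℕ.+ 0 ] ≈⟨ reflexive (≡.cong (λ k → k · F [ k ]) (ℕ.+-identityʳ (suc n))) ⟩
    suc n · F [ suc n ] ∎
    where
    -- This unfolds to `χ 1 n F` minus the same pairing after a first exponent 0, which `F` ignores.
    vanish : 0# ≈ χ 0 (suc n) F
    vanish = sym (trans (+-congˡ (-‿cong (cong′ (χ-linear 1 n) z))) (-‿inverseʳ _))

  -- p_{n+1} is primitive.
  χ-⋆ : ∀ n f g → ZeroInvariant f → ZeroInvariant g →
    χ 1 n (f ⋆ g) ≈ f [] * χ 1 n g + χ 1 n f * g []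
  χ-⋆ = <-rec _ step
    where
    step : ∀ n → (∀ {m} → m ℕ.< n → ∀ f g → ZeroInvariant f → ZeroInvariant g →
                  χ 1 m (f ⋆ g) ≈ f [] * χ 1 m g + χ 1 m f * g []) →
      ∀ f g → ZeroInvariant f → ZeroInvariant g →
      χ 1 n (f ⋆ g) ≈ f [] * χ 1 n g + χ 1 n f * g []
    step n rec f g zf zg = begin
      χ 1 n (f ⋆ g)                  ≈⟨ cong′ (χ-linear 1 n) (⋆-cong (λ α → sym (zf [] α)) (λ α → sym (zg [] α))) ⟩
      -- `P` and `Q` agree for `m < n` by induction, and their diagonal sums agree by Newton's
      -- identity; the term with `a = 0` is what remains.
      P 0 n                          ≈⟨ diag-head-cancel n tails total ⟩
      f [ 0 ] * χ 1 n (g′ 0) + χ 1 n (f′ 0) * g [ 0 ] ≈⟨ +-cong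
        (*-cong (zf [] []) (cong′ (χ-linear 1 n) (zg [])))
        (*-cong (cong′ (χ-linear 1 n) (zf [])) (zg [] [])) ⟩
      f [] * χ 1 n g + χ 1 n f * g [] ∎
      where
      f′ g′ : ℕ → List ℕ → Carrier
      f′ i β = f (i ∷ β)
      g′ j γ = g (j ∷ γ)
      P Q : ℕ → ℕ → Carrier
      P a m = χ 1 m (λ α → (f ⋆ g) (a ∷ α))
      Q a m = diag a λ i j → f [ i ] * χ 1 m (g′ j) + χ 1 m (f′ i) * g [ j ]
      tails : ∀ a m → m ℕ.< n → P a m ≈ Q a m
      tails a m lt = trans (diag-homo (χ-linear 1 m) a (λ i j → f′ i ⋆ g′ j)) (diag-cong a λ i j →
        rec lt (f′ i) (g′ j) (∷-zeroInvariant {f} i zf) (∷-zeroInvariant {g} j zg))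
      ⋆-zeroInvariant-head : ∀ α → (f ⋆ g) (0 ∷ α) ≈ (f ⋆ g) α
      ⋆-zeroInvariant-head = ⋆-cong (zf []) (zg [])
      -- Newton's identity for the product brings in the factor `n + 1`. Shared out between the two
      -- degrees, it is absorbed by Newton's identity for `g` and for `f` separately.
      total : diag n P ≈ diag n Q
      total = begin
        diag n P ≈⟨ newton n (f ⋆ g) ⋆-zeroInvariant-head ⟩
        suc n · diag (suc n) (λ i j → f [ i ] * g [ j ]) ≈⟨ diag-weighted n (λ i j → f [ i ] * g [ j ]) ⟩
        diag n (λ i l → suc l · (f [ i ] * g [ suc l ])) + diag n (λ j l → suc l · (f [ suc l ] * g [ j ]))
          ≈⟨ +-cong (diag-cong n λ i l → expand i l) (diag-cong n λ j l → expand′ j l) ⟩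
        diag n (λ i l → diag l λ j m → f [ i ] * χ 1 m (g′ j)) + diag n (λ j l → diag l λ i m → χ 1 m (f′ i) * g [ j ])
          ≈⟨ +-cong (diag-assoc n λ i j m → f [ i ] * χ 1 m (g′ j))
                    (trans (diag-cong n λ a m → diag-flip a _) (diag-assoc n λ j i m → χ 1 m (f′ i) * g [ j ])) ⟨
        diag n (λ a m → diag a λ i j → f [ i ] * χ 1 m (g′ j)) + diag n (λ a m → diag a λ i j → χ 1 m (f′ i) * g [ j ])
          ≈⟨ diag-+ n _ _ ⟨
        diag n (λ a m → (diag a λ i j → f [ i ] * χ 1 m (g′ j)) + (diag a λ i j → χ 1 m (f′ i) * g [ j ]))
          ≈⟨ diag-cong n (λ a m → diag-+ a _ _) ⟨
        diag n Q ∎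
        where
        expand : ∀ i l → suc l · (f [ i ] * g [ suc l ]) ≈ diag l λ j m → f [ i ] * χ 1 m (g′ j)
        expand i l = begin
          suc l · (f [ i ] * g [ suc l ])       ≈⟨ ×-comm-* (suc l) _ _ ⟨
          f [ i ] * (suc l · g [ suc l ])       ≈⟨ *-congˡ (newton l g (zg [])) ⟨
          f [ i ] * diag l (λ j m → χ 1 m (g′ j)) ≈⟨ diag-*ˡ l (f [ i ]) _ ⟨
          (diag l λ j m → f [ i ] * χ 1 m (g′ j)) ∎
        expand′ : ∀ j l → suc l · (f [ suc l ] * g [ j ]) ≈ diag l λ i m → χ 1 m (f′ i) * g [ j ]
        expand′ j l = begin
          suc l · (f [ suc l ] * g [ j ])       ≈⟨ ×-assoc-* (suc l) _ _ ⟨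
          (suc l · f [ suc l ]) * g [ j ]       ≈⟨ *-comm _ _ ⟩
          g [ j ] * (suc l · f [ suc l ])       ≈⟨ *-congˡ (newton l f (zf [])) ⟨
          g [ j ] * diag l (λ i m → χ 1 m (f′ i)) ≈⟨ diag-*ˡ l (g [ j ]) _ ⟨
          (diag l λ i m → g [ j ] * χ 1 m (f′ i)) ≈⟨ diag-cong l (λ _ _ → *-comm _ _) ⟩
          (diag l λ i m → χ 1 m (f′ i) * g [ j ]) ∎

-- Set power series, as functions on lists of vertices.

module Shuffle {c ℓ} (R : CommutativeRing c ℓ) (V : Set) where
  open CommutativeRing R hiding (zero) renaming (refl to ≈-refl; sym to ≈-sym; trans to ≈-trans)
  open DiagonalSums R
  open SetoidReasoning setoid

  -- Lists stand for vertex sets, dealt in all ways into two sublists. The recursion makes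
  -- `f ↦ f (x ∷ _)` a derivation for the product `⊛`, the derivative at `x`.
  shuf : (List V → List V → Carrier) → List V → Carrier
  shuf Φ []      = Φ [] []
  shuf Φ (x ∷ U) = shuf (λ S T → Φ (x ∷ S) T) U + shuf (λ S T → Φ S (x ∷ T)) U

  shuf-cong-Interleaving : ∀ U {Φ Ψ} → (∀ {S T} → Interleaving S T U → Φ S T ≈ Ψ S T) →
    shuf Φ U ≈ shuf Ψ U
  shuf-cong-Interleaving []      e = e []
  shuf-cong-Interleaving (x ∷ U) e = +-cong
    (shuf-cong-Interleaving U λ i → e (consˡ i)) (shuf-cong-Interleaving U λ i → e (consʳ i))

  shuf-cong : ∀ U {Φ Ψ} → (∀ S T → Φ S T ≈ Ψ S T) → shuf Φ U ≈ shuf Ψ U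
  shuf-cong U e = shuf-cong-Interleaving U λ {S} {T} _ → e S T

  shuf-cong-length : ∀ U {Φ Ψ} → (∀ S T → length S ℕ.+ length T ≡ length U → Φ S T ≈ Ψ S T) →
    shuf Φ U ≈ shuf Ψ U
  shuf-cong-length U e = shuf-cong-Interleaving U λ i → e _ _ (≡.sym (interleave-length i))

  shuf-+ : ∀ U Φ Ψ → shuf (λ S T → Φ S T + Ψ S T) U ≈ shuf Φ U + shuf Ψ U
  shuf-+ []      Φ Ψ = ≈-refl
  shuf-+ (x ∷ U) Φ Ψ = ≈-trans (+-cong (shuf-+ U _ _) (shuf-+ U _ _)) (+-interchange _ _ _ _)

  shuf-0 : ∀ U → shuf (λ _ _ → 0#) U ≈ 0#
  shuf-0 []      = ≈-refl
  shuf-0 (x ∷ U) = ≈-trans (+-cong (shuf-0 U) (shuf-0 U)) (+-identityˡ 0#)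

  shuf-· : ∀ k U Φ → shuf (λ S T → k · Φ S T) U ≈ k · shuf Φ U
  shuf-· zero    U Φ = shuf-0 U
  shuf-· (suc k) U Φ = ≈-trans (shuf-+ U _ _) (+-congˡ (shuf-· k U Φ))

  shuf-homo : ∀ {x} {X : Set x} {L : (X → Carrier) → Carrier} → Linear L →
    ∀ U (Φ : X → List V → List V → Carrier) →
    L (λ x → shuf (Φ x) U) ≈ shuf (λ S T → L (λ x → Φ x S T)) U
  shuf-homo lin []      Φ = ≈-refl
  shuf-homo lin (v ∷ U) Φ = ≈-trans (+-homo lin _ _) (+-cong (shuf-homo lin U _) (shuf-homo lin U _))

  shuf-linear : ∀ U → Linear (λ (Φ : List V × List V → Carrier) → shuf (λ S T → Φ (S , T)) U)
  shuf-linear U = record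
    { cong′  = λ e → shuf-cong U λ S T → e (S , T)
    ; +-homo = λ Φ Ψ → shuf-+ U _ _
    ; *-homo = *ˡ U
    }
    where
    *ˡ : ∀ U k (Φ : List V × List V → Carrier) →
      shuf (λ S T → k * Φ (S , T)) U ≈ k * shuf (λ S T → Φ (S , T)) U
    *ˡ []      k Φ = ≈-refl
    *ˡ (x ∷ U) k Φ = ≈-trans
      (+-cong (*ˡ U k (λ (S , T) → Φ (x ∷ S , T))) (*ˡ U k (λ (S , T) → Φ (S , x ∷ T))))
      (≈-sym (distribˡ k _ _))

  shuf-++ : ∀ P Q Φ → shuf Φ (P ++ Q) ≈
    shuf (λ P₁ P₂ → shuf (λ Q₁ Q₂ → Φ (P₁ ++ Q₁) (P₂ ++ Q₂)) Q) P
  shuf-++ []      Q Φ = ≈-refl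
  shuf-++ (x ∷ P) Q Φ = +-cong (shuf-++ P Q _) (shuf-++ P Q _)

  Symmetric₂ : (List V → List V → Carrier) → Set ℓ
  Symmetric₂ Φ = ∀ {S S′ T T′} → S ↭ S′ → T ↭ T′ → Φ S T ≈ Φ S′ T′

  shuf-↭ : ∀ Φ → Symmetric₂ Φ → ∀ {U U′} → U ↭ U′ → shuf Φ U ≈ shuf Φ U′
  shuf-↭ Φ r ↭.refl         = ≈-refl
  shuf-↭ Φ r (prep x p)   = +-cong
    (shuf-↭ _ (λ q s → r (prep x q) s) p) (shuf-↭ _ (λ q s → r q (prep x s)) p)
  shuf-↭ Φ r (swap {xs = U} {ys = U′} x y p) = ≈-trans
    (+-cong
      (+-cong (≈-trans (shuf-↭ _ (λ q s → r (prep x (prep y q)) s) p)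
                       (shuf-cong U′ λ S T → r (swap x y ↭.refl) ↭.refl))
              (shuf-↭ _ (λ q s → r (prep x q) (prep y s)) p))
      (+-cong (shuf-↭ _ (λ q s → r (prep y q) (prep x s)) p)
              (≈-trans (shuf-↭ _ (λ q s → r q (prep x (prep y s))) p)
                       (shuf-cong U′ λ S T → r ↭.refl (swap x y ↭.refl)))))
    (+-interchange _ _ _ _)
  shuf-↭ Φ r (↭.trans p q)  = ≈-trans (shuf-↭ Φ r p) (shuf-↭ Φ r q)

  shuf-head-cancel : ∀ U {Φ Ψ} → (∀ S T → length T ℕ.< length U → Φ S T ≈ Ψ S T) →
    shuf Φ U ≈ shuf Ψ U → Φ [] U ≈ Ψ [] U
  shuf-head-cancel []      e p = p
  shuf-head-cancel (x ∷ U) {Φ} {Ψ} e p = shuf-head-cancel U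
    (λ S T lt → e S (x ∷ T) (ℕ.s≤s lt))
    (+-cancelˡ (shuf (λ S T → Φ (x ∷ S) T) U) _ _ (≈-trans p (+-congʳ (≈-sym (shuf-cong-length U
      λ S T q → e (x ∷ S) T (ℕ.s≤s (≡.subst (length T ℕ.≤_) q (ℕ.m≤n+m _ _))))))))

  infixl 7 _⊛_
  _⊛_ : (f g : List V → Carrier) → List V → Carrier
  (f ⊛ g) U = shuf (λ S T → f S * g T) U

  ⊛-cong : ∀ {f f′ g g′} → (∀ S → f S ≈ f′ S) → (∀ T → g T ≈ g′ T) → ∀ U → (f ⊛ g) U ≈ (f′ ⊛ g′) U
  ⊛-cong p q U = shuf-cong U λ S T → *-cong (p S) (q T)

  ⊛-distribʳ : ∀ f g h U → ((λ S → f S + g S) ⊛ h) U ≈ (f ⊛ h) U + (g ⊛ h) U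
  ⊛-distribʳ f g h U = ≈-trans (shuf-cong U λ S T → distribʳ _ _ _) (shuf-+ U _ _)

  ⊛-distribˡ : ∀ f g h U → (f ⊛ (λ S → g S + h S)) U ≈ (f ⊛ g) U + (f ⊛ h) U
  ⊛-distribˡ f g h U = ≈-trans (shuf-cong U λ S T → distribˡ _ _ _) (shuf-+ U _ _)

  ⊛-comm : ∀ f g U → (f ⊛ g) U ≈ (g ⊛ f) U
  ⊛-comm f g []      = *-comm _ _
  ⊛-comm f g (x ∷ U) = ≈-trans (+-cong (⊛-comm _ g U) (⊛-comm f _ U)) (+-comm _ _)

  ⊛-assoc : ∀ f g h U → ((f ⊛ g) ⊛ h) U ≈ (f ⊛ (g ⊛ h)) U
  ⊛-assoc f g h []      = *-assoc _ _ _
  ⊛-assoc f g h (x ∷ U) = begin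
    ((λ S → (∂ f ⊛ g) S + (f ⊛ ∂ g) S) ⊛ h) U + ((f ⊛ g) ⊛ ∂ h) U
      ≈⟨ +-congʳ (⊛-distribʳ (∂ f ⊛ g) (f ⊛ ∂ g) h U) ⟩
    (((∂ f ⊛ g) ⊛ h) U + ((f ⊛ ∂ g) ⊛ h) U) + ((f ⊛ g) ⊛ ∂ h) U
      ≈⟨ +-cong (+-cong (⊛-assoc (∂ f) g h U) (⊛-assoc f (∂ g) h U)) (⊛-assoc f g (∂ h) U) ⟩
    ((∂ f ⊛ (g ⊛ h)) U + (f ⊛ (∂ g ⊛ h)) U) + (f ⊛ (g ⊛ ∂ h)) U
      ≈⟨ +-assoc _ _ _ ⟩
    (∂ f ⊛ (g ⊛ h)) U + ((f ⊛ (∂ g ⊛ h)) U + (f ⊛ (g ⊛ ∂ h)) U)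
      ≈⟨ +-congˡ (⊛-distribˡ f (∂ g ⊛ h) (g ⊛ ∂ h) U) ⟨
    (∂ f ⊛ (g ⊛ h)) U + (f ⊛ (λ S → (∂ g ⊛ h) S + (g ⊛ ∂ h) S)) U ∎
    where
    ∂ : (List V → Carrier) → List V → Carrier
    ∂ f S = f (x ∷ S)

  ⊛-leftComm : ∀ f g h U → (f ⊛ (g ⊛ h)) U ≈ (g ⊛ (f ⊛ h)) U
  ⊛-leftComm f g h U = begin
    (f ⊛ (g ⊛ h)) U ≈⟨ ⊛-assoc f g h U ⟨
    ((f ⊛ g) ⊛ h) U ≈⟨ ⊛-cong (⊛-comm f g) (λ _ → ≈-refl) U ⟩
    ((g ⊛ f) ⊛ h) U ≈⟨ ⊛-assoc g f h U ⟩
    (g ⊛ (f ⊛ h)) U ∎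

  ε : List V → Carrier
  ε []      = 1#
  ε (_ ∷ _) = 0#

  ⊛-identityˡ : ∀ f U → (ε ⊛ f) U ≈ f U
  ⊛-identityˡ f []      = *-identityˡ _
  ⊛-identityˡ f (x ∷ U) = ≈-trans
    (+-cong (≈-trans (shuf-cong U λ S T → zeroˡ _) (shuf-0 U)) (⊛-identityˡ (λ T → f (x ∷ T)) U))
    (+-identityˡ _)

  ⊛-identityʳ : ∀ f U → (f ⊛ ε) U ≈ f U
  ⊛-identityʳ f U = ≈-trans (⊛-comm f ε U) (⊛-identityˡ f U)

  ⊛-neg : ∀ f g U → (f ⊛ (λ S → - g S)) U ≈ - (f ⊛ g) U
  ⊛-neg f g []      = ≈-sym (-‿distribʳ-* _ _)
  ⊛-neg f g (x ∷ U) = ≈-trans (+-cong (⊛-neg _ g U) (⊛-neg f _ U)) (-‿+-comm _ _)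

  Symmetric : (List V → Carrier) → Set ℓ
  Symmetric f = ∀ {S S′} → S ↭ S′ → f S ≈ f S′

  ⊛-symmetric : ∀ {f g} → Symmetric f → Symmetric g → Symmetric (f ⊛ g)
  ⊛-symmetric p q = shuf-↭ _ λ r s → *-cong (p r) (q s)

  ε-symmetric : Symmetric ε
  ε-symmetric ↭.refl       = ≈-refl
  ε-symmetric (prep _ _)   = ≈-refl
  ε-symmetric (swap _ _ _) = ≈-refl
  ε-symmetric (↭.trans p q)  = ≈-trans (ε-symmetric p) (ε-symmetric q)

  -- Induction on the size: in all terms but the one where `f` receives the empty list, `g` and `h`
  -- are evaluated at shorter lists.
  ⊛-cancelˡ : ∀ f {g h} → f [] ≈ 1# → (∀ U → (f ⊛ g) U ≈ (f ⊛ h) U) → ∀ U → g U ≈ h U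
  ⊛-cancelˡ f {g} {h} f₀ e U = go (length U) U ≡.refl
    where
    go : ∀ n U → length U ≡ n → g U ≈ h U
    go = <-rec _ λ n rec → λ { U ≡.refl → begin
      g U        ≈⟨ ≈-trans (*-congʳ f₀) (*-identityˡ _) ⟨
      f [] * g U ≈⟨ shuf-head-cancel U {λ S T → f S * g T} (λ S T lt → *-congˡ (rec lt T ≡.refl)) (e U) ⟩
      f [] * h U ≈⟨ ≈-trans (*-congʳ f₀) (*-identityˡ _) ⟩
      h U        ∎ }

  -- The Euler derivation, the analogue of t d/dt.
  D : (List V → Carrier) → List V → Carrier
  D f U = length U · f U

  D-⊛ : ∀ f g U → D (f ⊛ g) U ≈ (D f ⊛ g) U + (f ⊛ D g) U
  D-⊛ f g U = begin
    length U · (f ⊛ g) U                              ≈⟨ shuf-· (length U) U _ ⟨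
    shuf (λ S T → length U · (f S * g T)) U           ≈⟨ shuf-cong-length U Leibniz ⟩
    shuf (λ S T → D f S * g T + f S * D g T) U        ≈⟨ shuf-+ U _ _ ⟩
    (D f ⊛ g) U + (f ⊛ D g) U                         ∎
    where
    Leibniz : ∀ S T → length S ℕ.+ length T ≡ length U →
      length U · (f S * g T) ≈ D f S * g T + f S * D g T
    Leibniz S T p = begin
      length U · (f S * g T)                               ≈⟨ ×-congˡ (≡.sym p) ⟩
      (length S ℕ.+ length T) · (f S * g T)                ≈⟨ ×-homo-+ _ (length S) (length T) ⟩
      length S · (f S * g T) + length T · (f S * g T)      ≈⟨ +-cong (×-assoc-* (length S) _ _) (×-comm-* (length T) _ _) ⟨
      D f S * g T + f S * D g T                            ∎

-- Natural numbers with a prescribed sign.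

module Signs {c ℓ} (R : CommutativeRing c ℓ) where
  open CommutativeRing R hiding (zero)
  open DiagonalSums R
  open import Algebra.Properties.Ring ring using (-‿involutive)

  signed : ℕ → Carrier → Carrier
  signed zero    x = x
  signed (suc k) x = - signed k x

  signed-cong : ∀ k {x y} → x ≈ y → signed k x ≈ signed k y
  signed-cong zero    e = e
  signed-cong (suc k) e = -‿cong (signed-cong k e)

  signed-+ : ∀ k x y → signed k x + signed k y ≈ signed k (x + y)
  signed-+ zero    x y = refl
  signed-+ (suc k) x y = trans (-‿+-comm _ _) (-‿cong (signed-+ k x y))

  signed-* : ∀ j k x y → signed j x * signed k y ≈ signed (j ℕ.+ k) (x * y)
  signed-* zero    zero    x y = refl
  signed-* zero    (suc k) x y = trans (sym (-‿distribʳ-* _ _)) (-‿cong (signed-* zero k x y))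
  signed-* (suc j) k       x y = trans (sym (-‿distribˡ-* _ _)) (-‿cong (signed-* j k x y))

  signed-0 : ∀ k → signed k 0# ≈ 0#
  signed-0 zero    = refl
  signed-0 (suc k) = trans (-‿cong (signed-0 k)) -0#≈0#

  signed≈0 : ∀ k {x} → signed k x ≈ 0# → x ≈ 0#
  signed≈0 zero    e = e
  signed≈0 (suc k) e = signed≈0 k (trans (sym (-‿involutive _)) (trans (-‿cong e) -0#≈0#))

  infix 4 _≈±[_]_
  -- Keeping the sign (-1)^k apart from a natural number rules out cancellation in sums, in a ring
  -- without an order.
  _≈±[_]_ : Carrier → ℕ → ℕ → Set ℓ
  x ≈±[ k ] m = x ≈ signed k (m · 1#)

  ±-+ : ∀ {k x y m n} → x ≈±[ k ] m → y ≈±[ k ] n → x + y ≈±[ k ] m ℕ.+ n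
  ±-+ {k} {m = m} {n} p q = trans (+-cong p q) (trans (signed-+ k _ _)
    (signed-cong k (sym (×-homo-+ 1# m n))))

  ±-* : ∀ {j k x y m n} → x ≈±[ j ] m → y ≈±[ k ] n → x * y ≈±[ j ℕ.+ k ] m ℕ.* n
  ±-* {j} {k} {m = m} {n} p q = trans (*-cong p q) (trans (signed-* j k _ _)
    (signed-cong (j ℕ.+ k) (sym (×1-homo-* m n))))

module _ {V : Set} where

  All-Interleavingˡ : ∀ {P : V → Set} {S T U} → Interleaving S T U → All P U → All P S
  All-Interleavingˡ []        []       = []
  All-Interleavingˡ (consˡ i) (p ∷ ps) = p ∷ All-Interleavingˡ i ps
  All-Interleavingˡ (consʳ i) (_ ∷ ps) = All-Interleavingˡ i ps

  All-Interleavingʳ : ∀ {P : V → Set} {S T U} → Interleaving S T U → All P U → All P T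
  All-Interleavingʳ []        []       = []
  All-Interleavingʳ (consˡ i) (_ ∷ ps) = All-Interleavingʳ i ps
  All-Interleavingʳ (consʳ i) (p ∷ ps) = p ∷ All-Interleavingʳ i ps

-- Growing lists of vertices and connected components.

module Growth {V : Set} (adj : V → V → Bool) where

  infixr 6 _∪_
  _∪_ : (V → Bool) → (V → Bool) → V → Bool
  (B ∪ C) y = B y ∨ C y

  ∅ : V → Bool
  ∅ _ = false

  -- An order of discovery: the admissible vertices are at first those of `B`, and each vertex taken
  -- adds its neighbours. For `B = adj x` this certifies that every entry is connected to `x`.
  data Grows : (V → Bool) → List V → Set where
    []  : ∀ {B} → Grows B []
    _∷_ : ∀ {B x W} → B x ≡ true → Grows (B ∪ adj x) W → Grows B (x ∷ W)

  -- Each vertex goes to a side that already admits it, and its neighbours become admissible on that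
  -- side, so the two sides still cover. This finds a nonzero term in the recursion of `C`.
  Grows-split : ∀ {B B₁ B₂} → (∀ y → B y ≡ true → B₁ y ≡ true ⊎ B₂ y ≡ true) → ∀ {W} → Grows B W →
    ∃[ S ] ∃[ T ] Interleaving S T W × Grows B₁ S × Grows B₂ T
  Grows-split cover [] = [] , [] , [] , [] , []
  Grows-split {B} {B₁} {B₂} cover {x ∷ W} (Bx ∷ g) with cover x Bx
  ... | inj₁ B₁x = let S , T , i , gS , gT = Grows-split left g in x ∷ S , T , consˡ i , B₁x ∷ gS , gT
    where
    left : ∀ y → (B ∪ adj x) y ≡ true → (B₁ ∪ adj x) y ≡ true ⊎ B₂ y ≡ true
    left y e with adj x y
    ... | true = inj₁ (∨-zeroʳ (B₁ y))
    ... | false with B y in By | e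
    ...   | true | _ with cover y By
    ...     | inj₁ p = inj₁ (≡.cong (_∨ false) p)
    ...     | inj₂ p = inj₂ p
  ... | inj₂ B₂x = let S , T , i , gS , gT = Grows-split right g in S , x ∷ T , consʳ i , gS , B₂x ∷ gT
    where
    right : ∀ y → (B ∪ adj x) y ≡ true → B₁ y ≡ true ⊎ (B₂ ∪ adj x) y ≡ true
    right y e with adj x y
    ... | true = inj₂ (∨-zeroʳ (B₂ y))
    ... | false with B y in By | e
    ...   | true | _ with cover y By
    ...     | inj₁ p = inj₁ p
    ...     | inj₂ p = inj₂ (≡.cong (_∨ false) p)

  Grows-∷ʳ : ∀ {B W} r → Grows B W → B r ≡ true ⊎ Any (λ u → adj u r ≡ true) W → Grows B (W ++ [ r ])
  Grows-∷ʳ r [] (inj₁ Br) = Br ∷ []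
  Grows-∷ʳ r (Bx ∷ g) (inj₁ Br)        = Bx ∷ Grows-∷ʳ r g (inj₁ (≡.cong (_∨ _) Br))
  Grows-∷ʳ {B} r (Bx ∷ g) (inj₂ (here a)) =
    Bx ∷ Grows-∷ʳ r g (inj₁ (≡.trans (≡.cong (B r ∨_) a) (∨-zeroʳ (B r))))
  Grows-∷ʳ r (Bx ∷ g) (inj₂ (there p)) = Bx ∷ Grows-∷ʳ r g (inj₂ p)

  Separated : List V → List V → Set
  Separated P Q = All (λ x → All (λ y → adj x y ≡ false) Q) P

  Component : V → List V → Set
  Component x U = ∃[ P ] ∃[ Q ] U ↭ x ∷ P ++ Q × Grows (adj x) P × Separated (x ∷ P) Q × All (x ≢_) Q

  -- Greedy search: while some entry of `Q` is adjacent to `x` or to `W`, it moves to the end of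
  -- `W`. The length of `Q` bounds the number of moves.
  component : ∀ x W Q → Grows (adj x) W → All (x ≢_) Q → Component x (x ∷ W ++ Q)
  component x W Q = go (length Q) W Q ≡.refl
    where
    go : ∀ k W Q → length Q ≡ k → Grows (adj x) W → All (x ≢_) Q → Component x (x ∷ W ++ Q)
    go k W Q p g x∉ with Any.any? (λ r → Any.any? (λ u → adj u r Bool.≟ true) (x ∷ W)) Q
    ... | no none = W , Q , ↭.refl , g
        , All.tabulate (λ u∈ → All.tabulate λ r∈ → ¬-not λ e → none (lose r∈ (lose u∈ e))) , x∉
    ... | yes some with find some
    ...   | r , r∈ , a with ∈-∃++ r∈
    go zero    W _ p g x∉ | yes some | r , r∈ , a | ys , zs , ≡.refl =
      contradiction (≡.trans (≡.sym (↭-length (shift r ys zs))) p) λ ()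
    go (suc k) W _ p g x∉ | yes some | r , r∈ , a | ys , zs , ≡.refl =
      let W′ , Q′ , π , rest = go k (W ++ [ r ]) (ys ++ zs)
            (ℕ.suc-injective (≡.trans (≡.sym (↭-length (shift r ys zs))) p))
            (Grows-∷ʳ r g (new a)) (All.tail (All-resp-↭ (shift r ys zs) x∉))
      in W′ , Q′ , ↭.trans (prep x (↭.trans (++⁺ˡ W (shift r ys zs))
           (↭.↭-reflexive (≡.sym (++-assoc W [ r ] (ys ++ zs)))))) π , rest
      where
      new : Any (λ u → adj u r ≡ true) (x ∷ W) → adj x r ≡ true ⊎ Any (λ u → adj u r ≡ true) W
      new (here e)  = inj₁ e
      new (there e) = inj₂ e

-- Stable sets, the logarithmic derivative and acyclic orientations.

module StableSets {c ℓ} (R : CommutativeRing c ℓ) (V : Set)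
  (adj : V → V → Bool) (adj-sym : ∀ x y → adj x y ≡ adj y x) where
  open CommutativeRing R hiding (zero) renaming (refl to ≈-refl; sym to ≈-sym; trans to ≈-trans)
  open DiagonalSums R
  open Shuffle R V
  open Signs R
  open Growth adj
  open SetoidReasoning setoid

  -- The indicator of the stable sets that avoid B.
  θ : (V → Bool) → List V → Carrier
  θ B []      = 1#
  θ B (x ∷ U) = if B x then 0# else θ (B ∪ adj x) U

  θ-agree : ∀ B B′ {U} → All (λ y → B y ≡ B′ y) U → θ B U ≈ θ B′ U
  θ-agree B B′ [] = ≈-refl
  θ-agree B B′ {x ∷ U} (e ∷ es) rewrite e with B′ x
  ... | true  = ≈-refl
  ... | false = θ-agree (B ∪ adj x) (B′ ∪ adj x) (All.map (λ {y} → ≡.cong (_∨ adj x y)) es)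

  θ-cong : ∀ B B′ → (∀ y → B y ≡ B′ y) → ∀ U → θ B U ≈ θ B′ U
  θ-cong B B′ e U = θ-agree B B′ (All.universal e U)

  θ-meets : ∀ B {U} → Any (λ y → B y ≡ true) U → θ B U ≈ 0#
  θ-meets B (here e) rewrite e = ≈-refl
  θ-meets B {x ∷ U} (there p) with B x
  ... | true  = ≈-refl
  ... | false = θ-meets (B ∪ adj x) (Any-map p)
    where
    Any-map : ∀ {U} → Any (λ y → B y ≡ true) U → Any (λ y → B y ∨ adj x y ≡ true) U
    Any-map (here e) = here (≡.cong (_∨ _) e)
    Any-map (there p) = there (Any-map p)

  θ-symmetric : ∀ B → Symmetric (θ B)
  θ-symmetric B ↭.refl        = ≈-refl
  θ-symmetric B (↭.trans p q) = ≈-trans (θ-symmetric B p) (θ-symmetric B q)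
  θ-symmetric B (prep x p) with B x
  ... | true  = ≈-refl
  ... | false = θ-symmetric (B ∪ adj x) p
  θ-symmetric B (swap {xs = U} {ys = U′} x y p) rewrite adj-sym y x with B x | B y
  ... | true  | true  = ≈-refl
  ... | true  | false = ≈-refl
  ... | false | true  = ≈-refl
  ... | false | false with adj x y
  ...   | true  = ≈-refl
  ...   | false = ≈-trans (θ-symmetric _ p) (θ-cong _ _
    (λ z → ≡.trans (∨-assoc (B z) _ _) (≡.trans (≡.cong (B z ∨_) (∨-comm (adj x z) (adj y z)))
      (≡.sym (∨-assoc (B z) _ _)))) U′)

  θ# : ℕ → List V → Carrier
  θ# a U = δ (length U) a * θ ∅ U

  θ#-symmetric : ∀ a → Symmetric (θ# a)
  θ#-symmetric a p = *-cong (reflexive (≡.cong (λ n → δ n a) (↭-length p))) (θ-symmetric ∅ p)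

  -- The chromatic symmetric function of the subgraph induced on U.
  Z : List ℕ → List V → Carrier
  Z []      = ε
  Z (a ∷ α) = θ# a ⊛ Z α

  Z-symmetric : ∀ α → Symmetric (Z α)
  Z-symmetric []      = ε-symmetric
  Z-symmetric (a ∷ α) = ⊛-symmetric {θ# a} {Z α} (θ#-symmetric a) (Z-symmetric α)

  Z-↭ : ∀ {α β} → α ↭ β → ∀ U → Z α U ≈ Z β U
  Z-↭ ↭.refl        U = ≈-refl
  Z-↭ (prep a p)    U = ⊛-cong {θ# a} (λ _ → ≈-refl) (Z-↭ p) U
  Z-↭ (↭.trans p q) U = ≈-trans (Z-↭ p U) (Z-↭ q U)
  Z-↭ (swap {xs = α} {ys = β} a b p) U = ≈-trans (⊛-leftComm (θ# a) (θ# b) (Z α) U)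
    (⊛-cong {θ# b} (λ _ → ≈-refl) (⊛-cong {θ# a} (λ _ → ≈-refl) (Z-↭ p)) U)

  Z-0∷ : ∀ α U → Z (0 ∷ α) U ≈ Z α U
  Z-0∷ α U = ≈-trans (⊛-cong {θ# 0} θ#0≈ε (λ _ → ≈-refl) U) (⊛-identityˡ (Z α) U)
    where
    θ#0≈ε : ∀ S → θ# 0 S ≈ ε S
    θ#0≈ε []      = *-identityˡ _
    θ#0≈ε (_ ∷ _) = zeroˡ _

  Z-degree : ∀ α U → ¬ sum α ≡ length U → Z α U ≈ 0#
  Z-degree []      []      ne = contradiction ≡.refl ne
  Z-degree []      (x ∷ U) ne = ≈-refl
  Z-degree (a ∷ α) U       ne = ≈-trans (shuf-cong-length U vanish) (shuf-0 U)
    where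
    vanish : ∀ S T → length S ℕ.+ length T ≡ length U → θ# a S * Z α T ≈ 0#
    vanish S T p with length S ℕ.≟ a
    ... | yes ≡.refl = ≈-trans (*-congˡ (Z-degree α T λ e → ne (≡.trans (≡.cong (length S ℕ.+_) e) p))) (zeroʳ _)
    ... | no  s≢a    = ≈-trans (*-congʳ (≈-trans (*-congʳ (δ-≢ (length S) a s≢a)) (zeroˡ _))) (zeroˡ _)

  -- The coefficient of the power sum of degree `length U`, multiplied by that degree. The value 0
  -- at the empty list is forced by `θ⊛A`.
  A : List V → Carrier
  A []      = 0#
  A (x ∷ W) = χ 1 (length W) (λ α → Z α (x ∷ W))

  -- A is the logarithmic derivative of θ ∅.
  θ⊛A : ∀ U → (θ ∅ ⊛ A) U ≈ D (θ ∅) U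
  θ⊛A []         = zeroʳ _
  θ⊛A U@(x ∷ W) = begin
    -- The factor `θ# a S` forces `a = length S`, so `m + 1 = length T` and one term of the diagonal
    -- survives. For empty `T` this `a` would be `n + 1`, outside the diagonal, in accordance with
    -- `A [] = 0`.
    (θ ∅ ⊛ A) U ≈⟨ shuf-cong-length U (λ S T p → pick S T (≡.trans (ℕ.+-comm (length T) _) p)) ⟨
    shuf (λ S T → diag n λ a m → θ# a S * b m T) U
      ≈⟨ diag-homo (shuf-linear U) n (λ a m (S , T) → θ# a S * b m T) ⟩
    diag n (λ a m → shuf (λ S T → θ# a S * b m T) U)
      ≈⟨ diag-cong n (λ a m → shuf-cong U λ S T → *-homo (χ-linear 1 m) (θ# a S) (λ α → Z α T)) ⟨
    diag n (λ a m → shuf (λ S T → χ 1 m (λ α → θ# a S * Z α T)) U)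
      ≈⟨ diag-cong n (λ a m → shuf-homo (χ-linear 1 m) U (λ α S T → θ# a S * Z α T)) ⟨
    diag n (λ a m → χ 1 m (λ α → Z (a ∷ α) U)) ≈⟨ newton n (λ α → Z α U) (λ α → Z-0∷ α U) ⟩
    suc n · Z [ suc n ] U   ≈⟨ ×-congʳ (suc n) (⊛-identityʳ (θ# (suc n)) U) ⟩
    suc n · θ# (suc n) U    ≈⟨ ×-congʳ (suc n) (≈-trans (*-congʳ (δ-refl (suc n))) (*-identityˡ _)) ⟩
    D (θ ∅) U               ∎
    where
    n = length W
    b : ℕ → List V → Carrier
    b m T = χ 1 m (λ α → Z α T)
    out : ∀ S T → (diag n λ a m → θ# a S * b m T) ≈ θ ∅ S * (diag n λ a m → δ (length S) a * b m T)
    out S T = ≈-trans (diag-cong n λ a m → ≈-trans (*-congʳ (*-comm _ _)) (*-assoc _ _ _))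
      (diag-*ˡ n (θ ∅ S) _)
    pick : ∀ S T → length T ℕ.+ length S ≡ suc n → (diag n λ a m → θ# a S * b m T) ≈ θ ∅ S * A T
    pick S [] p = ≈-trans (out S []) (*-congˡ (diag-δ-< n (length S) (λ m → b m []) (ℕ.≤-reflexive (≡.sym p))))
    pick S T@(_ ∷ T′) p = ≈-trans (out S T) (*-congˡ (≈-trans
      (reflexive (≡.cong (λ k → diag k λ a m → δ (length S) a * b m T)
        (≡.sym (≡.trans (ℕ.+-comm (length S) _) (ℕ.suc-injective p)))))
      (diag-δ (length S) (length T′) (λ m → b m T))))

  extract : (V → Bool) → List V → Maybe (V × List V)
  extract B []      = nothing
  extract B (y ∷ U) = if B y then just (y , U) else Maybe.map (map₂ (y ∷_)) (extract B U)

  extract-length : ∀ B U {x W} → extract B U ≡ just (x , W) → length U ≡ suc (length W)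
  extract-length B (y ∷ U) e with B y
  extract-length B (y ∷ U) ≡.refl | true = ≡.refl
  extract-length B (y ∷ U) e | false with extract B U in eq
  extract-length B (y ∷ U) ≡.refl | false | just _ = ≡.cong suc (extract-length B U eq)

  extract-just : ∀ B U {x W} → extract B U ≡ just (x , W) → B x ≡ true × Any (λ y → B y ≡ true) U
  extract-just B (y ∷ U) e with B y in By
  extract-just B (y ∷ U) ≡.refl | true = By , here By
  extract-just B (y ∷ U) e | false with extract B U in eq
  extract-just B (y ∷ U) ≡.refl | false | just _ = map₂ there (extract-just B U eq)

  extract-nothing : ∀ B U → extract B U ≡ nothing → All (λ y → B y ≡ false) U
  extract-nothing B []      e = []
  extract-nothing B (y ∷ U) e with B y in By
  extract-nothing B (y ∷ U) () | true
  ... | false with extract B U in eq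
  ...   | nothing = By ∷ extract-nothing B U eq

  nothing-extract : ∀ B {U} → All (λ y → B y ≡ false) U → extract B U ≡ nothing
  nothing-extract B [] = ≡.refl
  nothing-extract B (By ∷ p) rewrite By | nothing-extract B p = ≡.refl

  extract-∷ : ∀ B {x} W → B x ≡ true → extract B (x ∷ W) ≡ just (x , W)
  extract-∷ B W Bx rewrite Bx = ≡.refl

  -- Differentiation at the first vertex in `B` instead of the head of the list. Symmetry in `T` is
  -- not at hand for `C`, whose recursion depends on the order; it is enough that the extracted
  -- vertex may be brought to the front.
  shuf-extract : ∀ B Φ → (∀ {S S′} T → S ↭ S′ → Φ S T ≈ Φ S′ T) →
    (∀ S T {x T′} → extract B T ≡ just (x , T′) → Φ S T ≈ Φ S (x ∷ T′)) →
    ∀ U {x W} → extract B U ≡ just (x , W) →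
    shuf Φ U ≈ shuf (λ S T → Φ (x ∷ S) T + Φ S (x ∷ T)) W
  shuf-extract B Φ l r (y ∷ U) e with B y in By
  shuf-extract B Φ l r (y ∷ U) ≡.refl | true = ≈-sym (shuf-+ U _ _)
  shuf-extract B Φ l r (y ∷ U) e | false with extract B U in eq
  shuf-extract B Φ l r (y ∷ U) ≡.refl | false | just (x , W) = +-cong
    (≈-trans (shuf-extract B (λ S T → Φ (y ∷ S) T) (λ T p → l T (prep y p)) (λ S T → r (y ∷ S) T) U eq)
      (shuf-cong W λ S T → +-congʳ (l T (swap y x ↭.refl))))
    (≈-trans (shuf-extract B (λ S T → Φ S (y ∷ T)) (λ T → l (y ∷ T))
        (λ S T {z} {T′} p → ≈-trans (r S (y ∷ T) (skip p))
          (≈-sym (r S (y ∷ z ∷ T′) (skip (extract-∷ B T′ (proj₁ (extract-just B T p))))))) U eq)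
      (shuf-cong W λ S T → +-congˡ (r S (y ∷ x ∷ T) (skip (extract-∷ B T (proj₁ (extract-just B U eq)))))))
    where
    skip : ∀ {T z T′} → extract B T ≡ just (z , T′) → extract B (y ∷ T) ≡ just (z , y ∷ T′)
    skip p rewrite By | p = ≡.refl

  -- The first argument bounds the length of the list; beyond it, 0# is a junk value.
  mutual
    C′ : ℕ → (V → Bool) → List V → Carrier
    C′ k       B []      = 1#
    C′ zero    B (_ ∷ _) = 0#
    C′ (suc k) B (y ∷ U) = C-step k B (extract B (y ∷ U))

    C-step : ℕ → (V → Bool) → Maybe (V × List V) → Carrier
    C-step k B nothing        = 0#
    C-step k B (just (x , W)) = - (C′ k (adj x) ⊛ C′ k B) W

  -- C B U is (-1)^|U| times the number of acyclic orientations of U with all sinks in B; it is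
  -- obtained by splitting off the first vertex of U that may be a sink.
  C : (V → Bool) → List V → Carrier
  C B U = C′ (length U) B U

  C′≈C : ∀ k B U → length U ℕ.≤ k → C′ k B U ≈ C B U
  C′≈C k B U p = go k (length U) B U p ℕ.≤-refl
    where
    go : ∀ k k′ B U → length U ℕ.≤ k → length U ℕ.≤ k′ → C′ k B U ≈ C′ k′ B U
    go k k′ B [] p q = ≈-refl
    go (suc k) (suc k′) B (y ∷ U) (ℕ.s≤s p) (ℕ.s≤s q) with extract B (y ∷ U) in eq
    ... | nothing      = ≈-refl
    ... | just (x , W) = -‿cong (shuf-cong-length W λ S T e →
        let s = ℕ.≤-trans (ℕ.m≤m+n _ _) (ℕ.≤-reflexive (≡.trans e (≡.sym U≡W)))
            t = ℕ.≤-trans (ℕ.m≤n+m _ _) (ℕ.≤-reflexive (≡.trans e (≡.sym U≡W)))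
        in *-cong (go k k′ (adj x) S (ℕ.≤-trans s p) (ℕ.≤-trans s q))
                  (go k k′ B T (ℕ.≤-trans t p) (ℕ.≤-trans t q)))
      where
      U≡W : length U ≡ length W
      U≡W = ℕ.suc-injective (extract-length B (y ∷ U) eq)

  C-just : ∀ B U {x W} → extract B U ≡ just (x , W) → C B U ≈ - (C (adj x) ⊛ C B) W
  C-just B U@(y ∷ U′) {x} {W} e = ≈-trans (reflexive (≡.cong (C-step (length U′) B) e))
    (-‿cong (shuf-cong-length W λ S T p →
      *-cong (C′≈C (length U′) (adj x) S (ℕ.≤-trans (ℕ.m≤m+n _ _) (ℕ.≤-reflexive (≡.trans p W≡U))))
             (C′≈C (length U′) B T (ℕ.≤-trans (ℕ.m≤n+m _ _) (ℕ.≤-reflexive (≡.trans p W≡U))))))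
    where
    W≡U : length W ≡ length U′
    W≡U = ≡.sym (ℕ.suc-injective (extract-length B U e))

  C-nothing : ∀ B U → All (λ y → B y ≡ false) U → C B U ≈ ε U
  C-nothing B []      p = ≈-refl
  C-nothing B (y ∷ U) p = reflexive (≡.cong (C-step (length U) B) (nothing-extract B p))

  -- The recursion of `C` is made for this. For `x` in `B` and `N = adj x`, the derivative of `θ B`
  -- at `x` is 0, and that of `θ ∅` is `θ N`. Hence θ_N C_B + θ (C_B)' = 0, and with θ_N = θ C_N,
  -- known on smaller sets, cancelling θ gives (C_B)' = -C_N C_B.
  θ⊛C : ∀ B U → (θ ∅ ⊛ C B) U ≈ θ B U
  θ⊛C B U = go (length U) B U ≡.refl
    where
    go : ∀ n B U → length U ≡ n → (θ ∅ ⊛ C B) U ≈ θ B U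
    go = <-rec _ step
      where
      step : ∀ n → (∀ {m} → m ℕ.< n → ∀ B U → length U ≡ m → (θ ∅ ⊛ C B) U ≈ θ B U) →
        ∀ B U → length U ≡ n → (θ ∅ ⊛ C B) U ≈ θ B U
      step _ rec B U ≡.refl with extract B U in eq
      ... | nothing = begin
        (θ ∅ ⊛ C B) U ≈⟨ shuf-cong-Interleaving U (λ {S} {T} i →
                           *-congˡ (C-nothing B T (All-Interleavingʳ i avoid))) ⟩
        (θ ∅ ⊛ ε) U   ≈⟨ ⊛-identityʳ (θ ∅) U ⟩
        θ ∅ U         ≈⟨ θ-agree B ∅ avoid ⟨
        θ B U         ∎
        where avoid = extract-nothing B U eq
      ... | just (x , W) = begin
        (θ ∅ ⊛ C B) U
          ≈⟨ shuf-extract B (λ S T → θ ∅ S * C B T) (λ T p → *-congʳ (θ-symmetric ∅ p))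
               (λ S T e → *-congˡ (≈-trans (C-just B T e) (≈-sym (C-∷ _ (proj₁ (extract-just B T e)))))) U eq ⟩
        shuf (λ S T → θ N S * C B T + θ ∅ S * C B (x ∷ T)) W ≈⟨ shuf-+ W _ _ ⟩
        (θ N ⊛ C B) W + (θ ∅ ⊛ (λ T → C B (x ∷ T))) W
          ≈⟨ +-congˡ (⊛-cong {θ ∅} (λ _ → ≈-refl) (λ T → C-∷ T Bx) W) ⟩
        (θ N ⊛ C B) W + (θ ∅ ⊛ (λ T → - (C N ⊛ C B) T)) W ≈⟨ +-congˡ (⊛-neg (θ ∅) (C N ⊛ C B) W) ⟩
        (θ N ⊛ C B) W + - (θ ∅ ⊛ (C N ⊛ C B)) W  ≈⟨ +-congˡ (-‿cong (⊛-assoc (θ ∅) (C N) (C B) W)) ⟨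
        (θ N ⊛ C B) W + - ((θ ∅ ⊛ C N) ⊛ C B) W  ≈⟨ +-congˡ (-‿cong (shuf-cong-length W λ S T p →
            *-congʳ (rec (≡.subst (length S ℕ.<_) (≡.sym (extract-length B U eq))
              (ℕ.s≤s (≡.subst (length S ℕ.≤_) p (ℕ.m≤m+n _ _)))) N S ≡.refl))) ⟩
        (θ N ⊛ C B) W + - (θ N ⊛ C B) W          ≈⟨ -‿inverseʳ _ ⟩
        0#                                       ≈⟨ θ-meets B (proj₂ (extract-just B U eq)) ⟨
        θ B U                                    ∎
        where
        N = adj x
        Bx = proj₁ (extract-just B U eq)
        C-∷ : ∀ {z} T → B z ≡ true → C B (z ∷ T) ≈ - (C (adj z) ⊛ C B) T
        C-∷ {z} T Bz = C-just B (z ∷ T) (extract-∷ B T Bz)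

  -- Differentiate θ A = D θ at `x`: this gives θ_N A + θ A' = θ_N + D θ_N. Put θ_N = θ C_N; then D
  -- θ_N = (D θ) C_N + θ D C_N, and (D θ) C_N = θ A C_N = θ_N A cancels. Cancelling θ leaves A' =
  -- C_N + D C_N.
  A-∷ : ∀ x W → A (x ∷ W) ≈ suc (length W) · C (adj x) W
  A-∷ x = ⊛-cancelˡ (θ ∅) ≈-refl λ W → +-cancelˡ ((D (θ ∅) ⊛ C N) W) _ _ (begin
    (D (θ ∅) ⊛ C N) W + (θ ∅ ⊛ (λ T → A (x ∷ T))) W     ≈⟨ +-congʳ (⊛-cong {g = C N} θ⊛A (λ _ → ≈-refl) W) ⟨
    ((θ ∅ ⊛ A) ⊛ C N) W + (θ ∅ ⊛ (λ T → A (x ∷ T))) W   ≈⟨ +-congʳ (rearrange W) ⟩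
    (θ N ⊛ A) W + (θ ∅ ⊛ (λ T → A (x ∷ T))) W           ≈⟨ θ⊛A (x ∷ W) ⟩
    suc (length W) · θ N W                              ≈⟨ ×-congʳ (suc (length W)) (θ⊛C N W) ⟨
    (θ ∅ ⊛ C N) W + D (θ ∅ ⊛ C N) W                     ≈⟨ +-congˡ (D-⊛ (θ ∅) (C N) W) ⟩
    (θ ∅ ⊛ C N) W + ((D (θ ∅) ⊛ C N) W + (θ ∅ ⊛ D (C N)) W) ≈⟨ x+[y+z]≈y+[x+z] _ _ _ ⟩
    (D (θ ∅) ⊛ C N) W + ((θ ∅ ⊛ C N) W + (θ ∅ ⊛ D (C N)) W) ≈⟨ +-congˡ (⊛-distribˡ (θ ∅) (C N) (D (C N)) W) ⟨
    (D (θ ∅) ⊛ C N) W + (θ ∅ ⊛ (λ T → suc (length T) · C N T)) W ∎)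
    where
    N = adj x
    x+[y+z]≈y+[x+z] : ∀ x y z → x + (y + z) ≈ y + (x + z)
    x+[y+z]≈y+[x+z] x y z = ≈-trans (≈-sym (+-assoc x y z)) (≈-trans (+-congʳ (+-comm x y)) (+-assoc y x z))
    rearrange : ∀ W → ((θ ∅ ⊛ A) ⊛ C N) W ≈ (θ N ⊛ A) W
    rearrange W = begin
      ((θ ∅ ⊛ A) ⊛ C N) W ≈⟨ ⊛-assoc (θ ∅) A (C N) W ⟩
      (θ ∅ ⊛ (A ⊛ C N)) W ≈⟨ ⊛-cong {θ ∅} (λ _ → ≈-refl) (⊛-comm A (C N)) W ⟩
      (θ ∅ ⊛ (C N ⊛ A)) W ≈⟨ ⊛-assoc (θ ∅) (C N) A W ⟨
      ((θ ∅ ⊛ C N) ⊛ A) W ≈⟨ ⊛-cong {g = A} (θ⊛C N) (λ _ → ≈-refl) W ⟩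
      (θ N ⊛ A) W         ∎

  shuf-≈± : ∀ k U {Φ} → (∀ S T → length S ℕ.+ length T ≡ length U → ∃[ m ] Φ S T ≈±[ k ] m) →
    ∃[ m ] shuf Φ U ≈±[ k ] m
  shuf-≈± k []      h = h [] [] ≡.refl
  shuf-≈± k (x ∷ U) h =
    let m , p = shuf-≈± k U λ S T e → h (x ∷ S) T (≡.cong suc e)
        n , q = shuf-≈± k U λ S T e → h S (x ∷ T) (≡.trans (ℕ.+-suc _ _) (≡.cong suc e))
    in m ℕ.+ n , ±-+ {k} {m = m} {n} p q

  -- All terms carry the sign (-1)^k, so nothing can cancel the one that is known to be nonzero.
  shuf-≈±-suc : ∀ k {S₀ T₀ U Φ} → (∀ S T → length S ℕ.+ length T ≡ length U → ∃[ m ] Φ S T ≈±[ k ] m) →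
    Interleaving S₀ T₀ U → (∃[ m ] Φ S₀ T₀ ≈±[ k ] suc m) → ∃[ m ] shuf Φ U ≈±[ k ] suc m
  shuf-≈±-suc k h []        pos = pos
  shuf-≈±-suc k {U = x ∷ U} h (consˡ i) pos =
    let m , p = shuf-≈±-suc k (λ S T e → h (x ∷ S) T (≡.cong suc e)) i pos
        n , q = shuf-≈± k U λ S T e → h S (x ∷ T) (≡.trans (ℕ.+-suc _ _) (≡.cong suc e))
    in m ℕ.+ n , ±-+ {k} {m = suc m} {n} p q
  shuf-≈±-suc k {U = x ∷ U} h (consʳ i) pos =
    let m , p = shuf-≈± k U λ S T e → h (x ∷ S) T (≡.cong suc e)
        n , q = shuf-≈±-suc k (λ S T e → h S (x ∷ T) (≡.trans (ℕ.+-suc _ _) (≡.cong suc e))) i pos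
    in m ℕ.+ n , ≈-trans (±-+ {k} {m = m} {suc n} p q) (signed-cong k (×-congˡ (ℕ.+-suc m n)))

  ⊛-≈± : ∀ {f g : List V → Carrier} → (∀ S → ∃[ m ] f S ≈±[ length S ] m) → (∀ T → ∃[ m ] g T ≈±[ length T ] m) →
    ∀ {k} S T → length S ℕ.+ length T ≡ k → ∃[ m ] f S * g T ≈±[ k ] m
  ⊛-≈± p q S T ≡.refl = let m , x = p S ; n , y = q T in m ℕ.* n , ±-* {length S} {length T} {m = m} {n} x y

  C′-≈± : ∀ k B U → ∃[ m ] C′ k B U ≈±[ length U ] m
  C′-≈± k       B []      = 1 , ≈-sym (+-identityʳ _)
  C′-≈± zero    B U@(_ ∷ _) = 0 , ≈-sym (signed-0 (length U))
  C′-≈± (suc k) B U@(y ∷ U′) with extract B U in eq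
  ... | nothing      = 0 , ≈-sym (signed-0 (length U))
  ... | just (x , W) with shuf-≈± (length W) W (⊛-≈± (C′-≈± k (adj x)) (C′-≈± k B))
  ...   | m , p = m , ≈-trans (-‿cong p)
    (reflexive (≡.cong (λ l → signed l (m · 1#)) (≡.sym (extract-length B U eq))))

  -- `Grows-split` selects a term of the recursion whose factors live on lists growing from `adj x`
  -- and from `B`; both are nonzero by induction.
  C′-≈±-suc : ∀ k {B U} → length U ℕ.≤ k → Grows B U → ∃[ m ] C′ k B U ≈±[ length U ] suc m
  C′-≈±-suc k       _ [] = 0 , ≈-sym (+-identityʳ _)
  C′-≈±-suc (suc k) {B} {x ∷ W} (ℕ.s≤s le) (Bx ∷ g) rewrite Bx =
    let S , T , i , gS , gT = Grows-split {B₁ = adj x} {B} cover g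
        len = interleave-length i
        m , p = C′-≈±-suc k (ℕ.≤-trans (ℕ.≤-trans (ℕ.m≤m+n _ _) (ℕ.≤-reflexive (≡.sym len))) le) gS
        n , q = C′-≈±-suc k (ℕ.≤-trans (ℕ.≤-trans (ℕ.m≤n+m _ _) (ℕ.≤-reflexive (≡.sym len))) le) gT
        l , r = shuf-≈±-suc (length W) (⊛-≈± (C′-≈± k (adj x)) (C′-≈± k B)) i
          -- The predecessor of `suc m ℕ.* suc n`.
          (n ℕ.+ m ℕ.* suc n , ≈-trans (±-* {length S} {length T} {m = suc m} {suc n} p q)
            (reflexive (≡.cong (λ j → signed j ((suc m ℕ.* suc n) · 1#)) (≡.sym len))))
    in l , -‿cong r
    where
    cover : ∀ y → (B ∪ adj x) y ≡ true → adj x y ≡ true ⊎ B y ≡ true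
    cover y e with B y
    ... | true  = inj₂ ≡.refl
    ... | false = inj₁ e

  A-≈±-suc : ∀ x W → Grows (adj x) W → ∃[ m ] A (x ∷ W) ≈±[ length W ] suc m
  A-≈±-suc x W g = let m , p = C′-≈±-suc (length W) ℕ.≤-refl g in
    m ℕ.+ length W ℕ.* suc m , (begin
    A (x ∷ W)                                        ≈⟨ A-∷ x W ⟩
    suc (length W) · C (adj x) W                     ≈⟨ ×-congʳ (suc (length W)) p ⟩
    suc (length W) · signed (length W) (suc m · 1#)  ≈⟨ ·-signed (length W) (suc (length W)) _ ⟩
    signed (length W) (suc (length W) · (suc m · 1#)) ≈⟨ signed-cong (length W) (×-assocˡ 1# (suc (length W)) (suc m)) ⟩
    signed (length W) ((suc (length W) ℕ.* suc m) · 1#) ∎)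
    where
    ·-signed : ∀ k n y → n · signed k y ≈ signed k (n · y)
    ·-signed k zero    y = ≈-sym (signed-0 k)
    ·-signed k (suc n) y = ≈-trans (+-congˡ (·-signed k n y)) (signed-+ k _ _)

  -- Multiplicativity over vertex sets without edges between them.

  θ-++ : ∀ B P Q → All (λ y → B y ≡ false) Q → Separated P Q → θ B (P ++ Q) ≈ θ B P * θ ∅ Q
  θ-++ B []      Q avoid []        = ≈-trans (θ-agree B ∅ avoid) (≈-sym (*-identityˡ _))
  θ-++ B (x ∷ P) Q avoid (sx ∷ sp) with B x
  ... | true  = ≈-sym (zeroˡ _)
  ... | false = θ-++ (B ∪ adj x) P Q (All.zipWith (λ (p , q) → ≡.cong₂ _∨_ p q) (avoid , sx)) sp

  θ#-++ : ∀ a P Q → Separated P Q → θ# a (P ++ Q) ≈ diag a (λ i j → θ# i P * θ# j Q)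
  θ#-++ a P Q sep = begin
    δ (length (P ++ Q)) a * θ ∅ (P ++ Q)
      ≈⟨ *-cong (reflexive (≡.cong (λ n → δ n a) (length-++ P))) (θ-++ ∅ P Q (All.universal (λ _ → ≡.refl) Q) sep) ⟩
    δ (length P ℕ.+ length Q) a * w                    ≈⟨ *-congʳ (diag-δ-δ (length P) (length Q) a) ⟨
    diag a (λ i j → δ (length P) i * δ (length Q) j) * w ≈⟨ *-comm _ _ ⟩
    w * diag a (λ i j → δ (length P) i * δ (length Q) j) ≈⟨ diag-*ˡ a w _ ⟨
    diag a (λ i j → w * (δ (length P) i * δ (length Q) j))
      ≈⟨ diag-cong a (λ i j → ≈-trans (*-comm _ _) (interchange *-commutativeSemigroup _ _ _ _)) ⟩
    diag a (λ i j → θ# i P * θ# j Q)                   ∎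
    where
    w = θ ∅ P * θ ∅ Q

  -- A colour class in the union is a pair of stable sets whose sizes add up to the exponent. After
  -- this the proof only exchanges sums, using bilinearity of `⋆`.
  Z-++ : ∀ α P Q → Separated P Q → Z α (P ++ Q) ≈ ((λ β → Z β P) ⋆ (λ γ → Z γ Q)) α
  Z-++ []      []      Q sep = ≈-sym (*-identityˡ _)
  Z-++ []      (_ ∷ _) Q sep = ≈-sym (zeroˡ _)
  Z-++ (a ∷ α) P Q sep = begin
    Z (a ∷ α) (P ++ Q) ≈⟨ shuf-++ P Q _ ⟩
    shuf (λ P₁ P₂ → shuf (λ Q₁ Q₂ → θ# a (P₁ ++ Q₁) * Z α (P₂ ++ Q₂)) Q) P
      ≈⟨ shuf-cong-Interleaving P (λ p → shuf-cong-Interleaving Q λ q → *-cong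
           (θ#-++ a _ _ (All.map (All-Interleavingˡ q) (All-Interleavingˡ p sep)))
           (Z-++ α _ _ (All.map (All-Interleavingʳ q) (All-Interleavingʳ p sep)))) ⟩
    shuf (λ P₁ P₂ → shuf (λ Q₁ Q₂ → diag a (λ i j → θ# i P₁ * θ# j Q₁) * Y P₂ Q₂) Q) P
      ≈⟨ shuf-cong P (λ P₁ P₂ → shuf-cong Q λ Q₁ Q₂ → ≈-trans (*-comm _ _)
           (≈-trans (≈-sym (diag-*ˡ a _ _)) (diag-cong a λ i j → ≈-trans (*-comm _ _) (*-assoc _ _ _)))) ⟩
    shuf (λ P₁ P₂ → shuf (λ Q₁ Q₂ → diag a λ i j → θ# i P₁ * (θ# j Q₁ * Y P₂ Q₂)) Q) P
      ≈⟨ shuf-cong P (λ P₁ P₂ → diag-homo (shuf-linear Q) a (λ i j (Q₁ , Q₂) → θ# i P₁ * (θ# j Q₁ * Y P₂ Q₂))) ⟩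
    shuf (λ P₁ P₂ → diag a λ i j → shuf (λ Q₁ Q₂ → θ# i P₁ * (θ# j Q₁ * Y P₂ Q₂)) Q) P
      ≈⟨ diag-homo (shuf-linear P) a (λ i j (P₁ , P₂) → shuf (λ Q₁ Q₂ → θ# i P₁ * (θ# j Q₁ * Y P₂ Q₂)) Q) ⟩
    diag a (λ i j → shuf (λ P₁ P₂ → shuf (λ Q₁ Q₂ → θ# i P₁ * (θ# j Q₁ * Y P₂ Q₂)) Q) P)
      ≈⟨ diag-cong a (λ i j → shuf-cong P
           λ P₁ P₂ → shuf-cong Q λ Q₁ Q₂ → *-congˡ (*-homo (⋆-linearʳ (λ β → Z β P₂) α) (θ# j Q₁) (λ γ → Z γ Q₂))) ⟨
    diag a (λ i j → shuf (λ P₁ P₂ → shuf (λ Q₁ Q₂ → θ# i P₁ * ((λ β → Z β P₂) ⋆ (λ γ → θ# j Q₁ * Z γ Q₂)) α) Q) P)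
      ≈⟨ diag-cong a (λ i j → shuf-cong P
           λ P₁ P₂ → shuf-cong Q λ Q₁ Q₂ → *-homo (⋆-linearˡ (λ γ → θ# j Q₁ * Z γ Q₂) α) (θ# i P₁) (λ β → Z β P₂)) ⟨
    diag a (λ i j → shuf (λ P₁ P₂ → shuf (λ Q₁ Q₂ → ((λ β → θ# i P₁ * Z β P₂) ⋆ (λ γ → θ# j Q₁ * Z γ Q₂)) α) Q) P)
      ≈⟨ diag-cong a (λ i j → shuf-cong P
           λ P₁ P₂ → shuf-homo (⋆-linearʳ (λ β → θ# i P₁ * Z β P₂) α) Q (λ γ Q₁ Q₂ → θ# j Q₁ * Z γ Q₂)) ⟨
    diag a (λ i j → shuf (λ P₁ P₂ → ((λ β → θ# i P₁ * Z β P₂) ⋆ (λ γ → Z (j ∷ γ) Q)) α) P)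
      ≈⟨ diag-cong a (λ i j → shuf-homo (⋆-linearˡ (λ γ → Z (j ∷ γ) Q) α) P (λ β P₁ P₂ → θ# i P₁ * Z β P₂)) ⟨
    ((λ β → Z β P) ⋆ (λ γ → Z γ Q)) (a ∷ α) ∎
    where
    Y : List V → List V → Carrier
    Y P₂ Q₂ = ((λ β → Z β P₂) ⋆ (λ γ → Z γ Q₂)) α

-- Counting colourings by expanding products of set power series.

module Counting {c ℓ} (R : CommutativeRing c ℓ) where
  open CommutativeRing R hiding (zero)
  open DiagonalSums R
  open SetoidReasoning setoid
  open Sum +-commutativeMonoid public using () renaming (sum to ∑; sum-cong-≋ to ∑-cong)
  open Sum *-commutativeMonoid public using () renaming (sum to ∏; sum-cong-≋ to ∏-cong)

  ind : ∀ {p} {P : Set p} → Dec P → Carrier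
  ind d = if does d then 1# else 0#

  ind-true : ∀ {p} {P : Set p} (P? : Dec P) → P → ind P? ≈ 1#
  ind-true P? p rewrite dec-true P? p = refl

  ind-false : ∀ {p} {P : Set p} (P? : Dec P) → ¬ P → ind P? ≈ 0#
  ind-false P? ¬p rewrite dec-false P? ¬p = refl

  ind-cong : ∀ {p q} {P : Set p} {Q : Set q} (P? : Dec P) (Q? : Dec Q) →
    (P → Q) → (Q → P) → ind P? ≈ ind Q?
  ind-cong (yes p) Q? f g = sym (ind-true Q? (f p))
  ind-cong (no ¬p) Q? f g = sym (ind-false Q? (¬p ∘ g))

  ∏-ind : ∀ {n p} {P : Pred (Fin n) p} (P? : U.Decidable P) → ∏ (ind ∘ P?) ≈ ind (Fin.all? P?)
  ∏-ind {zero}  P? = refl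
  ∏-ind {suc n} P? = trans (*-congˡ (∏-ind (P? ∘ suc))) (go (P? zero))
    where
    go : (d : Dec _) → ind d * ind (Fin.all? (P? ∘ suc)) ≈ ind (Fin.all? P?)
    go (yes p) = trans (*-identityˡ _) (ind-cong (Fin.all? (P? ∘ suc)) (Fin.all? P?)
      (λ f → λ { zero → p ; (suc i) → f i }) (λ f → f ∘ suc))
    go (no ¬p) = trans (zeroˡ _) (sym (ind-false (Fin.all? P?) λ f → ¬p (f zero)))

  count-ind : ∀ {n p} {P : Pred (Fin n) p} (P? : U.Decidable P) → count P? · 1# ≈ ∑ (ind ∘ P?)
  count-ind P? = go id
    where
    go : ∀ {k} (h : Fin k → _) → length (filter P? (tabulate h)) · 1# ≈ ∑ (ind ∘ P? ∘ h)
    go {zero}  h = refl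
    go {suc k} h with does (P? (h zero))
    ... | true  = +-congˡ (go (h ∘ suc))
    ... | false = trans (go (h ∘ suc)) (sym (+-identityˡ _))

  ∑-↑ : ∀ m k (f : Fin (m ℕ.+ k) → Carrier) → ∑ f ≈ ∑ (λ i → f (i ↑ˡ k)) + ∑ (λ j → f (m ↑ʳ j))
  ∑-↑ zero    k f = sym (+-identityˡ _)
  ∑-↑ (suc m) k f = trans (+-congˡ (∑-↑ m k (f ∘ suc))) (sym (+-assoc _ _ _))

  ∑-combine : ∀ m k (f : Fin (m ℕ.* k) → Carrier) → ∑ f ≈ ∑ {m} (λ i → ∑ (λ j → f (combine i j)))
  ∑-combine zero    k f = refl
  ∑-combine (suc m) k f = trans (∑-↑ k (m ℕ.* k) f) (+-congˡ (∑-combine m k (λ i → f (k ↑ʳ i))))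

  ∑κ : ∀ n N → ((Fin n → Fin N) → Carrier) → Carrier
  ∑κ zero    N g = g λ ()
  ∑κ (suc n) N g = ∑ {N} λ i → ∑κ n N λ κ → g (i Vector.∷ κ)

  ∑κ-cong : ∀ n {N g h} → (∀ κ → g κ ≈ h κ) → ∑κ n N g ≈ ∑κ n N h
  ∑κ-cong zero        e = e _
  ∑κ-cong (suc n) {N} e = ∑-cong {N} λ i → ∑κ-cong n λ κ → e _

  -- The decoding of `combine i c` agrees with `i` followed by the decoding of `c` only pointwise,
  -- so `g` has to respect pointwise equality.
  ∑-finToFun : ∀ n N g → (∀ {κ κ′} → κ ≗ κ′ → g κ ≈ g κ′) →
    ∑ {N ℕ.^ n} (g ∘ finToFun) ≈ ∑κ n N g
  ∑-finToFun zero    N g resp = trans (+-identityʳ _) (resp λ ())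
  ∑-finToFun (suc n) N g resp = begin
    ∑ {N ℕ.* N ℕ.^ n} (g ∘ finToFun)                          ≈⟨ ∑-combine N (N ℕ.^ n) _ ⟩
    ∑ {N} (λ i → ∑ {N ℕ.^ n} (λ c → g (finToFun (combine i c))))
      ≈⟨ ∑-cong {N} (λ i → ∑-cong {N ℕ.^ n} λ c → resp (λ
           { zero    → ≡.cong proj₁ (Fin.remQuot-combine i c)
           ; (suc v) → ≡.cong (λ p → finToFun (proj₂ p) v) (Fin.remQuot-combine i c) })) ⟩
    ∑ {N} (λ i → ∑ {N ℕ.^ n} (λ c → g (i Vector.∷ finToFun c)))
      ≈⟨ ∑-cong {N} (λ i → ∑-finToFun n N (λ κ → g (i Vector.∷ κ))
           λ e → resp λ { zero → ≡.refl ; (suc v) → e v }) ⟩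
    ∑κ (suc n) N g ∎

module _ {V : Set} where

  addTo : ∀ {N} → Fin N → V → Fin N → List V → List V
  addTo i x j S = if does (i Fin.≟ j) then x ∷ S else S

  -- The class of colour `j`, built vertex by vertex so that it unfolds in step with `⊛∏-∷`.
  block : ∀ {n N} → (Fin n → V) → (Fin n → Fin N) → Fin N → List V
  block {zero}  h κ j = []
  block {suc n} h κ j = addTo (κ zero) (h zero) j (block (h ∘ suc) (κ ∘ suc) j)

block-filter : ∀ {m n N} (κ : Fin m → Fin N) (h : Fin n → Fin m) j →
  block h (κ ∘ h) j ≡ filter (λ v → κ v Fin.≟ j) (tabulate h)
block-filter {n = zero}  κ h j = ≡.refl
block-filter {n = suc n} κ h j with does (κ (h zero) Fin.≟ j)
... | true  = ≡.cong (h zero ∷_) (block-filter κ (h ∘ suc) j)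
... | false = block-filter κ (h ∘ suc) j

module Distribution {c ℓ} (R : CommutativeRing c ℓ) (V : Set) where
  open CommutativeRing R hiding (zero)
  open Shuffle R V
  open Counting R
  open SetoidReasoning setoid

  ⊛∏ : ∀ {N} → (Fin N → List V → Carrier) → List V → Carrier
  ⊛∏ {zero}  f = ε
  ⊛∏ {suc N} f = f zero ⊛ ⊛∏ (f ∘ suc)

  ⊛∏-cong : ∀ {N} {f g : Fin N → List V → Carrier} → (∀ i S → f i S ≈ g i S) → ∀ U → ⊛∏ f U ≈ ⊛∏ g U
  ⊛∏-cong {zero}  e U = refl
  ⊛∏-cong {suc N} e U = ⊛-cong (e zero) (⊛∏-cong (e ∘ suc)) U

  ⊛-∑ : ∀ {N} f (g : Fin N → List V → Carrier) U → (f ⊛ (λ S → ∑ (λ i → g i S))) U ≈ ∑ (λ i → (f ⊛ g i) U)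
  ⊛-∑ {zero}  f g U = trans (shuf-cong U λ _ _ → zeroʳ _) (shuf-0 U)
  ⊛-∑ {suc N} f g U = trans (⊛-distribˡ f (g zero) _ U) (+-congˡ (⊛-∑ f (g ∘ suc) U))

  ⊛∏-∷ : ∀ {N} (f : Fin N → List V → Carrier) x U →
    ⊛∏ f (x ∷ U) ≈ ∑ (λ i → ⊛∏ (λ j S → f j (addTo i x j S)) U)
  ⊛∏-∷ {zero}  f x U = refl
  ⊛∏-∷ {suc N} f x U = +-congˡ (trans (⊛-cong (λ _ → refl) (⊛∏-∷ (f ∘ suc) x) U)
    (⊛-∑ (f zero) (λ i → ⊛∏ (λ j S → f (suc j) (addTo i x j S))) U))

  -- Dealing each vertex to one of `N` factors is the choice of a map `κ`, and factor `j` receives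
  -- the class of `j`.
  ⊛∏-tabulate : ∀ n {N} (f : Fin N → List V → Carrier) (h : Fin n → V) →
    ⊛∏ f (tabulate h) ≈ ∑κ n N (λ κ → ∏ (λ j → f j (block h κ j)))
  ⊛∏-tabulate zero    f h = go f
    where
    go : ∀ {N} (f : Fin N → List V → Carrier) → ⊛∏ f [] ≈ ∏ (λ j → f j [])
    go {zero}  f = refl
    go {suc N} f = *-congˡ (go (f ∘ suc))
  ⊛∏-tabulate (suc n) {N} f h = trans (⊛∏-∷ f (h zero) _)
    (∑-cong {N} λ i → ⊛∏-tabulate n (λ j S → f j (addTo i (h zero) j S)) (h ∘ suc))

adjᵇ : ∀ {n} → Graph n → Fin n → Fin n → Bool
adjᵇ G u v = does (adj? G u v)

adjᵇ-sym : ∀ {n} (G : Graph n) u v → adjᵇ G u v ≡ adjᵇ G v u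
adjᵇ-sym G u v with adj? G v u
... | yes a = dec-true (adj? G u v) (adj-sym G a)
... | no ¬a = dec-false (adj? G u v) (¬a ∘ adj-sym G)

-- Identification of the coefficients of the chromatic symmetric function with `Z`.

module Chromatic {c ℓ} (R : CommutativeRing c ℓ) {n} (G : Graph n) where
  open CommutativeRing R hiding (zero)
  open DiagonalSums R
  open Counting R
  open Shuffle R (Fin n) using (_⊛_; ⊛-cong)
  open Distribution R (Fin n)
  open Growth (adjᵇ G)
  open StableSets R (Fin n) (adjᵇ G) (adjᵇ-sym G)
  open SetoidReasoning setoid

  Adjacent : List (Fin n) → Set
  Adjacent S = ∃[ u ] ∃[ v ] u ∈ S × v ∈ S × Adj G u v

  θ-stable : ∀ B {S} → All (λ v → B v ≡ false) S → ¬ Adjacent S → θ B S ≈ 1#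
  θ-stable B [] ¬adj = refl
  θ-stable B {x ∷ S} (Bx ∷ avoid) ¬adj rewrite Bx = θ-stable (B ∪ adjᵇ G x)
    (All.tabulate λ {y} y∈ → ≡.cong₂ _∨_ (All.lookup avoid y∈)
      (dec-false (adj? G x y) λ a → ¬adj (x , y , here ≡.refl , there y∈ , a)))
    (λ (u , v , u∈ , v∈ , a) → ¬adj (u , v , there u∈ , there v∈ , a))

  θ-adjacent : ∀ B {S} → Adjacent S → θ B S ≈ 0#
  θ-adjacent B {x ∷ S} adj with B x
  θ-adjacent B {x ∷ S} adj | true = refl
  θ-adjacent B {x ∷ S} (u , v , here e , here e′ , a) | false =
    contradiction a (adj-irrefl G (≡.trans e (≡.sym e′)))
  θ-adjacent B {x ∷ S} (u , v , here ≡.refl , there v∈ , a) | false =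
    θ-meets _ (Any.map (λ { ≡.refl → ≡.trans (≡.cong (B v ∨_) (dec-true (adj? G x v) a)) (∨-zeroʳ (B v)) }) v∈)
  θ-adjacent B {x ∷ S} (u , v , there u∈ , here ≡.refl , a) | false =
    θ-meets _ (Any.map (λ { ≡.refl → ≡.trans (≡.cong (B u ∨_) (dec-true (adj? G x u) (adj-sym G a))) (∨-zeroʳ (B u)) }) u∈)
  θ-adjacent B {x ∷ S} (u , v , there u∈ , there v∈ , a) | false =
    θ-adjacent _ (u , v , u∈ , v∈ , a)

  module _ (α : List ℕ) (κ : Fin n → Fin (length α)) where
    Monochromatic : Fin (length α) → Set
    Monochromatic j = ∃[ u ] ∃[ v ] κ u ≡ j × κ v ≡ j × Adj G u v

    Good : Fin (length α) → Set
    Good j = count (λ v → κ v Fin.≟ j) ≡ lookup α j × ¬ Monochromatic j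

    monochromatic? : ∀ j → Dec (Monochromatic j)
    monochromatic? j = Fin.any? λ u → Fin.any? λ v → κ u Fin.≟ j ×-dec (κ v Fin.≟ j ×-dec adj? G u v)

    good? : ∀ j → Dec (Good j)
    good? j = (count (λ v → κ v Fin.≟ j) ℕ.≟ lookup α j) ×-dec ¬? (monochromatic? j)

    θ#-good : ∀ j → θ# (lookup α j) (block id κ j) ≈ ind (good? j)
    θ#-good j rewrite block-filter κ id j = go (count (λ v → κ v Fin.≟ j) ℕ.≟ lookup α j) (monochromatic? j)
      where
      S = filter (λ v → κ v Fin.≟ j) (allFin n)
      ∈S : ∀ u → κ u ≡ j → u ∈ S
      ∈S u = ∈-filter⁺ (λ v → κ v Fin.≟ j) (∈-allFin u)
      S∋ : ∀ u → u ∈ S → κ u ≡ j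
      S∋ u u∈ = proj₂ (∈-filter⁻ (λ v → κ v Fin.≟ j) {xs = allFin n} u∈)
      go : Dec (length S ≡ lookup α j) → Dec (Monochromatic j) → θ# (lookup α j) S ≈ ind (good? j)
      go (no ne) _ = trans (trans (*-congʳ (δ-≢ _ _ ne)) (zeroˡ _)) (sym (ind-false (good? j) (ne ∘ proj₁)))
      go (yes e) (yes m@(u , v , p , q , a)) = trans
        (trans (*-congˡ (θ-adjacent ∅ (u , v , ∈S u p , ∈S v q , a))) (zeroʳ _))
        (sym (ind-false (good? j) λ good → proj₂ good m))
      go (yes e) (no ¬m) = trans
        (trans (*-cong (trans (reflexive (≡.cong (δ (length S)) (≡.sym e))) (δ-refl (length S)))
          (θ-stable ∅ (All.universal (λ _ → ≡.refl) S) λ (u , v , u∈ , v∈ , a) →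
            ¬m (u , v , S∋ u u∈ , S∋ v v∈ , a))) (*-identityˡ _))
        (sym (ind-true (good? j) (e , ¬m)))

    ∏θ# : ∏ (λ j → θ# (lookup α j) (block id κ j)) ≈ ind (properWithContent? G α κ)
    ∏θ# = begin
      ∏ (λ j → θ# (lookup α j) (block id κ j)) ≈⟨ ∏-cong θ#-good ⟩
      ∏ (λ j → ind (good? j))                  ≈⟨ ∏-ind good? ⟩
      ind (Fin.all? good?)                     ≈⟨ ind-cong (Fin.all? good?) (properWithContent? G α κ)
        (λ good → (λ u v a e → proj₂ (good (κ u)) (u , v , ≡.refl , ≡.sym e , a)) , proj₁ ∘ good)
        (λ (p , h) j → h j , λ (u , v , e , e′ , a) → p u v a (≡.trans e (≡.sym e′))) ⟩
      ind (properWithContent? G α κ)           ∎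

  Z≈⊛∏ : ∀ α U → Z α U ≈ ⊛∏ (λ j → θ# (lookup α j)) U
  Z≈⊛∏ []      U = refl
  Z≈⊛∏ (a ∷ α) U = ⊛-cong {θ# a} (λ _ → refl) (Z≈⊛∏ α) U

  -- Expanding the product of the `θ#` over the colours gives a summand for each map; it is 1 if
  -- every class is stable and has the prescribed size, and 0 otherwise.
  #colorings≈Z : ∀ α → #colorings G α · 1# ≈ Z α (allFin n)
  #colorings≈Z α = begin
    #colorings G α · 1# ≈⟨ count-ind (λ (c : Fin (length α ℕ.^ n)) → properWithContent? G α (finToFun c)) ⟩
    ∑ {length α ℕ.^ n} (λ c → ind (properWithContent? G α (finToFun c)))
      ≈⟨ ∑-finToFun n (length α) (λ κ → ind (properWithContent? G α κ)) (λ {κ} {κ′} e →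
           ind-cong (properWithContent? G α κ) (properWithContent? G α κ′) (resp e) (resp (≡.sym ∘ e))) ⟩
    ∑κ n (length α) (λ κ → ind (properWithContent? G α κ)) ≈⟨ ∑κ-cong n (∏θ# α) ⟨
    ∑κ n (length α) (λ κ → ∏ (λ j → θ# (lookup α j) (block id κ j))) ≈⟨ ⊛∏-tabulate n _ id ⟨
    ⊛∏ (λ j → θ# (lookup α j)) (allFin n)                        ≈⟨ Z≈⊛∏ α (allFin n) ⟨
    Z α (allFin n)                                               ∎
    where
    resp : ∀ {κ κ′} → κ ≗ κ′ → ProperWithContent G α κ → ProperWithContent G α κ′
    resp e (p , h) = proper-≗ G e p , content-≗ α e h

-- Factorizations of homogeneous series over a domain.

-- The form of "integral domain" available for Cauchy reals: instead of deciding which factor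
-- vanishes, a factor is cancelled once it is known to be nonzero.
record IsStableDomain {c ℓ} (R : CommutativeRing c ℓ) : Set (c ⊔ ℓ) where
  open CommutativeRing R hiding (zero)
  field
    stable : ∀ {x} → ¬ ¬ x ≈ 0# → x ≈ 0#
    cancel : ∀ {x y} → x * y ≈ 0# → ¬ x ≈ 0# → y ≈ 0#

CharacteristicZero : ∀ {c ℓ} → CommutativeRing c ℓ → Set ℓ
CharacteristicZero R = ∀ k → ¬ suc k · 1# ≈ 0#
  where
  open CommutativeRing R hiding (zero)
  open DiagonalSums R

module Domain {c ℓ} (R : CommutativeRing c ℓ) (isStableDomain : IsStableDomain R) where
  open CommutativeRing R hiding (zero)
  open DiagonalSums R
  open IsStableDomain isStableDomain
  open SetoidReasoning setoid

  ZeroOn : ℕ → (List ℕ → Carrier) → Set ℓ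
  ZeroOn N f = ∀ α → length α ≡ N → f α ≈ 0#

  ⋆-zeroˡ : ∀ {N} f g → ZeroOn N f → ZeroOn N (f ⋆ g)
  ⋆-zeroˡ f g z []      p = trans (*-congʳ (z [] p)) (zeroˡ _)
  ⋆-zeroˡ f g z (a ∷ α) p = trans
    (diag-cong a λ i j → ⋆-zeroˡ (λ β → f (i ∷ β)) (λ γ → g (j ∷ γ))
      (λ β q → z (i ∷ β) (≡.trans (≡.cong suc q) p)) α ≡.refl)
    (diag-0 a)

  ⋆-zeroʳ : ∀ {N} f g → ZeroOn N g → ZeroOn N (f ⋆ g)
  ⋆-zeroʳ f g z α p = trans (⋆-comm f g α) (⋆-zeroˡ g f z α p)

  -- The product of the lexicographically first terms of f and g is a term of f ⋆ g.
  ⋆-cancel-length : ∀ N f g → ZeroOn N (f ⋆ g) → ¬ ZeroOn N f → ZeroOn N g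
  ⋆-cancel-length zero f g fg≈0 f≉0 [] _ =
    cancel (fg≈0 [] ≡.refl) λ f₀ → f≉0 λ { [] _ → f₀ }
  ⋆-cancel-length (suc N) f g fg≈0 f≉0 (b ∷ γ) p = stable λ gbγ≉0 →
    f≉0 λ { (a ∷ β) q → f-zero (λ g-zero → gbγ≉0 (g-zero b γ (ℕ.suc-injective p))) a β (ℕ.suc-injective q) }
    where
    f′ g′ : ℕ → List ℕ → Carrier
    f′ a β = f (a ∷ β)
    g′ b γ = g (b ∷ γ)
    -- If the slices of `f` before `a` and those of `g` before `b` vanish, then at first exponent
    -- `a + b` only the product of `f′ a` and `g′ b` remains.
    g-zero-from : ∀ a → (∀ {i} → i ℕ.< a → ZeroOn N (f′ i)) → ¬ ZeroOn N (f′ a) → ∀ b → ZeroOn N (g′ b)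
    g-zero-from a f<a fa≉0 = <-rec _ λ b g<b → ⋆-cancel-length N (f′ a) (g′ b)
      (λ α q → trans (sym (diag-single a b (λ i j → (f′ i ⋆ g′ j) α) (others b g<b α q)))
        (fg≈0 (a ℕ.+ b ∷ α) (≡.cong suc q)))
      fa≉0
      where
      others : ∀ b → (∀ {j} → j ℕ.< b → ZeroOn N (g′ j)) → ∀ α → length α ≡ N →
        ∀ i j → i ℕ.+ j ≡ a ℕ.+ b → ¬ i ≡ a → (f′ i ⋆ g′ j) α ≈ 0#
      others b g<b α q i j s i≢a with ℕ.<-cmp i a
      ... | tri< i<a _ _ = ⋆-zeroˡ (f′ i) (g′ j) (f<a i<a) α q
      ... | tri≈ _ i≡a _ = contradiction i≡a i≢a
      ... | tri> _ _ a<i = ⋆-zeroʳ (f′ i) (g′ j) (g<b (ℕ.≰⇒> λ b≤j →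
        ℕ.<-irrefl (≡.sym s) (ℕ.+-mono-<-≤ a<i b≤j))) α q
    -- Replaces the choice of the least nonzero slice of `f`: a first nonzero one would make all of
    -- `g` vanish.
    f-zero : ¬ (∀ b → ZeroOn N (g′ b)) → ∀ a → ZeroOn N (f′ a)
    f-zero g≉0 = <-rec _ λ a f<a β q → stable λ faβ≉0 →
      g≉0 (g-zero-from a f<a λ fa≈0 → faβ≉0 (fa≈0 β q))

  pad : ∀ {f} → ZeroInvariant f → ∀ α k → f (α ++ replicate k 0) ≈ f α
  pad {f} z α zero    = reflexive (≡.cong f (++-identityʳ α))
  pad {f} z α (suc k) = trans (z α (replicate k 0)) (pad {f} z α k)

  -- Nonzero coefficients of `f` and `g` may sit at lists of different lengths; zeros bring both to
  -- the length `length γ + length β`.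
  ⋆-cancel : ∀ f g → ZeroInvariant f → ZeroInvariant g → (∀ α → (f ⋆ g) α ≈ 0#) →
    ¬ (∀ β → f β ≈ 0#) → ∀ γ → g γ ≈ 0#
  ⋆-cancel f g zf zg fg≈0 f≉0 γ = stable λ gγ≉0 → f≉0 λ β → stable λ fβ≉0 → gγ≉0
    (trans (sym (pad {g} zg γ (length β)))
      (⋆-cancel-length (length γ ℕ.+ length β) f g (λ α _ → fg≈0 α)
        (λ f≈0 → fβ≉0 (trans (sym (pad {f} zf β (length γ)))
          (f≈0 (β ++ replicate (length γ) 0) (≡.trans (padded β γ) (ℕ.+-comm (length β) _)))))
        (γ ++ replicate (length β) 0) (padded γ β)))
    where
    padded : ∀ (α β : List ℕ) → length (α ++ replicate (length β) 0) ≡ length α ℕ.+ length β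
    padded α β = ≡.trans (length-++ α) (≡.cong (length α ℕ.+_) (length-replicate (length β)))

  comp : ℕ → (List ℕ → Carrier) → List ℕ → Carrier
  comp m f α = δ (sum α) m * f α

  comp-zeroInvariant : ∀ m {f} → ZeroInvariant f → ZeroInvariant (comp m f)
  comp-zeroInvariant m z β γ = *-cong
    (reflexive (≡.cong (λ s → δ s m) (≡.trans (sum-++ β (0 ∷ γ)) (≡.sym (sum-++ β γ))))) (z β γ)

  comp-≡ : ∀ {m} f α → sum α ≡ m → comp m f α ≈ f α
  comp-≡ f α ≡.refl = trans (*-congʳ (δ-refl (sum α))) (*-identityˡ _)

  comp-≢ : ∀ {m} f α → ¬ sum α ≡ m → comp m f α ≈ 0#
  comp-≢ {m} f α ne = trans (*-congʳ (δ-≢ (sum α) m ne)) (zeroˡ _)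

  DegreeAtMost : ℕ → (List ℕ → Carrier) → Set ℓ
  DegreeAtMost d f = ∀ α → d ℕ.< sum α → f α ≈ 0#

  -- In degree `m + e`, a factor of degree below its bound forces the other above its own, where it
  -- vanishes.
  comp-⋆ : ∀ {m e} f g → DegreeAtMost m f → DegreeAtMost e g →
    ∀ α → (comp m f ⋆ comp e g) α ≈ comp (m ℕ.+ e) (f ⋆ g) α
  comp-⋆ {m} {e} f g degf degg α = trans (split-cong α terms) (split-*ˡ α (δ (sum α) (m ℕ.+ e)) _)
    where
    terms : ∀ β γ → sum β ℕ.+ sum γ ≡ sum α →
      comp m f β * comp e g γ ≈ δ (sum α) (m ℕ.+ e) * (f β * g γ)
    terms β γ p with ℕ.<-cmp (sum β) m | ℕ.<-cmp (sum γ) e | sum α ℕ.≟ m ℕ.+ e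
    ... | tri≈ _ a _ | tri≈ _ b _ | yes q = trans (*-cong (comp-≡ f β a) (comp-≡ g γ b))
      (sym (trans (*-congʳ (trans (reflexive (≡.cong (λ s → δ s (m ℕ.+ e)) q)) (δ-refl (m ℕ.+ e)))) (*-identityˡ _)))
    ... | tri≈ _ a _ | tri≈ _ b _ | no ne = contradiction (≡.trans (≡.sym p) (≡.cong₂ ℕ._+_ a b)) ne
    ... | tri> _ a≢ m<β | _ | _ = trans (trans (*-congʳ (comp-≢ f β a≢)) (zeroˡ _))
      (sym (trans (*-congˡ (trans (*-congʳ (degf β m<β)) (zeroˡ _))) (zeroʳ _)))
    ... | _ | tri> _ b≢ e<γ | _ = trans (trans (*-congˡ (comp-≢ g γ b≢)) (zeroʳ _))
      (sym (trans (*-congˡ (trans (*-congˡ (degg γ e<γ)) (zeroʳ _))) (zeroʳ _)))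
    ... | tri< a<m a≢ _ | tri< b<e _ _ | yes q = contradiction (≡.trans p q) (ℕ.<⇒≢ (ℕ.+-mono-< a<m b<e))
    ... | tri< a<m a≢ _ | tri≈ _ b _ | yes q = contradiction (≡.trans p q) (ℕ.<⇒≢ (ℕ.+-mono-<-≤ a<m (ℕ.≤-reflexive b)))
    ... | tri≈ _ a _ | tri< b<e _ _ | yes q = contradiction (≡.trans p q) (ℕ.<⇒≢ (ℕ.+-mono-≤-< (ℕ.≤-reflexive a) b<e))
    ... | tri< _ a≢ _ | _ | no ne = trans (trans (*-congʳ (comp-≢ f β a≢)) (zeroˡ _))
      (sym (trans (*-congʳ (δ-≢ (sum α) (m ℕ.+ e) ne)) (zeroˡ _)))
    ... | tri≈ _ _ _ | tri< _ b≢ _ | no ne = trans (trans (*-congˡ (comp-≢ g γ b≢)) (zeroʳ _))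
      (sym (trans (*-congʳ (δ-≢ (sum α) (m ℕ.+ e) ne)) (zeroˡ _)))

  Homogeneous : ℕ → (List ℕ → Carrier) → Set ℓ
  Homogeneous n X = ∀ α → ¬ sum α ≡ n → X α ≈ 0#

  Constant : (List ℕ → Carrier) → Set ℓ
  Constant f = ∀ α → 0 ℕ.< sum α → f α ≈ 0#

  module _ {n : ℕ} {X : List ℕ → Carrier} (hom : Homogeneous n X) (f g : List ℕ → Carrier)
    (zf : ZeroInvariant f) (zg : ZeroInvariant g) (X≈f⋆g : ∀ α → X α ≈ (f ⋆ g) α) where

    -- Induction on the degree: once the lower terms of `g` vanish, the coefficient of the product
    -- at `γ` is `f [] * g γ`, while `X` is 0 there.
    order : ¬ f [] ≈ 0# → ∀ γ → sum γ ℕ.< n → g γ ≈ 0#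
    order f₀≉0 γ lt = go (sum γ) γ ≡.refl lt
      where
      go : ∀ k γ → sum γ ≡ k → k ℕ.< n → g γ ≈ 0#
      go = <-rec _ λ { _ rec γ ≡.refl lt → cancel (begin
        f [] * g γ                          ≈⟨ *-congʳ (pad {f} zf [] (length γ)) ⟨
        f (replicate (length γ) 0) * g γ    ≈⟨ split-single γ (λ β γ′ → f β * g γ′) (λ β γ′ p β≢0 →
          let γ′<γ = ≡.subst (sum γ′ ℕ.<_) p (ℕ.m<n+m (sum γ′) (ℕ.n≢0⇒n>0 β≢0))
          in trans (*-congˡ (rec γ′<γ γ′ ≡.refl (ℕ.<-trans γ′<γ lt))) (zeroʳ _)) ⟨
        (f ⋆ g) γ                           ≈⟨ X≈f⋆g γ ⟨
        X γ                                 ≈⟨ hom γ (ℕ.<⇒≢ lt) ⟩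
        0#                                  ∎) f₀≉0 }

    -- The top degree components of f and g multiply to a nonzero component of X, whose degree is n.
    cofactor-constant : ¬ f [] ≈ 0# → ∀ d e → DegreeAtMost d f → DegreeAtMost e g → ¬ Constant g → Constant f
    cofactor-constant f₀≉0 d e degf degg g≉c α 0<α = stable λ fα≉0 → top fα≉0 e degg
      where
      -- As `comp e g` is nonzero, `order` gives `n ≤ e`. The product with the component of `f` of
      -- degree `suc m` lies in degree above `n`, where `X` vanishes, so this component is zero and
      -- the bound on `f` drops to `m`.
      lower : ∀ e → ¬ (∀ γ → comp e g γ ≈ 0#) → DegreeAtMost e g →
        ∀ m → DegreeAtMost m f → Constant f
      lower e ge≉0 degg zero    degf = degf
      lower e ge≉0 degg (suc m) degf = lower e ge≉0 degg m λ β m<β → vanish β (ℕ.m≤n⇒m<n∨m≡n m<β)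
        where
        n≤e : n ℕ.≤ e
        n≤e = ℕ.≮⇒≥ λ e<n → ge≉0 λ γ → vanishes γ (sum γ ℕ.≟ e) e<n
          where
          vanishes : ∀ γ → Dec (sum γ ≡ e) → e ℕ.< n → comp e g γ ≈ 0#
          vanishes γ (yes ≡.refl) lt = trans (*-congˡ (order f₀≉0 γ lt)) (zeroʳ _)
          vanishes γ (no ne)      lt = comp-≢ g γ ne
        product : ∀ α → (comp e g ⋆ comp (suc m) f) α ≈ 0#
        product α = trans (⋆-comm _ _ α) (trans (comp-⋆ f g degf degg α) (zero-at (sum α ℕ.≟ suc m ℕ.+ e)))
          where
          zero-at : Dec (sum α ≡ suc m ℕ.+ e) → comp (suc m ℕ.+ e) (f ⋆ g) α ≈ 0#
          zero-at (no ne)  = comp-≢ (f ⋆ g) α ne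
          zero-at (yes eq) = trans (*-congˡ (trans (sym (X≈f⋆g α)) (hom α λ α≡n →
            ℕ.<⇒≢ (ℕ.s≤s (ℕ.≤-trans n≤e (ℕ.m≤n+m e m))) (≡.trans (≡.sym α≡n) eq)))) (zeroʳ _)
        vanish : ∀ β → suc m ℕ.< sum β ⊎ suc m ≡ sum β → f β ≈ 0#
        vanish β (inj₁ lt) = degf β lt
        vanish β (inj₂ eq) = trans (sym (comp-≡ f β (≡.sym eq)))
          (⋆-cancel (comp e g) (comp (suc m) f) (comp-zeroInvariant e {g} zg) (comp-zeroInvariant (suc m) {f} zf)
            product ge≉0 β)

      -- Descends from the degree bound of `g`. If the component at the bound is zero, the bound
      -- drops; if not, `lower` applies. At bound 0 the series `g` would be constant.
      top : ¬ f α ≈ 0# → ∀ e → ¬ DegreeAtMost e g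
      top fα≉0 zero    degg = g≉c degg
      top fα≉0 (suc e) degg = fα≉0 (lower (suc e)
        (λ ge≈0 → top fα≉0 e λ γ e<γ → vanish ge≈0 γ (ℕ.m≤n⇒m<n∨m≡n e<γ))
        degg d degf α 0<α)
        where
        vanish : (∀ γ → comp (suc e) g γ ≈ 0#) → ∀ γ → suc e ℕ.< sum γ ⊎ suc e ≡ sum γ → g γ ≈ 0#
        vanish ge≈0 γ (inj₁ lt) = degg γ lt
        vanish ge≈0 γ (inj₂ eq) = trans (sym (comp-≡ g γ (≡.sym eq))) (ge≈0 γ)

  irreducible : ∀ {k X} → Homogeneous (suc k) X → ¬ χ 1 k X ≈ 0# →
    ∀ f g → ZeroInvariant f → ZeroInvariant g →
    ∀ {d e} → DegreeAtMost d f → DegreeAtMost e g → ¬ Constant f → ¬ Constant g →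
    ¬ (∀ α → X α ≈ (f ⋆ g) α)
  irreducible {k} {X} hom χ≉0 f g zf zg {d} {e} degf degg f≉c g≉c X≈f⋆g = χ≉0 (begin
    χ 1 k X                             ≈⟨ cong′ (χ-linear 1 k) X≈f⋆g ⟩
    χ 1 k (f ⋆ g)                       ≈⟨ χ-⋆ k f g zf zg ⟩
    f [] * χ 1 k g + χ 1 k f * g []     ≈⟨ +-cong (*-congʳ f₀≈0) (*-congˡ g₀≈0) ⟩
    0# * χ 1 k g + χ 1 k f * 0#         ≈⟨ +-cong (zeroˡ _) (zeroʳ _) ⟩
    0# + 0#                             ≈⟨ +-identityˡ 0# ⟩
    0#                                  ∎)
    where
    f₀≈0 : f [] ≈ 0#
    f₀≈0 = stable λ f₀≉0 → f≉c (cofactor-constant hom f g zf zg X≈f⋆g f₀≉0 d e degf degg g≉c)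
    g₀≈0 : g [] ≈ 0#
    g₀≈0 = stable λ g₀≉0 → g≉c (cofactor-constant hom g f zg zf
      (λ α → trans (X≈f⋆g α) (⋆-comm f g α)) g₀≉0 e d degg degf f≉c)

-- Reachability in graphs.

module _ {n : ℕ} (G : Graph n) where
  open Growth (adjᵇ G)

  adjᵇ⇒Adj : ∀ u v → adjᵇ G u v ≡ true → Adj G u v
  adjᵇ⇒Adj u v e with yes a ← adj? G u v = a

  grows-reachable : ∀ x {B W} → (∀ y → B y ≡ true → Star (Adj G) x y) → Grows B W → All (Star (Adj G) x) W
  grows-reachable x reach [] = []
  grows-reachable x {B} reach (_∷_ {x = w} Bw g) = reach w Bw ∷ grows-reachable x reach′ g
    where
    reach′ : ∀ y → (B ∪ adjᵇ G w) y ≡ true → Star (Adj G) x y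
    reach′ y e with B y in By
    ... | true  = reach y By
    ... | false = reach w Bw ◅◅ (adjᵇ⇒Adj w y e ◅ ∎ˢ)

  reachable⇒connected : ∀ x → (∀ v → Star (Adj G) x v) → Connected G
  reachable⇒connected x reach u v = reverse (adj-sym G) (reach u) ◅◅ reach v

  stays : ∀ {P Q u v} → Separated P Q → (∀ w → w ∈ P ++ Q) → Star (Adj G) u v → u ∈ Q → v ∈ Q
  stays sep all ∎ˢ u∈ = u∈
  stays {P} {Q} {u} sep all (_◅_ {j = w} a s) u∈ = stays {P} sep all s ([ crossing , id ]′ (∈-++⁻ P (all w)))
    where
    crossing : w ∈ P → w ∈ Q
    crossing w∈ = contradiction (≡.trans (≡.sym (dec-true (adj? G w u) (adj-sym G a)))
      (All.lookup (All.lookup sep w∈) u∈)) λ ()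

-- Connectedness and irreducibility over a domain of characteristic zero.

module Criterion {c ℓ} (R : CommutativeRing c ℓ) (isStableDomain : IsStableDomain R)
  (char0 : CharacteristicZero R) where
  open CommutativeRing R hiding (zero)
  open DiagonalSums R
  open Signs R
  open Domain R isStableDomain
  open Counting R using (∑; ∑-cong)
  open SymmetricFunctions R
  open SetoidReasoning setoid

  coeff-zeroInvariant : ∀ f → ZeroInvariant (coeff f)
  coeff-zeroInvariant f β γ = begin
    coeff f (β ++ 0 ∷ γ)        ≈⟨ symmetric f (↭-trans (shift 0 β γ) (∷↭∷ʳ 0 (β ++ γ))) ⟩
    coeff f ((β ++ γ) ++ [ 0 ]) ≈⟨ padding f (β ++ γ) ⟩
    coeff f (β ++ γ)            ∎

  ∑≈diag : ∀ a F → ∑ {suc a} (λ i → F (toℕ i) (a ℕ.∸ toℕ i)) ≈ diag a F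
  ∑≈diag zero    F = +-identityʳ _
  ∑≈diag (suc a) F = +-congˡ (∑≈diag a (λ i → F (suc i)))

  ∑-split≈split : ∀ F α → ∑-split F α ≈ split F α
  ∑-split≈split F []      = refl
  ∑-split≈split F (a ∷ α) = trans
    (∑-cong {suc a} λ i → ∑-split≈split (λ β γ → F (toℕ i ∷ β) (a ℕ.∸ toℕ i ∷ γ)) α)
    (∑≈diag a (λ i j → split (λ β γ → F (i ∷ β) (j ∷ γ)) α))

  module _ {k : ℕ} (G : Graph (suc k)) where
    open Growth (adjᵇ G)
    open StableSets R (Fin (suc k)) (adjᵇ G) (adjᵇ-sym G)
    open Chromatic R G using (#colorings≈Z)

    V : List (Fin (suc k))
    V = allFin (suc k)

    Zᴸ : List (Fin (suc k)) → Λ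
    Zᴸ U = record
      { coeff     = λ α → Z α U
      ; padding   = λ α → trans (Z-↭ (↭-sym (∷↭∷ʳ 0 α)) U) (Z-0∷ α U)
      ; symmetric = λ p → Z-↭ p U
      ; bounded   = length U , λ α lt → Z-degree α U λ e → ℕ.<-irrefl (≡.sym e) lt
      }

    X-homogeneous : Homogeneous (suc k) (coeff (X G))
    X-homogeneous α ne = trans (#colorings≈Z α)
      (Z-degree α V λ e → ne (≡.trans e (length-tabulate id)))

    zero⇒constant : (∀ α → coeff (X G) α ≈ 0#) → IsConstant (X G)
    zero⇒constant z α _ = z α

    -- Homogeneity of positive degree leaves no room for a constant term.
    Z-constant : ∀ U → 0 ℕ.< length U → IsConstant (Zᴸ U) → ∀ α → Z α U ≈ 0#
    Z-constant U 0<U const α with sum α ℕ.≟ length U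
    ... | yes e = const α (≡.subst (0 ℕ.<_) (≡.sym e) 0<U)
    ... | no ne = Z-degree α U ne

    connected-component : Component zero V
    connected-component = component zero [] (tabulate suc) [] (All.tabulate⁺ λ _ ())

    connected⇒irreducible : Connected G → Irreducible (X G)
    connected⇒irreducible conn = go connected-component
      where
      go : Component zero V → Irreducible (X G)
      -- A path from `q` to the vertex `zero` cannot leave the complement of the component, which
      -- does not contain `zero`.
      go (W , q ∷ Q , π , g , sep , 0∉) = contradiction ≡.refl (All.lookup 0∉
        (stays G {zero ∷ W} sep (λ w → ∈-resp-↭ π (∈-allFin w)) (conn q zero) (here ≡.refl)))
      go (W , [] , π , g , _ , _) = X≉const , X≉unit , λ (f , h , f≉c , h≉c , X≈fh) →
        irreducible X-homogeneous χ≉0 (coeff f) (coeff h) (coeff-zeroInvariant f) (coeff-zeroInvariant h)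
          (proj₂ (bounded f)) (proj₂ (bounded h)) f≉c h≉c
          (λ α → trans (X≈fh α) (∑-split≈split _ α))
        where
        π′ : V ↭ zero ∷ W
        π′ = ≡.subst (λ U → V ↭ zero ∷ U) (++-identityʳ W) π
        k≡W : k ≡ length W
        k≡W = ℕ.suc-injective (≡.trans (≡.sym (length-tabulate {n = suc k} id)) (↭-length π′))
        χ≈A : χ 1 k (coeff (X G)) ≈ A (zero ∷ W)
        χ≈A = begin
          χ 1 k (coeff (X G))                 ≈⟨ cong′ (χ-linear 1 k) (λ α → trans (#colorings≈Z α) (Z-symmetric α π′)) ⟩
          χ 1 k (λ α → Z α (zero ∷ W))        ≈⟨ reflexive (≡.cong (λ m → χ 1 m (λ α → Z α (zero ∷ W))) k≡W) ⟩
          A (zero ∷ W)                        ∎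
        χ≉0 : ¬ χ 1 k (coeff (X G)) ≈ 0#
        χ≉0 e = let m , p = A-≈±-suc zero W g in
          char0 m (signed≈0 (length W) (trans (sym p) (trans (sym χ≈A) e)))
        X≉const : ¬ IsConstant (X G)
        X≉const const = χ≉0 (trans (cong′ (χ-linear 1 k) X≈0) (0-homo (χ-linear 1 k)))
          where
          X≈0 : ∀ α → coeff (X G) α ≈ 0#
          X≈0 α with sum α ℕ.≟ suc k
          ... | yes e = const α (≡.subst (0 ℕ.<_) (≡.sym e) (ℕ.s≤s ℕ.z≤n))
          ... | no ne = X-homogeneous α ne
        X≉unit : ¬ IsUnit (X G)
        X≉unit (h , Xh≈1) = char0 0 (begin
          1# + 0#                     ≈⟨ +-identityʳ 1# ⟩
          1#                          ≈⟨ Xh≈1 [] ⟨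
          coeff (X G) [] * coeff h [] ≈⟨ *-congʳ (X-homogeneous [] λ ()) ⟩
          0# * coeff h []             ≈⟨ zeroˡ _ ⟩
          0#                          ∎)

    irreducible⇒connected : Irreducible (X G) → Connected G
    irreducible⇒connected (X≉const , _ , prime) = go connected-component
      where
      go : Component zero V → Connected G
      go (W , [] , π , g , _ , _) = reachable⇒connected G zero λ v → All.lookup
        (∎ˢ ∷ grows-reachable G zero (λ y e → adjᵇ⇒Adj G zero y e ◅ ∎ˢ) g)
        (∈-resp-↭ (≡.subst (λ U → V ↭ zero ∷ U) (++-identityʳ W) π) (∈-allFin v))
      go (W , Q@(_ ∷ _) , π , _ , sep , _) = contradiction
        (Zᴸ P , Zᴸ Q
          -- A constant factor is zero by `Z-constant`; then the product is zero and thus constant,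
          -- against irreducibility.
          , (λ const → X≉const (zero⇒constant λ α → trans (X≈⋆ α)
              (⋆-zeroˡ _ _ (λ β _ → Z-constant P (ℕ.s≤s ℕ.z≤n) const β) α ≡.refl)))
          , (λ const → X≉const (zero⇒constant λ α → trans (X≈⋆ α)
              (⋆-zeroʳ _ _ (λ β _ → Z-constant Q (ℕ.s≤s ℕ.z≤n) const β) α ≡.refl)))
          , λ α → trans (X≈⋆ α) (sym (∑-split≈split _ α)))
        prime
        where
        P = zero ∷ W
        X≈⋆ : ∀ α → coeff (X G) α ≈ ((λ β → Z β P) ⋆ (λ γ → Z γ Q)) α
        X≈⋆ α = begin
          coeff (X G) α                          ≈⟨ #colorings≈Z α ⟩
          Z α V                                  ≈⟨ Z-symmetric α π ⟩
          Z α (P ++ Q)                           ≈⟨ Z-++ α P Q sep ⟩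
          ((λ β → Z β P) ⋆ (λ γ → Z γ Q)) α      ∎

-- The complex numbers as a domain with stable equality and characteristic zero.

module ComplexDomain where
  open ComplexNumbers

  Eventually : (ℕ → Set) → Set
  Eventually P = ∃[ N ] (∀ n → N ℕ.≤ n → P n)

  eventually₂ : ∀ {P Q T : ℕ → Set} → (∀ n → P n → Q n → T n) → Eventually P → Eventually Q → Eventually T
  eventually₂ f (N , p) (M , q) = N ℕ.⊔ M , λ n le →
    f n (p n (ℕ.≤-trans (ℕ.m≤m⊔n N M) le)) (q n (ℕ.≤-trans (ℕ.m≤n⊔m N M) le))

  Apart : (ℕ → ℚ) → Set
  Apart z = ∃[ q ] 0ℚ ℚ.< q × Eventually (λ n → q ℚ.≤ ∣ z n ∣)

  apart⇒¬null : ∀ {z} → Apart z → ¬ Null z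
  apart⇒¬null (q , q>0 , ap) null = proj₂ both (proj₁ both) ℕ.≤-refl
    where
    both : Eventually (λ _ → ⊥)
    both = eventually₂ (λ _ a b → ℚ.<-irrefl ≡.refl (ℚ.≤-<-trans a b)) ap (null q q>0)

  ∣p∣≤∣p-q∣+∣q∣ : ∀ p q → ∣ p ∣ ℚ.≤ ∣ p ℚ.- q ∣ ℚ.+ ∣ q ∣
  ∣p∣≤∣p-q∣+∣q∣ p q = subst (λ r → ∣ r ∣ ℚ.≤ ∣ p ℚ.- q ∣ ℚ.+ ∣ q ∣) split (ℚ.∣p+q∣≤∣p∣+∣q∣ (p ℚ.- q) q)
    where
    split : (p ℚ.- q) ℚ.+ q ≡ p
    split = ≡.trans (ℚ.+-assoc p (ℚ.- q) q)
      (≡.trans (≡.cong (p ℚ.+_) (ℚ.+-inverseˡ q)) (ℚ.+-identityʳ p))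

  -- A decidable substitute for "zero or nonzero": a rational comparison at one late index settles
  -- which alternative is given.
  small-or-apart : ∀ x ε → 0ℚ ℚ.< ε → Eventually (λ n → ∣ seq x n ∣ ℚ.< ε) ⊎ Apart (seq x)
  small-or-apart x ε ε>0 = go (cauchy x q q>0)
    where
    -- The comparison is with two thirds of `ε`. Later terms move by less than one third, so they
    -- stay below `ε` or stay at least `q`.
    q = (ℤ.1ℤ ℚ./ 3) ℚ.* ε
    q>0 : 0ℚ ℚ.< q
    q>0 = subst (ℚ._< q) (ℚ.*-zeroʳ (ℤ.1ℤ ℚ./ 3)) (ℚ.*-monoʳ-<-pos (ℤ.1ℤ ℚ./ 3) ε>0)
    thirds : q ℚ.+ (q ℚ.+ q) ≡ ε
    thirds = ≡.trans (≡.cong (q ℚ.+_) (≡.sym (ℚ.*-distribʳ-+ ε (ℤ.1ℤ ℚ./ 3) (ℤ.1ℤ ℚ./ 3))))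
      (≡.trans (≡.sym (ℚ.*-distribʳ-+ ε (ℤ.1ℤ ℚ./ 3) (ℤ.1ℤ ℚ./ 3 ℚ.+ ℤ.1ℤ ℚ./ 3))) (ℚ.*-identityˡ ε))
    go : ∃[ N ] (∀ m n → N ℕ.≤ m → N ℕ.≤ n → ∣ seq x m ℚ.- seq x n ∣ ℚ.< q) →
      Eventually (λ n → ∣ seq x n ∣ ℚ.< ε) ⊎ Apart (seq x)
    go (N , near) with ∣ seq x N ∣ ℚ.<? q ℚ.+ q
    ... | yes lt = inj₁ (N , λ n le → subst (∣ seq x n ∣ ℚ.<_) thirds
      (ℚ.≤-<-trans (∣p∣≤∣p-q∣+∣q∣ (seq x n) (seq x N)) (ℚ.+-mono-< (near n N le ℕ.≤-refl) lt)))
    ... | no ≮ = inj₂ (q , q>0 , N , λ n le → ℚ.≮⇒≥ λ xn<q → ≮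
      (ℚ.≤-<-trans (∣p∣≤∣p-q∣+∣q∣ (seq x N) (seq x n)) (ℚ.+-mono-< (near N n ℕ.≤-refl le) xn<q)))

  opaque
    unfolding _*ᴿ_

    ≈0⇒null : ∀ {x} → x ≈ᴿ 0ᴿ → Null (seq x)
    ≈0⇒null {x} e ε ε>0 = proj₁ (null e ε ε>0) , λ n le →
      subst (λ r → ∣ r ∣ ℚ.< ε) (ℚ.+-identityʳ (seq x n)) (proj₂ (null e ε ε>0) n le)

    null⇒≈0 : ∀ {x} → Null (seq x) → x ≈ᴿ 0ᴿ
    null⇒≈0 {x} z = mk≈ λ ε ε>0 → proj₁ (z ε ε>0) , λ n le →
      subst (λ r → ∣ r ∣ ℚ.< ε) (≡.sym (ℚ.+-identityʳ (seq x n))) (proj₂ (z ε ε>0) n le)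

    seq-* : ∀ x y n → seq (x *ᴿ y) n ≡ seq x n ℚ.* seq y n
    seq-* x y n = ≡.refl

    seq-+ : ∀ x y n → seq (x +ᴿ y) n ≡ seq x n ℚ.+ seq y n
    seq-+ x y n = ≡.refl

    seq-0 : ∀ n → seq 0ᴿ n ≡ 0ℚ
    seq-0 n = ≡.refl

    seq-1 : ∀ n → seq 1ᴿ n ≡ 1ℚ
    seq-1 n = ≡.refl

  -- For each `ε` the second alternative of `small-or-apart` is excluded. Stability and cancellation
  -- both rest on this.
  ¬apart⇒≈0 : ∀ x → ¬ Apart (seq x) → x ≈ᴿ 0ᴿ
  ¬apart⇒≈0 x ¬ap = null⇒≈0 λ ε ε>0 → go (small-or-apart x ε ε>0)
    where
    go : ∀ {ε} → Eventually (λ n → ∣ seq x n ∣ ℚ.< ε) ⊎ Apart (seq x) → Eventually (λ n → ∣ seq x n ∣ ℚ.< ε)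
    go (inj₁ small) = small
    go (inj₂ ap)    = contradiction ap ¬ap

  ᴿ-stable : ∀ {x} → ¬ ¬ x ≈ᴿ 0ᴿ → x ≈ᴿ 0ᴿ
  ᴿ-stable {x} ¬¬e = ¬apart⇒≈0 x λ ap → ¬¬e λ e → apart⇒¬null ap (≈0⇒null e)

  -- If `y` were eventually at least `q` in modulus, the terms of `x` would be at most those of the
  -- product divided by `q`, so `x` would be zero.
  ᴿ-cancel : ∀ {x y} → x *ᴿ y ≈ᴿ 0ᴿ → ¬ x ≈ᴿ 0ᴿ → y ≈ᴿ 0ᴿ
  ᴿ-cancel {x} {y} xy≈0 x≉0 = ¬apart⇒≈0 y λ ap → x≉0 (null⇒≈0 (x-null ap))
    where
    x-null : Apart (seq y) → Null (seq x)
    x-null (q , q>0 , ap) ε ε>0 = eventually₂ bound ap (≈0⇒null xy≈0 (q ℚ.* ε) qε>0)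
      where
      instance
        q-pos = ℚ.positive q>0
        q-nonNeg = ℚ.pos⇒nonNeg q
      qε>0 : 0ℚ ℚ.< q ℚ.* ε
      qε>0 = subst (ℚ._< q ℚ.* ε) (ℚ.*-zeroʳ q) (ℚ.*-monoʳ-<-pos q ε>0)
      bound : ∀ n → q ℚ.≤ ∣ seq y n ∣ → ∣ seq (x *ᴿ y) n ∣ ℚ.< q ℚ.* ε → ∣ seq x n ∣ ℚ.< ε
      bound n q≤y xy<qε = ℚ.*-cancelˡ-<-nonNeg q (begin-strict
        q ℚ.* ∣ seq x n ∣           ≤⟨ ℚ.*-monoʳ-≤-nonNeg ∣ seq x n ∣ {{ℚ.∣-∣-nonNeg (seq x n)}} q≤y ⟩
        ∣ seq y n ∣ ℚ.* ∣ seq x n ∣ ≡⟨ ℚ.*-comm ∣ seq y n ∣ ∣ seq x n ∣ ⟩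
        ∣ seq x n ∣ ℚ.* ∣ seq y n ∣ ≡⟨ ℚ.∣p*q∣≡∣p∣*∣q∣ (seq x n) (seq y n) ⟨
        ∣ seq x n ℚ.* seq y n ∣     ≡⟨ ≡.cong ∣_∣ (seq-* x y n) ⟨
        ∣ seq (x *ᴿ y) n ∣          <⟨ xy<qε ⟩
        q ℚ.* ε                     ∎)
        where open ℚ.≤-Reasoning

  0≤p*p : ∀ p → 0ℚ ℚ.≤ p ℚ.* p
  0≤p*p p with ℚ.≤-total 0ℚ p
  ... | inj₁ 0≤p = ℚ.nonNegative⁻¹ (p ℚ.* p) {{ℚ.nonNeg*nonNeg⇒nonNeg p {{ℚ.nonNegative 0≤p}} p {{ℚ.nonNegative 0≤p}}}}
  ... | inj₂ p≤0 = ℚ.nonNegative⁻¹ (p ℚ.* p) {{ℚ.nonPos*nonPos⇒nonPos p {{ℚ.nonPositive p≤0}} p {{ℚ.nonPositive p≤0}}}}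

  sumOfSquares : ∀ x y → x *ᴿ x +ᴿ y *ᴿ y ≈ᴿ 0ᴿ → x ≈ᴿ 0ᴿ
  sumOfSquares x y e = ¬apart⇒≈0 x λ (q , q>0 , ap) → apart⇒¬null (apart q q>0 ap) (≈0⇒null e)
    where
    apart : ∀ q → 0ℚ ℚ.< q → Eventually (λ n → q ℚ.≤ ∣ seq x n ∣) → Apart (seq (x *ᴿ x +ᴿ y *ᴿ y))
    apart q q>0 (N , ap) = q ℚ.* q , qq>0 , N , λ n le → begin
        q ℚ.* q                       ≤⟨ ℚ.*-monoʳ-≤-nonNeg q (ap n le) ⟩
        ∣ seq x n ∣ ℚ.* q             ≤⟨ ℚ.*-monoˡ-≤-nonNeg ∣ seq x n ∣ {{ℚ.∣-∣-nonNeg (seq x n)}} (ap n le) ⟩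
        ∣ seq x n ∣ ℚ.* ∣ seq x n ∣   ≡⟨ ℚ.∣p*q∣≡∣p∣*∣q∣ (seq x n) (seq x n) ⟨
        ∣ xx n ∣                      ≡⟨ ℚ.0≤p⇒∣p∣≡p (0≤p*p (seq x n)) ⟩
        xx n                          ≡⟨ ℚ.+-identityʳ (xx n) ⟨
        xx n ℚ.+ 0ℚ                   ≤⟨ ℚ.+-monoʳ-≤ (xx n) (0≤p*p (seq y n)) ⟩
        xx n ℚ.+ yy n                 ≡⟨ ℚ.0≤p⇒∣p∣≡p (ℚ.+-mono-≤ (0≤p*p (seq x n)) (0≤p*p (seq y n))) ⟨
        ∣ xx n ℚ.+ yy n ∣             ≡⟨ ≡.cong ∣_∣ (≡.trans (seq-+ (x *ᴿ x) (y *ᴿ y) n)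
                                           (≡.cong₂ ℚ._+_ (seq-* x x n) (seq-* y y n))) ⟨
        ∣ seq (x *ᴿ x +ᴿ y *ᴿ y) n ∣  ∎
      where
      open ℚ.≤-Reasoning
      instance
        q-pos = ℚ.positive q>0
        q-nonNeg = ℚ.pos⇒nonNeg q
      xx yy : ℕ → ℚ
      xx n = seq x n ℚ.* seq x n
      yy n = seq y n ℚ.* seq y n
      qq>0 : 0ℚ ℚ.< q ℚ.* q
      qq>0 = subst (ℚ._< q ℚ.* q) (ℚ.*-zeroʳ q) (ℚ.*-monoʳ-<-pos q q>0)

  module ℝR = CommutativeRing ℝ-commutativeRing
  open NaturalCoefficients ℝR.commutativeSemiring using (solve; _:=_; _:+_; _:*_)
  open import Algebra.Properties.Group ℝR.+-group using (x∙y⁻¹≈ε⇒x≈y)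

  -- Multiplication by the conjugate of `z` turns the equation into `s` times `w` equals 0, where
  -- `s` is the squared modulus of `z`. The vanishing real part enters as `ac≈bd`, free of negation,
  -- as the semiring solver requires.
  ᶜ-cancel : ∀ {z w} → z *ᶜ w ≈ᶜ 0ᶜ → ¬ z ≈ᶜ 0ᶜ → w ≈ᶜ 0ᶜ
  ᶜ-cancel {a +i b} {c +i d} (re≈0 , im≈0) z≉0 = ᴿ-cancel sc≈0 s≉0 , ᴿ-cancel sd≈0 s≉0
    where
    open import Relation.Binary.Reasoning.Setoid ℝR.setoid
    s = a *ᴿ a +ᴿ b *ᴿ b
    s≉0 : ¬ s ≈ᴿ 0ᴿ
    s≉0 e = z≉0 (sumOfSquares a b e , sumOfSquares b a (ℝR.trans (ℝR.+-comm _ _) e))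
    ac≈bd : a *ᴿ c ≈ᴿ b *ᴿ d
    ac≈bd = x∙y⁻¹≈ε⇒x≈y _ _ re≈0
    sc≈0 : s *ᴿ c ≈ᴿ 0ᴿ
    sc≈0 = begin
      s *ᴿ c
        ≈⟨ solve 3 (λ a b c → (a :* a :+ b :* b) :* c := a :* (a :* c) :+ b :* (b :* c)) ℝR.refl a b c ⟩
      a *ᴿ (a *ᴿ c) +ᴿ b *ᴿ (b *ᴿ c)    ≈⟨ ℝR.+-congʳ (ℝR.*-congˡ ac≈bd) ⟩
      a *ᴿ (b *ᴿ d) +ᴿ b *ᴿ (b *ᴿ c)
        ≈⟨ solve 4 (λ a b c d → a :* (b :* d) :+ b :* (b :* c) := b :* (a :* d :+ b :* c)) ℝR.refl a b c d ⟩
      b *ᴿ (a *ᴿ d +ᴿ b *ᴿ c)           ≈⟨ ℝR.*-congˡ im≈0 ⟩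
      b *ᴿ 0ᴿ                           ≈⟨ ℝR.zeroʳ b ⟩
      0ᴿ                                ∎
    sd≈0 : s *ᴿ d ≈ᴿ 0ᴿ
    sd≈0 = begin
      s *ᴿ d
        ≈⟨ solve 3 (λ a b d → (a :* a :+ b :* b) :* d := a :* (a :* d) :+ b :* (b :* d)) ℝR.refl a b d ⟩
      a *ᴿ (a *ᴿ d) +ᴿ b *ᴿ (b *ᴿ d)    ≈⟨ ℝR.+-congˡ (ℝR.*-congˡ ac≈bd) ⟨
      a *ᴿ (a *ᴿ d) +ᴿ b *ᴿ (a *ᴿ c)
        ≈⟨ solve 4 (λ a b c d → a :* (a :* d) :+ b :* (a :* c) := a :* (a :* d :+ b :* c)) ℝR.refl a b c d ⟩
      a *ᴿ (a *ᴿ d +ᴿ b *ᴿ c)           ≈⟨ ℝR.*-congˡ im≈0 ⟩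
      a *ᴿ 0ᴿ                           ≈⟨ ℝR.zeroʳ a ⟩
      0ᴿ                                ∎

  ℂ-isStableDomain : IsStableDomain ℂ-commutativeRing
  ℂ-isStableDomain = record
    { stable = λ ¬¬e → ᴿ-stable (λ ne → ¬¬e λ e → ne (re≈ e)) , ᴿ-stable (λ ne → ¬¬e λ e → ne (im≈ e))
    ; cancel = ᶜ-cancel
    }

  -- All terms of the sequence of the real part are at least 1.
  ℂ-characteristicZero : CharacteristicZero ℂ-commutativeRing
  ℂ-characteristicZero k e = apart⇒¬null (1ℚ , ℚ.positive⁻¹ 1ℚ , 0 , λ n _ → begin
      1ℚ                             ≤⟨ 1≤ n ⟩
      seq (re (suc k · 1ᶜ)) n        ≡⟨ ℚ.0≤p⇒∣p∣≡p (nonNeg (suc k) n) ⟨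
      ∣ seq (re (suc k · 1ᶜ)) n ∣    ∎) (≈0⇒null (re≈ e))
    where
    open DiagonalSums ℂ-commutativeRing
    open ℚ.≤-Reasoning
    nonNeg : ∀ k n → 0ℚ ℚ.≤ seq (re (k · 1ᶜ)) n
    1≤suc : ∀ k n → 1ℚ ℚ.≤ seq (re (suc k · 1ᶜ)) n
    nonNeg zero    n = ℚ.≤-reflexive (≡.sym (seq-0 n))
    nonNeg (suc k) n = ℚ.≤-trans (ℚ.<⇒≤ (ℚ.positive⁻¹ 1ℚ)) (1≤suc k n)
    1≤suc k n = begin
      1ℚ                                        ≡⟨ ℚ.+-identityʳ 1ℚ ⟨
      1ℚ ℚ.+ 0ℚ                                 ≤⟨ ℚ.+-monoʳ-≤ 1ℚ (nonNeg k n) ⟩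
      1ℚ ℚ.+ seq (re (k · 1ᶜ)) n                ≡⟨ ≡.cong (ℚ._+ seq (re (k · 1ᶜ)) n) (seq-1 n) ⟨
      seq 1ᴿ n ℚ.+ seq (re (k · 1ᶜ)) n          ≡⟨ seq-+ 1ᴿ (re (k · 1ᶜ)) n ⟨
      seq (re (suc k · 1ᶜ)) n                   ∎
    1≤ : ∀ n → 1ℚ ℚ.≤ seq (re (suc k · 1ᶜ)) n
    1≤ = 1≤suc k

mainTheorem5 : (n : ℕ) → 1 ≤ n → (F : Graph n) → IsForest F →
    IsTree F ⇔ SymmetricFunctions.Irreducible ℂ-commutativeRing (SymmetricFunctions.X ℂ-commutativeRing F)
mainTheorem5 (suc k) _ F forest = mk⇔
  (λ (_ , connected) → connected⇒irreducible F connected)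
  (λ irr → forest , irreducible⇒connected F irr)
  where
  open Criterion ℂ-commutativeRing ComplexDomain.ℂ-isStableDomain ComplexDomain.ℂ-characteristicZero
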